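{- For every $\varepsilon>0$ there exist $n_0, C, D>0$ such that for all integers $n\ge n_0$ the following holds: there is a collection $(G_i)_{i\in\mathcal I}$ of pairwise edge-disjoint graphs $G_i\subseteq K_n$, each on the same $n$ vertices, with $|\mathcal I| = \lceil D\sqrt{n/\log n}\,\rceil$, such that every $G_i$ is triangle-free, $\max_{i\in\mathcal I}\alpha(G_i)\le C\sqrt{n\log n}$, and $\sum_{i\in\mathcal I} e(G_i)\ge (1-\varepsilon)\binom{n}{2}$.
   Context: $K_n$ is the complete graph on $n$ vertices; $\alpha(G)$ denotes the independence number of $G$ and $e(G)$ its number of edges. -}

module Defs where

open import Data.Nat using (ℕ; zero; suc; _+_; _*_; _∸_; _^_; _≤_; _<_; _<ᵇ_)
open import Data.Nat.Combinatorics using (_C_)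
open import Data.Bool using (Bool; true; false; if_then_else_; _∧_)
open import Data.Fin using (Fin; toℕ)
open import Data.Fin.Subset using (Subset; _∈_; ∣_∣)
open import Data.List using (List; map; allFin)
open import Data.Nat.ListAction using (sum)
open import Data.Product using (_×_; ∃-syntax)
open import Relation.Binary.PropositionalEquality using (_≡_; _≢_)
open import Relation.Nullary using (¬_)

record Graph (n : ℕ) : Set where
  field
    adj   : Fin n → Fin n → Bool
    sym   : ∀ u v → adj u v ≡ adj v u
    irrefl : ∀ u → adj u u ≡ false
open Graph public

Adj : ∀ {n} → Graph n → Fin n → Fin n → Set
Adj G u v = adj G u v ≡ true

TriangleFree : ∀ {n} → Graph n → Set
TriangleFree G = ¬ (∃[ u ] ∃[ v ] ∃[ w ] (Adj G u v × Adj G v w × Adj G u w))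

Independent : ∀ {n} → Graph n → Subset n → Set
Independent G S = ∀ u v → u ∈ S → v ∈ S → ¬ Adj G u v

edges : ∀ {n} → Graph n → ℕ
edges {n} G = sum (map (λ u → sum (map (λ v →
  if (toℕ u <ᵇ toℕ v) ∧ adj G u v then 1 else 0) (allFin n))) (allFin n))

sumEdges : ∀ {n m} → (Fin m → Graph n) → ℕ
sumEdges {m = m} G = sum (map (λ i → edges (G i)) (allFin m))

PairwiseEdgeDisjoint : ∀ {n m} → (Fin m → Graph n) → Set
PairwiseEdgeDisjoint G = ∀ i j → i ≢ j → ∀ u v → ¬ (Adj (G i) u v × Adj (G j) u v)

-- Real-number conditions, with log = log₂ (real-valued, not rounded) and
-- rational constants, turned into exact integer inequalities.
-- For naturals x, y:   x ≤ y · log₂ n  ⇔  2^x ≤ n^y,  and  y · log₂ n < x ⇔ n^y < 2^x.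

-- α(G) ≤ (c/d) · √(n log₂ n), i.e. every independent set S satisfies
-- |S|² d² ≤ c² · n · log₂ n.
AlphaAtMost : ∀ {n} → Graph n → (c d : ℕ) → Set
AlphaAtMost {n} G c d = ∀ S → Independent G S →
  2 ^ (∣ S ∣ * ∣ S ∣ * (d * d)) ≤ n ^ (c * c * n)

-- m = ⌈ (a/b) · √(n / log₂ n) ⌉, i.e. m - 1 < x ≤ m where x = (a/b)√(n/log₂ n):
--   x ≤ m      ⇔  a² n ≤ m² b² log₂ n
--   m - 1 < x  ⇔  (m-1)² b² log₂ n < a² n     (for m ≥ 1; for m = 0 the
--                                              first condition already forces x ≤ 0)
IsCeilDSqrtNOverLog : (a b n m : ℕ) → Set
IsCeilDSqrtNOverLog a b n m =
  (n ^ ((m ∸ 1) * (m ∸ 1) * (b * b)) < 2 ^ (a * a * n)) ×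
  (2 ^ (a * a * n) ≤ n ^ (m * m * (b * b)))

-- Σ e(G_i) ≥ (1 - p/q) · C(n,2)   (q > 0).
EdgeSumBound : (p q s n : ℕ) → Set
EdgeSumBound p q s n = (q ∸ p) * (n C 2) ≤ q * s

{-# OPTIONS --safe #-}

-- Each vertex gets two random classes π₀ v, π₁ v among M = n^(7/8), each pair of vertices a random
-- side s, and each pair of classes of side s one of m ≈ √(n / log n) random colours; a pair of vertices
-- takes the colour of its two classes under the projection of its side.  So each colour class is a
-- union of two blown-up random graphs on M vertices, and since M/m² → 0 two classes rarely have a
-- common neighbour in a given colour: it is enough to discard the o(n²) pairs that close a triangle.
--
-- If I is a set of C √(n log n) vertices, then one projection, say of side s, is injective on a
-- constant fraction of I, because a random map does not concentrate on few classes in both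
-- coordinates.  Counted with multiplicity, the neighbourhoods in a sparse random graph overlap I in few
-- pairs only, so most pairs of side s inside I are not discarded because of a common neighbour.
-- Revealing the colours of side s row by row, each such pair has a given colour with probability 1/m,
-- and the probability that none has it is small enough for a union bound over all I.
--
-- Probabilities are counts, and logarithms only enter through powers of two.
module Submission where

open import Defs hiding (sym)
open import Data.Nat using (ℕ; zero; suc; _+_; _*_; _∸_; _^_; _≤_; _<_; _≤ᵇ_; _<ᵇ_; _≤?_; _<?_; z≤n; s≤s; s≤s⁻¹; NonZero; >-nonZero; _⊓_; pred; ⌊_/2⌋; ⌈_/2⌉; _/_)
open import Data.Nat.Properties
open import Data.Nat.Tactic.RingSolver using (solve-∀)
open import Algebra.Properties.Semiring.Sum +-*-semiring
  using (∑-distrib-+; ∑-comm; sum-cong-≗; *-distribˡ-sum; *-distribʳ-sum) renaming (sum to ∑)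
open import Data.Bool using (Bool; true; false; _∧_; _∨_; not; T; if_then_else_)
open import Data.Bool.Properties using (∨-comm; ∧-comm)
open import Data.Fin using (Fin; zero; suc; toℕ)
open import Data.Vec as Vec using (Vec; []; _∷_; lookup)
open import Data.Vec.Properties using (lookup⇒[]=)
open import Data.Fin.Subset using (Subset; ∣_∣)
import Data.List as List
import Data.List.Properties as List
import Data.Nat.ListAction as ListAction
open import Data.Nat.Combinatorics using (_C_; nC1≡n; nCk+nC[k+1]≡[n+1]C[k+1])
open import Data.Nat.DivMod using (m≡m%n+[m/n]*n; m%n<n; m/n*n≤m)
open import Data.Product using (_×_; _,_; proj₁; proj₂; ∃-syntax)
open import Data.Sum using (_⊎_; inj₁; inj₂)
open import Data.Empty using (⊥; ⊥-elim)
open import Data.Unit using (⊤; tt)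
open import Function using (_∘_; flip)
open import Relation.Binary.PropositionalEquality hiding (J)
open import Relation.Binary using (tri<; tri≈; tri>)
open import Relation.Nullary using (Dec; ¬_; yes; no; does)
import Data.Fin.Properties as Fin

-- Finite sums

-- Colouring the pairs of vertices directly fails: two vertices would have about n/m² ≈ log n common
-- neighbours in a given colour, so most pairs would close a triangle. Blowing up M classes lowers
-- this number to M/m², but a single blown-up graph has independent sets that are unions of whole
-- classes, too large by a factor n/M. A second projection removes them: a set that meets few
-- classes in both projections lies in a small box of pairs of classes, and boxes hold few vertices.
-- This needs M polynomially above n^(3/4), while M/m² → 0 needs M polynomially below n; 7/8 lies
-- between.
--
-- The two ways of discarding differ on purpose. In a triangle of one side it is enough to remove
-- the pair opposite the earliest class, and then the fate of a pair is known before its own row is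
-- revealed. In a triangle of both sides, two edges give the third pair a common neighbour under the
-- other projection; the matrix of the other side can be fixed beforehand, so all common neighbours
-- in it may count. Both tests look at colours and not at surviving edges, which avoids circularity.

⟦_⟧ : Bool → ℕ
⟦ true ⟧ = 1
⟦ false ⟧ = 0

∑-mono : ∀ {n} {f g : Fin n → ℕ} → (∀ i → f i ≤ g i) → ∑ f ≤ ∑ g
∑-mono {zero} f≤g = z≤n
∑-mono {suc n} f≤g = +-mono-≤ (f≤g zero) (∑-mono (f≤g ∘ suc))

∑-const : ∀ n c → ∑ {n} (λ _ → c) ≡ n * c
∑-const zero c = refl
∑-const (suc n) c = cong (c +_) (∑-const n c)

term≤∑ : ∀ {n} (f : Fin n → ℕ) i → f i ≤ ∑ f
term≤∑ f zero = m≤m+n (f zero) _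
term≤∑ f (suc i) = ≤-trans (term≤∑ (f ∘ suc) i) (m≤n+m _ (f zero))

∑-find : ∀ {n} (f g : Fin n → ℕ) → ∑ f < ∑ g → ∃[ i ] f i < g i
∑-find {suc n} f g lt with f zero <? g zero
... | yes p = zero , p
... | no ¬p with ∑-find (f ∘ suc) (g ∘ suc) (+-cancelˡ-< (f zero) _ _ (<-≤-trans lt (+-monoˡ-≤ _ (≮⇒≥ ¬p))))
...   | i , q = suc i , q

-- The exchange of two sums is a field of `Space`, so the outer sum cannot itself be a `Space`
-- there; these two laws are all that is asked of it.
record Linear {A : Set} (T : (A → ℕ) → ℕ) : Set where
  field
    T-zero : T (λ _ → 0) ≡ 0
    T-+ : ∀ f g → T (λ a → f a + g a) ≡ T f + T g
open Linear

-- A finite type, presented by its operator of summation over all elements.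
record Space (A : Set) : Set₁ where
  field
    S : (A → ℕ) → ℕ
    S-mono : ∀ {f g} → (∀ a → f a ≤ g a) → S f ≤ S g
    S-+ : ∀ f g → S (λ a → f a + g a) ≡ S f + S g
    S-* : ∀ c f → S (λ a → c * f a) ≡ c * S f
    S-find : ∀ f g → S f < S g → ∃[ a ] f a < g a
    term≤S : ∀ f a → f a ≤ S f
    S-swap : ∀ {B : Set} {T : (B → ℕ) → ℕ} → Linear T → ∀ (f : B → A → ℕ) →
      T (λ b → S (f b)) ≡ S (λ a → T (λ b → f b a))

  size : ℕ
  size = S (λ _ → 1)

  S-cong : ∀ {f g} → (∀ a → f a ≡ g a) → S f ≡ S g
  S-cong eq = ≤-antisym (S-mono (≤-reflexive ∘ eq)) (S-mono (≤-reflexive ∘ sym ∘ eq))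

  S-const : ∀ c → S (λ _ → c) ≡ c * size
  S-const c = trans (S-cong (λ _ → sym (*-identityʳ c))) (S-* c (λ _ → 1))

  S-linear : Linear S
  S-linear = record { T-zero = S-const 0 ; T-+ = S-+ }

  S-*ʳ : ∀ f c → S (λ a → f a * c) ≡ S f * c
  S-*ʳ f c = trans (S-cong (λ a → *-comm (f a) c)) (trans (S-* c f) (*-comm c (S f)))

open Space public

finSpace : ∀ n → Space (Fin n)
finSpace n = record
  { S = ∑
  ; S-mono = ∑-mono
  ; S-+ = ∑-distrib-+
  ; S-* = λ c f → sym (*-distribˡ-sum c f)
  ; S-find = ∑-find
  ; term≤S = term≤∑
  ; S-swap = swap n
  }
  where
  swap : ∀ n {B : Set} {T : (B → ℕ) → ℕ} → Linear T → ∀ (f : B → Fin n → ℕ) →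
    T (λ b → ∑ (f b)) ≡ ∑ (λ a → T (λ b → f b a))
  swap zero lin f = T-zero lin
  swap (suc n) lin f = trans (T-+ lin _ _) (cong₂ _+_ refl (swap n lin (λ b → f b ∘ suc)))

infixr 5 _×ₛ_

_×ₛ_ : ∀ {A B} → Space A → Space B → Space (A × B)
X ×ₛ Y = record
  { S = λ f → S X (λ x → S Y (λ y → f (x , y)))
  ; S-mono = λ f≤g → S-mono X (λ x → S-mono Y (λ y → f≤g (x , y)))
  ; S-+ = λ f g → trans (S-cong X (λ x → S-+ Y _ _)) (S-+ X _ _)
  ; S-* = λ c f → trans (S-cong X (λ x → S-* Y c _)) (S-* X c _)
  ; S-find = find
  ; term≤S = λ { f (x , y) → ≤-trans (term≤S Y (λ y → f (x , y)) y) (term≤S X (λ x → S Y (λ y → f (x , y))) x) }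
  ; S-swap = λ lin f → trans (S-swap X lin _) (S-cong X (λ x → S-swap Y lin _))
  }
  where
  find : ∀ f g → S X (λ x → S Y (λ y → f (x , y))) < S X (λ x → S Y (λ y → g (x , y))) → ∃[ a ] f a < g a
  find f g lt with S-find X _ _ lt
  ... | x , lt′ with S-find Y _ _ lt′
  ...   | y , lt″ = (x , y) , lt″

size-× : ∀ {A B} (X : Space A) (Y : Space B) → size (X ×ₛ Y) ≡ size X * size Y
size-× X Y = trans (S-const X (size Y)) (*-comm (size Y) (size X))

vecSpace : ∀ {A} → Space A → ∀ n → Space (Vec A n)
vecSpace X zero = record
  { S = λ f → f []
  ; S-mono = λ f≤g → f≤g []
  ; S-+ = λ f g → refl
  ; S-* = λ c f → refl
  ; S-find = λ f g lt → [] , lt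
  ; term≤S = λ { f [] → ≤-refl }
  ; S-swap = λ lin f → refl
  }
vecSpace X (suc n) = record
  { S = λ f → S P (f ∘ cons)
  ; S-mono = λ f≤g → S-mono P (f≤g ∘ cons)
  ; S-+ = λ f g → S-+ P (f ∘ cons) (g ∘ cons)
  ; S-* = λ c f → S-* P c (f ∘ cons)
  ; S-find = λ f g lt → let p , fp<gp = S-find P (f ∘ cons) (g ∘ cons) lt in cons p , fp<gp
  ; term≤S = λ { f (a ∷ v) → term≤S P (f ∘ cons) (a , v) }
  ; S-swap = λ lin f → S-swap P lin (λ b → f b ∘ cons)
  }
  where
  P = X ×ₛ vecSpace X n
  cons : _ → _
  cons (a , v) = a ∷ v

size-vec : ∀ {A} (X : Space A) n → size (vecSpace X n) ≡ size X ^ n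
size-vec X zero = refl
size-vec X (suc n) = trans (size-× X (vecSpace X n)) (cong (size X *_) (size-vec X n))

size-fin : ∀ n → size (finSpace n) ≡ n
size-fin n = trans (∑-const n 1) (*-identityʳ n)

-- Throughout, a probability or mean `s / size` of at most `P / Q` is written `s * Q ≤ P * size`,
-- without division; here `P` stands for the whole right-hand side.
union-bound : ∀ {A I} (X : Space A) (Y : Space I) (f : I → A → ℕ) {Q P} →
  (∀ i → S X (f i) * Q ≤ P) → S X (λ a → S Y (λ i → f i a)) * Q ≤ size Y * P
union-bound X Y f {Q} {P} bound = begin
  S X (λ a → S Y (λ i → f i a)) * Q  ≡⟨ cong (_* Q) (S-swap Y (S-linear X) (λ a i → f i a)) ⟩
  S Y (λ i → S X (f i)) * Q          ≡⟨ S-*ʳ Y _ Q ⟨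
  S Y (λ i → S X (f i) * Q)          ≤⟨ S-mono Y bound ⟩
  S Y (λ _ → P)                      ≡⟨ trans (S-const Y P) (*-comm P (size Y)) ⟩
  size Y * P                         ∎
  where open ≤-Reasoning

interchange : ∀ a b c d → (a * b) * (c * d) ≡ (a * c) * (b * d)
interchange = solve-∀

-- With b = 0 the left-hand side counts the v for which every X j (lookup v j) vanishes.
exponential-moment : ∀ {A} (Σ : Space A) {N} (b P Q : ℕ) (X : Fin N → A → ℕ) (Y : Fin N → ℕ) →
  (∀ j → S Σ (λ a → b ^ X j a) * Q ^ Y j ≤ P ^ Y j * size Σ) →
  S (vecSpace Σ N) (λ v → b ^ ∑ (λ j → X j (lookup v j))) * Q ^ ∑ Y ≤ P ^ ∑ Y * size (vecSpace Σ N)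
exponential-moment Σ {zero} b P Q X Y bound = ≤-refl
exponential-moment Σ {suc N} b P Q X Y bound = begin
  S Σ (λ a → S V (λ v → b ^ (X zero a + rest v))) * Q ^ (Y zero + ∑ Y′)
    ≡⟨ cong₂ _*_ split (^-distribˡ-+-* Q (Y zero) _) ⟩
  (S Σ (λ a → b ^ X zero a) * S V (λ v → b ^ rest v)) * (Q ^ Y zero * Q ^ ∑ Y′)
    ≡⟨ interchange (S Σ (λ a → b ^ X zero a)) _ _ _ ⟩
  (S Σ (λ a → b ^ X zero a) * Q ^ Y zero) * (S V (λ v → b ^ rest v) * Q ^ ∑ Y′)
    ≤⟨ *-mono-≤ (bound zero) (exponential-moment Σ b P Q (X ∘ suc) Y′ (bound ∘ suc)) ⟩
  (P ^ Y zero * size Σ) * (P ^ ∑ Y′ * size V)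
    ≡⟨ interchange (P ^ Y zero) (size Σ) _ _ ⟩
  (P ^ Y zero * P ^ ∑ Y′) * (size Σ * size V)
    ≡⟨ cong₂ _*_ (^-distribˡ-+-* P (Y zero) _) (size-× Σ V) ⟨
  P ^ (Y zero + ∑ Y′) * size (vecSpace Σ (suc N)) ∎
  where
  open ≤-Reasoning
  V = vecSpace Σ N
  Y′ = Y ∘ suc
  rest : _ → ℕ
  rest v = ∑ (λ j → X (suc j) (lookup v j))
  split : S Σ (λ a → S V (λ v → b ^ (X zero a + rest v))) ≡ S Σ (λ a → b ^ X zero a) * S V (λ v → b ^ rest v)
  split = trans
    (S-cong Σ (λ a → trans (S-cong V (λ v → ^-distribˡ-+-* b (X zero a) (rest v))) (S-* V (b ^ X zero a) _)))
    (S-*ʳ Σ _ _)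

-- Moments and adaptive exposure

infix 4 _==_

_==_ : ∀ {n} → Fin n → Fin n → Bool
x == y = does (x Fin.≟ y)

==⇒≡ : ∀ {n} (x y : Fin n) → (x == y) ≡ true → x ≡ y
==⇒≡ x y eq with x Fin.≟ y
... | yes p = p

≡⇒== : ∀ {n} {x y : Fin n} → x ≡ y → (x == y) ≡ true
≡⇒== {x = x} refl with x Fin.≟ x
... | yes _ = refl
... | no ¬p = ⊥-elim (¬p refl)

∧-split : ∀ {x y} → x ∧ y ≡ true → x ≡ true × y ≡ true
∧-split {true} {true} eq = refl , refl

∧-intro : ∀ {x y} → x ≡ true → y ≡ true → x ∧ y ≡ true
∧-intro refl refl = refl

≤ᵇ-true : ∀ {m n} → m ≤ n → (m ≤ᵇ n) ≡ true
≤ᵇ-true {m} {n} p with m ≤ᵇ n | ≤⇒≤ᵇ p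
... | true | _ = refl

true-≤ᵇ : ∀ m n → (m ≤ᵇ n) ≡ true → m ≤ n
true-≤ᵇ m n eq = ≤ᵇ⇒≤ m n (subst T (sym eq) tt)

⟦⟧-mono : ∀ {x y} → (x ≡ true → y ≡ true) → ⟦ x ⟧ ≤ ⟦ y ⟧
⟦⟧-mono {false} f = z≤n
⟦⟧-mono {true} f rewrite f refl = ≤-refl

⟦∧⟧ : ∀ x y → ⟦ x ∧ y ⟧ ≡ ⟦ x ⟧ * ⟦ y ⟧
⟦∧⟧ true y = sym (+-identityʳ ⟦ y ⟧)
⟦∧⟧ false y = refl

⟦∨⟧ : ∀ x y → ⟦ x ∨ y ⟧ ≤ ⟦ x ⟧ + ⟦ y ⟧
⟦∨⟧ true y = s≤s z≤n
⟦∨⟧ false y = ≤-refl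

⟦⟧*-mono : ∀ b {x y} → (b ≡ true → x ≤ y) → ⟦ b ⟧ * x ≤ ⟦ b ⟧ * y
⟦⟧*-mono true le = *-monoʳ-≤ 1 (le refl)
⟦⟧*-mono false le = z≤n

⟦⟧*≤ : ∀ b n → ⟦ b ⟧ * n ≤ n
⟦⟧*≤ true n = ≤-reflexive (+-identityʳ n)
⟦⟧*≤ false n = z≤n

matrixSpace : ∀ {A} → Space A → ∀ k n → Space (Vec (Vec A n) k)
matrixSpace Σ k n = vecSpace (vecSpace Σ n) k

at : ∀ {A : Set} {k n} → Vec (Vec A n) k → Fin k → Fin n → A
at ω z x = lookup (lookup ω z) x

matrix-moment : ∀ {A} (Σ : Space A) {k n} (b P Q : ℕ) (X : Fin k → Fin n → A → ℕ) (Y : Fin k → Fin n → ℕ) →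
  (∀ z x → S Σ (λ a → b ^ X z x a) * Q ^ Y z x ≤ P ^ Y z x * size Σ) →
  S (matrixSpace Σ k n) (λ ω → b ^ ∑ (λ z → ∑ (λ x → X z x (at ω z x)))) * Q ^ ∑ (λ z → ∑ (Y z))
    ≤ P ^ ∑ (λ z → ∑ (Y z)) * size (matrixSpace Σ k n)
matrix-moment Σ b P Q X Y bound =
  exponential-moment (vecSpace Σ _) b P Q (λ z row → ∑ (λ x → X z x (lookup row x))) (λ z → ∑ (Y z))
    (λ z → exponential-moment Σ b P Q (X z) (Y z) (bound z))

∑-hit : ∀ {m} b (i : Fin (suc m)) → ∑ (λ c → b ^ ⟦ c == i ⟧) ≡ m + b
∑-hit {m} b zero = begin
  b * 1 + ∑ {m} (λ _ → 1)  ≡⟨ cong₂ _+_ (*-identityʳ b) (trans (∑-const m 1) (*-identityʳ m)) ⟩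
  b + m                    ≡⟨ +-comm b m ⟩
  m + b                    ∎
  where open ≡-Reasoning
∑-hit {suc m} b (suc i) = cong suc (∑-hit b i)

∑-miss : ∀ {m} (i : Fin m) → ∑ (λ c → 0 ^ ⟦ not (c == i) ⟧) ≡ 1
∑-miss {suc m} zero = cong suc (trans (∑-const m 0) (*-zeroʳ m))
∑-miss {suc m} (suc i) = ∑-miss i

-- The moment of one uniform colour, switched on by `s`: `b = 0` gives the chance of missing `i`,
-- and `b > 1` feeds Chernoff bounds.
hit-cell : ∀ {m} b s (i : Fin (suc m)) →
  ∑ (λ c → b ^ ⟦ s ∧ (c == i) ⟧) * suc m ^ ⟦ s ⟧ ≤ (m + b) ^ ⟦ s ⟧ * size (finSpace (suc m))
hit-cell {m} b true i = ≤-reflexive (begin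
  ∑ (λ c → b ^ ⟦ c == i ⟧) * suc m ^ 1       ≡⟨ cong₂ _*_ (trans (∑-hit b i) (sym (*-identityʳ (m + b)))) (trans (*-identityʳ (suc m)) (sym (size-fin (suc m)))) ⟩
  (m + b) ^ 1 * size (finSpace (suc m))      ∎)
  where open ≡-Reasoning
hit-cell {m} b false i = ≤-reflexive (*-comm (size (finSpace (suc m))) 1)

miss-cell : ∀ {m} s (i : Fin m) →
  ∑ (λ c → 0 ^ ⟦ s ∧ not (c == i) ⟧) * m ^ ⟦ s ⟧ ≤ 1 ^ ⟦ s ⟧ * size (finSpace m)
miss-cell {m} true i = ≤-reflexive (cong₂ _*_ (∑-miss i) (trans (*-identityʳ m) (sym (size-fin m))))
miss-cell {m} false i = ≤-reflexive (*-comm (size (finSpace m)) 1)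

markov : ∀ {A} (Σ : Space A) b (X : A → ℕ) E → 0 < b →
  S Σ (λ a → ⟦ E ≤ᵇ X a ⟧) * b ^ E ≤ S Σ (λ a → b ^ X a)
markov Σ b@(suc _) X E _ = ≤-trans (≤-reflexive (sym (S-*ʳ Σ _ (b ^ E)))) (S-mono Σ step)
  where
  step : ∀ a → ⟦ E ≤ᵇ X a ⟧ * b ^ E ≤ b ^ X a
  step a with E ≤ᵇ X a in eq
  ... | true = ≤-trans (≤-reflexive (+-identityʳ (b ^ E))) (^-monoʳ-≤ b (true-≤ᵇ E (X a) eq))
  ... | false = z≤n

-- Multiply by `Q ^ (y ∸ k)` and use `P ≤ Q`. This caps the cost charged to one step of an exposure.
weaken-exponent : ∀ s {t P Q k y} → 0 < Q → P ≤ Q → k ≤ y → s * Q ^ y ≤ P ^ y * t → s * Q ^ k ≤ P ^ k * t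
weaken-exponent s {t} {P} {Q@(suc _)} {k} {y} _ P≤Q k≤y le =
  *-cancelʳ-≤ _ _ (Q ^ d) {{m^n≢0 Q d}} (begin
    s * Q ^ k * Q ^ d    ≡⟨ trans (*-assoc s _ _) (cong (s *_) (sym (^-distribˡ-+-* Q k d))) ⟩
    s * Q ^ (k + d)      ≡⟨ cong (λ e → s * Q ^ e) k+d≡y ⟩
    s * Q ^ y            ≤⟨ le ⟩
    P ^ y * t            ≡⟨ cong (λ e → P ^ e * t) k+d≡y ⟨
    P ^ (k + d) * t      ≡⟨ cong (_* t) (^-distribˡ-+-* P k d) ⟩
    P ^ k * P ^ d * t    ≤⟨ *-monoˡ-≤ t (*-monoʳ-≤ (P ^ k) (^-monoˡ-≤ d P≤Q)) ⟩
    P ^ k * Q ^ d * t    ≡⟨ swap (P ^ k) (Q ^ d) t ⟩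
    P ^ k * t * Q ^ d    ∎)
  where
  open ≤-Reasoning
  d = y ∸ k
  k+d≡y : k + d ≡ y
  k+d≡y = m+[n∸m]≡n k≤y
  swap : ∀ a b c → a * b * c ≡ a * c * b
  swap = solve-∀

raise-exponent : ∀ s {t P Q y k} → Q ≤ P → y ≤ k → s * Q ^ y ≤ P ^ y * t → s * Q ^ k ≤ P ^ k * t
raise-exponent s {t} {P} {Q} {y} {k} Q≤P y≤k le = begin
    s * Q ^ k            ≡⟨ cong (λ e → s * Q ^ e) y+d≡k ⟨
    s * Q ^ (y + d)      ≡⟨ trans (cong (s *_) (^-distribˡ-+-* Q y d)) (sym (*-assoc s _ _)) ⟩
    s * Q ^ y * Q ^ d    ≤⟨ *-mono-≤ le (^-monoˡ-≤ d Q≤P) ⟩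
    P ^ y * t * P ^ d    ≡⟨ swap (P ^ y) t (P ^ d) ⟩
    P ^ y * P ^ d * t    ≡⟨ cong (_* t) (^-distribˡ-+-* P y d) ⟨
    P ^ (y + d) * t      ≡⟨ cong (λ e → P ^ e * t) y+d≡k ⟩
    P ^ k * t            ∎
  where
  open ≤-Reasoning
  d = k ∸ y
  y+d≡k : y + d ≡ k
  y+d≡k = m+[n∸m]≡n y≤k
  swap : ∀ a b c → a * b * c ≡ a * c * b
  swap = solve-∀

-- The entries of v are revealed one by one; the values forbidden at step j (those with X j v > 0)
-- and the cost Y j v of avoiding them may depend on the entries revealed before.
adaptive-bound : ∀ {A} (Σ : Space A) {N} (P Q K : ℕ) → 0 < Q → P ≤ Q →
  (X : Fin N → Vec A N → A → ℕ) (Y : Fin N → Vec A N → ℕ) →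
  (∀ j v w → (∀ l → toℕ l < toℕ j → lookup v l ≡ lookup w l) → (∀ a → X j v a ≡ X j w a) × Y j v ≡ Y j w) →
  (∀ j v → S Σ (λ a → 0 ^ X j v a) * Q ^ Y j v ≤ P ^ Y j v * size Σ) →
  Vec A N →
  S (vecSpace Σ N) (λ v → ⟦ K ≤ᵇ ∑ (λ j → Y j v) ⟧ * 0 ^ ∑ (λ j → X j v (lookup v j))) * Q ^ K
    ≤ P ^ K * size (vecSpace Σ N)
adaptive-bound Σ {zero} P Q zero _ _ X Y adapted bound _ = ≤-refl
adaptive-bound Σ {zero} P Q (suc K) _ _ X Y adapted bound _ = z≤n
adaptive-bound Σ {suc N} P Q K 0<Q P≤Q X Y adapted bound (a₀ ∷ v₀) = begin
  S Σ (λ a → S V (λ v → ⟦ K ≤ᵇ Y zero (a ∷ v) + restY a v ⟧ * 0 ^ (X zero (a ∷ v) a + restX a v))) * Q ^ K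
    ≤⟨ *-monoˡ-≤ (Q ^ K) (S-mono Σ (λ a → ≤-trans (S-mono V (step a)) (≤-reflexive (S-* V (0 ^ x a) _)))) ⟩
  S Σ (λ a → 0 ^ x a * R a) * Q ^ K
    ≡⟨ S-*ʳ Σ _ (Q ^ K) ⟨
  S Σ (λ a → 0 ^ x a * R a * Q ^ K)
    ≤⟨ S-mono Σ inner ⟩
  S Σ (λ a → 0 ^ x a * (Q ^ (y ⊓ K) * (P ^ (K ∸ y) * size V)))
    ≡⟨ S-*ʳ Σ _ _ ⟩
  S Σ (λ a → 0 ^ x a) * (Q ^ (y ⊓ K) * (P ^ (K ∸ y) * size V))
    ≡⟨ *-assoc (S Σ (λ a → 0 ^ x a)) _ _ ⟨
  S Σ (λ a → 0 ^ x a) * Q ^ (y ⊓ K) * (P ^ (K ∸ y) * size V)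
    -- Only `y ⊓ K` is charged to the first step, so that the exponents add up to `K` even when this
    -- step alone exceeds it.
    ≤⟨ *-monoˡ-≤ (P ^ (K ∸ y) * size V) (weaken-exponent (S Σ (λ a → 0 ^ x a)) 0<Q P≤Q (m⊓n≤m y K) (bound zero (a₀ ∷ v₀))) ⟩
  P ^ (y ⊓ K) * size Σ * (P ^ (K ∸ y) * size V)
    ≡⟨ interchange (P ^ (y ⊓ K)) (size Σ) _ _ ⟩
  P ^ (y ⊓ K) * P ^ (K ∸ y) * (size Σ * size V)
    ≡⟨ cong₂ _*_ (trans (sym (^-distribˡ-+-* P (y ⊓ K) _)) (cong (P ^_) (m⊓n+n∸m≡n y K))) (sym (size-× Σ V)) ⟩
  P ^ K * size (vecSpace Σ (suc N)) ∎
  where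
  open ≤-Reasoning
  V = vecSpace Σ N
  restY restX : _ → _ → ℕ
  restY a v = ∑ (λ j → Y (suc j) (a ∷ v))
  restX a v = ∑ (λ j → X (suc j) (a ∷ v) (lookup v j))
  -- No entry is known yet, so by `adapted` the first cost and the first forbidden values are the
  -- same for all vectors; they are read off the given one.
  y = Y zero (a₀ ∷ v₀)
  x = X zero (a₀ ∷ v₀)
  R : _ → ℕ
  R a = S V (λ v → ⟦ K ∸ y ≤ᵇ restY a v ⟧ * 0 ^ restX a v)
  step : ∀ a v → ⟦ K ≤ᵇ Y zero (a ∷ v) + restY a v ⟧ * 0 ^ (X zero (a ∷ v) a + restX a v)
    ≤ 0 ^ x a * (⟦ K ∸ y ≤ᵇ restY a v ⟧ * 0 ^ restX a v)
  step a v = begin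
    ⟦ K ≤ᵇ Y zero (a ∷ v) + restY a v ⟧ * 0 ^ (X zero (a ∷ v) a + restX a v)
      ≡⟨ cong₂ (λ s t → ⟦ K ≤ᵇ s + restY a v ⟧ * 0 ^ (t + restX a v)) (proj₂ same) (proj₁ same a) ⟩
    ⟦ K ≤ᵇ y + restY a v ⟧ * 0 ^ (x a + restX a v)
      ≤⟨ *-monoˡ-≤ _ (⟦⟧-mono {K ≤ᵇ y + restY a v} (λ p → ≤ᵇ-true (m≤n+o⇒m∸n≤o K y (true-≤ᵇ K (y + restY a v) p)))) ⟩
    ⟦ K ∸ y ≤ᵇ restY a v ⟧ * 0 ^ (x a + restX a v)
      ≡⟨ cong (⟦ K ∸ y ≤ᵇ restY a v ⟧ *_) (^-distribˡ-+-* 0 (x a) _) ⟩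
    ⟦ K ∸ y ≤ᵇ restY a v ⟧ * (0 ^ x a * 0 ^ restX a v)
      ≡⟨ exchange ⟦ K ∸ y ≤ᵇ restY a v ⟧ (0 ^ x a) _ ⟩
    0 ^ x a * (⟦ K ∸ y ≤ᵇ restY a v ⟧ * 0 ^ restX a v) ∎
    where
    same = adapted zero (a ∷ v) (a₀ ∷ v₀) (λ l ())
    exchange : ∀ a b c → a * (b * c) ≡ b * (a * c)
    exchange = solve-∀
  inner : ∀ a → 0 ^ x a * R a * Q ^ K ≤ 0 ^ x a * (Q ^ (y ⊓ K) * (P ^ (K ∸ y) * size V))
  inner a = begin
    0 ^ x a * R a * Q ^ K
      ≡⟨ cong (0 ^ x a * R a *_) (trans (cong (Q ^_) (sym (m⊓n+n∸m≡n y K))) (^-distribˡ-+-* Q (y ⊓ K) _)) ⟩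
    0 ^ x a * R a * (Q ^ (y ⊓ K) * Q ^ (K ∸ y))
      ≡⟨ arrange (0 ^ x a) (R a) (Q ^ (y ⊓ K)) (Q ^ (K ∸ y)) ⟩
    0 ^ x a * (Q ^ (y ⊓ K) * (R a * Q ^ (K ∸ y)))
      ≤⟨ *-monoʳ-≤ (0 ^ x a) (*-monoʳ-≤ (Q ^ (y ⊓ K))
           (adaptive-bound Σ P Q (K ∸ y) 0<Q P≤Q (λ j v → X (suc j) (a ∷ v)) (λ j v → Y (suc j) (a ∷ v))
             (λ j v w same → adapted (suc j) (a ∷ v) (a ∷ w) λ { zero _ → refl ; (suc l) (s≤s p) → same l p })
             (λ j v → bound (suc j) (a ∷ v)) v₀)) ⟩
    0 ^ x a * (Q ^ (y ⊓ K) * (P ^ (K ∸ y) * size V)) ∎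
    where
    arrange : ∀ a b c d → a * b * (c * d) ≡ a * (c * (b * d))
    arrange = solve-∀

-- Subsets of finite sets

# : ∀ {n} → (Fin n → Bool) → ℕ
# P = ∑ (λ x → ⟦ P x ⟧)

#-mono : ∀ {n} {P R : Fin n → Bool} → (∀ x → P x ≡ true → R x ≡ true) → # P ≤ # R
#-mono P⊆R = ∑-mono (λ x → ⟦⟧-mono (P⊆R x))

abstract
  ex : ∀ {n} → (Fin n → Bool) → Bool
  ex P = 1 ≤ᵇ # P

  ex-intro : ∀ {n} (P : Fin n → Bool) x → P x ≡ true → ex P ≡ true
  ex-intro P x px = ≤ᵇ-true (≤-trans (≤-reflexive (cong ⟦_⟧ (sym px))) (term≤∑ (λ x → ⟦ P x ⟧) x))

  ex-elim : ∀ {n} (P : Fin n → Bool) → ex P ≡ true → ∃[ x ] P x ≡ true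
  ex-elim {n} P eq with ∑-find (λ _ → 0) (λ x → ⟦ P x ⟧)
    (subst (_< # P) (sym (trans (∑-const n 0) (*-zeroʳ n))) (true-≤ᵇ 1 (# P) eq))
  ... | x , lt with P x in px
  ...   | true = x , px

  ⟦ex⟧≤# : ∀ {n} (P : Fin n → Bool) → ⟦ ex P ⟧ ≤ # P
  ⟦ex⟧≤# P with # P
  ... | zero = z≤n
  ... | suc k = s≤s z≤n

  ex-cong : ∀ {n} {P R : Fin n → Bool} → (∀ x → P x ≡ R x) → ex P ≡ ex R
  ex-cong eq = cong (1 ≤ᵇ_) (sum-cong-≗ (λ x → cong ⟦_⟧ (eq x)))

∑-zero : ∀ {n} {f : Fin n → ℕ} → (∀ x → f x ≡ 0) → ∑ f ≡ 0
∑-zero {n} eq = trans (sum-cong-≗ eq) (trans (∑-const n 0) (*-zeroʳ n))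

∑-δ : ∀ {n} (y : Fin n) (g : Fin n → ℕ) → ∑ (λ x → ⟦ y == x ⟧ * g x) ≡ g y
∑-δ {suc n} zero g = trans (cong₂ _+_ (+-identityʳ (g zero)) (∑-zero {n} {λ _ → 0} (λ _ → refl))) (+-identityʳ (g zero))
∑-δ (suc y) g = ∑-δ y (g ∘ suc)

#-singleton : ∀ {n} (y : Fin n) → # (y ==_) ≡ 1
#-singleton y = trans (sum-cong-≗ (λ x → sym (*-identityʳ ⟦ y == x ⟧))) (∑-δ y (λ _ → 1))

-- Taking the least elements makes the chosen set precede all that is left; this later puts one half
-- of a transversal wholly before the other.
take-first : ∀ {n} (P : Fin n → Bool) h → h ≤ # P → ∃[ Z ]
  ((∀ x → Z x ≡ true → P x ≡ true) × # Z ≡ h ×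
   (∀ x y → Z x ≡ true → P y ≡ true → Z y ≡ false → toℕ x < toℕ y))
take-first {n} P zero _ = (λ _ → false) , (λ x ()) , ∑-zero {n} (λ _ → refl) , λ x y ()
take-first {suc n} P (suc h) h≤ with P zero in p₀
... | true with take-first (P ∘ suc) h (s≤s⁻¹ h≤)
...   | Z , Z⊆P , #Z , lo = Z′ , sub , cong suc #Z , ord
  where
  Z′ : Fin (suc n) → Bool
  Z′ zero = true
  Z′ (suc x) = Z x
  sub : ∀ x → Z′ x ≡ true → P x ≡ true
  sub zero _ = p₀
  sub (suc x) zx = Z⊆P x zx
  ord : ∀ x y → Z′ x ≡ true → P y ≡ true → Z′ y ≡ false → toℕ x < toℕ y
  ord zero (suc y) _ _ _ = s≤s z≤n
  ord (suc x) (suc y) zx py zy = s≤s (lo x y zx py zy)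
take-first {suc n} P (suc h) h≤ | false with take-first (P ∘ suc) (suc h) h≤
...   | Z , Z⊆P , #Z , lo = Z′ , sub , #Z , ord
  where
  Z′ : Fin (suc n) → Bool
  Z′ zero = false
  Z′ (suc x) = Z x
  sub : ∀ x → Z′ x ≡ true → P x ≡ true
  sub (suc x) zx = Z⊆P x zx
  ord : ∀ x y → Z′ x ≡ true → P y ≡ true → Z′ y ≡ false → toℕ x < toℕ y
  ord (suc x) zero _ py _ with () ← trans (sym py) p₀
  ord (suc x) (suc y) zx py zy = s≤s (lo x y zx py zy)

_∖_ : ∀ {n} → (Fin n → Bool) → (Fin n → Bool) → Fin n → Bool
(P ∖ Z) x = P x ∧ not (Z x)

∑-split : ∀ {n} (P Z : Fin n → Bool) (g : Fin n → ℕ) → (∀ x → Z x ≡ true → P x ≡ true) →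
  ∑ (λ x → ⟦ P x ⟧ * g x) ≡ ∑ (λ x → ⟦ Z x ⟧ * g x) + ∑ (λ x → ⟦ (P ∖ Z) x ⟧ * g x)
∑-split P Z g Z⊆P = trans (sum-cong-≗ point) (∑-distrib-+ (λ x → ⟦ Z x ⟧ * g x) _)
  where
  point : ∀ x → ⟦ P x ⟧ * g x ≡ ⟦ Z x ⟧ * g x + ⟦ (P ∖ Z) x ⟧ * g x
  point x with Z x in zx | P x in px
  ... | true | true = sym (+-identityʳ _)
  ... | true | false with () ← trans (sym (Z⊆P x zx)) px
  ... | false | true = refl
  ... | false | false = refl

#-split : ∀ {n} (P Z : Fin n → Bool) → (∀ x → Z x ≡ true → P x ≡ true) → # P ≡ # Z + # (P ∖ Z)
#-split P Z Z⊆P = begin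
  # P                                                        ≡⟨ unit P ⟩
  ∑ (λ x → ⟦ P x ⟧ * 1)                                      ≡⟨ ∑-split P Z (λ _ → 1) Z⊆P ⟩
  ∑ (λ x → ⟦ Z x ⟧ * 1) + ∑ (λ x → ⟦ (P ∖ Z) x ⟧ * 1)        ≡⟨ cong₂ _+_ (unit Z) (unit (P ∖ Z)) ⟨
  # Z + # (P ∖ Z)                                            ∎
  where
  open ≡-Reasoning
  unit : ∀ R → # R ≡ ∑ (λ x → ⟦ R x ⟧ * 1)
  unit R = sum-cong-≗ (λ x → sym (*-identityʳ ⟦ R x ⟧))

-- Union bounds over sets of `h` elements run over vectors of length `h`, of which there are
-- `n ^ h`; repetitions and permutations only overcount.
mem : ∀ {n h} → Vec (Fin n) h → Fin n → Bool
mem [] x = false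
mem (y ∷ ys) x = (y == x) ∨ mem ys x

#-mem : ∀ {n h} (ys : Vec (Fin n) h) → # (mem ys) ≤ h
#-mem {n} [] = ≤-reflexive (∑-zero {n} (λ _ → refl))
#-mem {n} {suc h} (y ∷ ys) = begin
  ∑ (λ x → ⟦ (y == x) ∨ mem ys x ⟧)      ≤⟨ ∑-mono (λ x → ⟦∨⟧ (y == x) (mem ys x)) ⟩
  ∑ (λ x → ⟦ y == x ⟧ + ⟦ mem ys x ⟧)    ≡⟨ ∑-distrib-+ (λ x → ⟦ y == x ⟧) _ ⟩
  # (y ==_) + # (mem ys)                 ≤⟨ +-mono-≤ (≤-reflexive (#-singleton y)) (#-mem ys) ⟩
  suc h                                  ∎
  where open ≤-Reasoning

enumerate : ∀ {n} (P : Fin n → Bool) → Vec (Fin n) (# P)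
enumerate {zero} P = []
enumerate {suc n} P with P zero
... | true = zero ∷ Vec.map suc (enumerate (P ∘ suc))
... | false = Vec.map suc (enumerate (P ∘ suc))

mem-map-suc : ∀ {n h} (ys : Vec (Fin n) h) x → mem (Vec.map suc ys) (suc x) ≡ mem ys x
mem-map-suc [] x = refl
mem-map-suc (y ∷ ys) x = cong ((y == x) ∨_) (mem-map-suc ys x)

mem-map-suc-zero : ∀ {n h} (ys : Vec (Fin n) h) → mem (Vec.map suc ys) zero ≡ false
mem-map-suc-zero [] = refl
mem-map-suc-zero (y ∷ ys) = mem-map-suc-zero ys

mem-enumerate : ∀ {n} (P : Fin n → Bool) x → mem (enumerate P) x ≡ P x
mem-enumerate {suc n} P x with P zero in p₀
mem-enumerate {suc n} P zero | true = sym p₀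
mem-enumerate {suc n} P zero | false = trans (mem-map-suc-zero (enumerate (P ∘ suc))) (sym p₀)
mem-enumerate {suc n} P (suc x) | true = trans (mem-map-suc (enumerate (P ∘ suc)) x) (mem-enumerate (P ∘ suc) x)
mem-enumerate {suc n} P (suc x) | false = trans (mem-map-suc (enumerate (P ∘ suc)) x) (mem-enumerate (P ∘ suc) x)

enumerate-exact : ∀ {n} (P : Fin n → Bool) h → # P ≡ h → ∃[ ys ] (∀ x → mem {n} {h} ys x ≡ P x)
enumerate-exact P .(# P) refl = enumerate P , mem-enumerate P

mem-padRight : ∀ {n h k} (le : h ≤ k) d (ys : Vec (Fin n) h) x → mem ys x ≡ true → mem (Vec.padRight le d ys) x ≡ true
mem-padRight (s≤s le) d (y ∷ ys) x eq with y == x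
... | true = refl
... | false = mem-padRight le d ys x eq

enumerate-cover : ∀ {n} (P : Fin n → Bool) h → Fin n → # P ≤ h → ∃[ ys ] (∀ x → P x ≡ true → mem {n} {h} ys x ≡ true)
enumerate-cover P h d le = Vec.padRight le d (enumerate P) ,
  λ x px → mem-padRight le d (enumerate P) x (trans (mem-enumerate P x) px)

-- Pairs with a common neighbour

∑-exchange : ∀ {k n} (p : Fin k → ℕ) (q : Fin n → ℕ) (r : Fin k → Fin n → ℕ) →
  ∑ (λ z → p z * ∑ (λ x → q x * r z x)) ≡ ∑ (λ x → q x * ∑ (λ z → p z * r z x))
∑-exchange p q r = begin
  ∑ (λ z → p z * ∑ (λ x → q x * r z x))      ≡⟨ sum-cong-≗ (λ z → *-distribˡ-sum (p z) (λ x → q x * r z x)) ⟩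
  ∑ (λ z → ∑ (λ x → p z * (q x * r z x)))    ≡⟨ ∑-comm (λ z x → p z * (q x * r z x)) ⟩
  ∑ (λ x → ∑ (λ z → p z * (q x * r z x)))    ≡⟨ sum-cong-≗ (λ x → sum-cong-≗ (λ z → exchange (p z) (q x) (r z x))) ⟩
  ∑ (λ x → ∑ (λ z → q x * (p z * r z x)))    ≡⟨ sum-cong-≗ (λ x → *-distribˡ-sum (q x) (λ z → p z * r z x)) ⟨
  ∑ (λ x → q x * ∑ (λ z → p z * r z x))      ∎
  where
  open ≡-Reasoning
  exchange : ∀ p q r → p * (q * r) ≡ q * (p * r)
  exchange = solve-∀

-- Cut `T` into pieces of exactly `t` elements and one smaller rest: at most 1 + |T|/t pieces, each
-- of cost at most `B`.
∑-chunks : ∀ {n} (g : Fin n → ℕ) t B → 0 < t → (∀ T → # T ≤ t → ∑ (λ x → ⟦ T x ⟧ * g x) ≤ B) →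
  ∀ T → t * ∑ (λ x → ⟦ T x ⟧ * g x) ≤ B * (t + # T)
∑-chunks {n} g t B 0<t small T = go (# T) T ≤-refl
  where
  e : (Fin n → Bool) → ℕ
  e T = ∑ (λ x → ⟦ T x ⟧ * g x)
  go : ∀ fuel T → # T ≤ fuel → t * e T ≤ B * (t + # T)
  go fuel T #T≤ with # T ≤? t
  ... | yes le = begin
    t * e T            ≤⟨ *-monoʳ-≤ t (small T le) ⟩
    t * B              ≡⟨ *-comm t B ⟩
    B * t              ≤⟨ *-monoʳ-≤ B (m≤m+n t (# T)) ⟩
    B * (t + # T)      ∎
    where open ≤-Reasoning
  go zero T #T≤ | no ≰t = ⊥-elim (≰t (≤-trans #T≤ z≤n))
  go (suc fuel) T #T≤ | no ≰t with take-first T t (<⇒≤ (≰⇒> ≰t))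
  ... | Z , Z⊆T , #Z , _ = begin
    t * e T                            ≡⟨ cong (t *_) (∑-split T Z g Z⊆T) ⟩
    t * (e Z + e (T ∖ Z))              ≡⟨ *-distribˡ-+ t (e Z) _ ⟩
    t * e Z + t * e (T ∖ Z)            ≤⟨ +-mono-≤ (≤-trans (*-monoʳ-≤ t (small Z (≤-reflexive #Z))) (≤-reflexive (*-comm t B)))
                                                   (go fuel (T ∖ Z) rest≤) ⟩
    B * t + B * (t + # (T ∖ Z))        ≡⟨ *-distribˡ-+ B t _ ⟨
    B * (t + (t + # (T ∖ Z)))          ≡⟨ cong (λ s → B * (t + s)) #T ⟨
    B * (t + # T)                      ∎
    where
    open ≤-Reasoning
    #T : # T ≡ t + # (T ∖ Z)
    #T = trans (#-split T Z Z⊆T) (cong (_+ # (T ∖ Z)) #Z)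
    rest≤ : # (T ∖ Z) ≤ fuel
    rest≤ = s≤s⁻¹ (≤-trans (+-monoˡ-≤ _ 0<t) (≤-trans (≤-reflexive (sym #T)) #T≤))

∑-<ᵇ : ∀ f a → a ≤ f → ∑ {f} (λ p → ⟦ toℕ p <ᵇ a ⟧) ≡ a
∑-<ᵇ zero zero _ = refl
∑-<ᵇ (suc f) zero _ = ∑-zero {f} {λ _ → 0} (λ _ → refl)
∑-<ᵇ (suc f) (suc a) (s≤s le) = cong suc (∑-<ᵇ f a le)

-- A weight a ≤ f is the sum of the indicators of its f level sets.
∑-weighted : ∀ {n} (g a : Fin n → ℕ) t B f → 0 < t → (∀ T → # T ≤ t → ∑ (λ x → ⟦ T x ⟧ * g x) ≤ B) →
  (∀ x → a x ≤ f) → t * ∑ (λ x → a x * g x) ≤ B * (f * t + ∑ a)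
∑-weighted {n} g a t B f 0<t small a≤f = begin
  t * ∑ (λ x → a x * g x)
    ≡⟨ cong (t *_) (trans (sum-cong-≗ λ x → trans (cong (_* g x) (sym (∑-<ᵇ f (a x) (a≤f x)))) (*-distribʳ-sum {f} (g x) _))
         (∑-comm (λ x p → ⟦ L p x ⟧ * g x))) ⟩
  t * ∑ {f} (λ p → ∑ (λ x → ⟦ L p x ⟧ * g x))
    ≡⟨ *-distribˡ-sum t (λ p → ∑ (λ x → ⟦ L p x ⟧ * g x)) ⟩
  ∑ {f} (λ p → t * ∑ (λ x → ⟦ L p x ⟧ * g x))
    ≤⟨ ∑-mono (λ p → ∑-chunks g t B 0<t small (L p)) ⟩
  ∑ {f} (λ p → B * (t + # (L p)))
    ≡⟨ *-distribˡ-sum B (λ p → t + # (L p)) ⟨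
  B * ∑ {f} (λ p → t + # (L p))
    ≡⟨ cong (B *_) (trans (∑-distrib-+ {f} (λ _ → t) _) (cong₂ _+_ (∑-const f t)
         (trans (sym (∑-comm (λ x p → ⟦ L p x ⟧))) (sum-cong-≗ (λ x → ∑-<ᵇ f (a x) (a≤f x)))))) ⟩
  B * (f * t + ∑ a) ∎
  where
  open ≤-Reasoning
  L : Fin f → Fin n → Bool
  L p x = toℕ p <ᵇ a x

module _ {k n : ℕ} (W : Fin k → Fin n → Bool) (D b t : ℕ)
  (row≤ : ∀ z → ∑ (λ x → ⟦ W z x ⟧) ≤ D) (col≤ : ∀ x → ∑ (λ z → ⟦ W z x ⟧) ≤ D) (0<t : 0 < t)
  (sparse : ∀ Z T → # Z ≤ t → # T ≤ t → ∑ (λ z → ⟦ Z z ⟧ * ∑ (λ x → ⟦ T x ⟧ * ⟦ W z x ⟧)) ≤ b * t) where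

  -- Rows of weight at most 2bf are controlled by the column degrees; by sparsity there are at most
  -- t heavier rows, of total weight at most 2bft, and these are controlled by the row degrees.
  weighted-degree-square : ∀ (a : Fin n → ℕ) f → (∀ x → a x ≤ f) → ∑ a ≤ f * t →
    ∑ (λ z → ∑ (λ x → a x * ⟦ W z x ⟧) * ∑ (λ x → a x * ⟦ W z x ⟧)) ≤ 4 * (b * f * (f * t) * D)
  weighted-degree-square a f a≤f ∑a≤ = begin
    ∑ (λ z → w z * w z)
      ≤⟨ ∑-mono split ⟩
    ∑ (λ z → θ * w z + f * D * (⟦ H z ⟧ * w z))
      ≡⟨ trans (∑-distrib-+ (λ z → θ * w z) _) (cong₂ _+_ (sym (*-distribˡ-sum θ w)) (sym (*-distribˡ-sum (f * D) (λ z → ⟦ H z ⟧ * w z)))) ⟩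
    θ * ∑ w + f * D * ∑ (λ z → ⟦ H z ⟧ * w z)
      ≤⟨ +-mono-≤ (*-monoʳ-≤ θ ∑w≤) (*-monoʳ-≤ (f * D) (on-small H #H≤)) ⟩
    θ * (f * t * D) + f * D * (θ * t)
      ≡⟨ total b f t D ⟩
    4 * (b * f * (f * t) * D) ∎
    where
    open ≤-Reasoning
    w : Fin k → ℕ
    w z = ∑ (λ x → a x * ⟦ W z x ⟧)
    θ = 2 * (b * f)
    H : Fin k → Bool
    H z = suc θ ≤ᵇ w z
    total : ∀ b f t D → 2 * (b * f) * (f * t * D) + f * D * (2 * (b * f) * t) ≡ 4 * (b * f * (f * t) * D)
    total = solve-∀
    regroup : ∀ b t f → b * t * (f * t + f * t) ≡ t * (2 * (b * f) * t)
    regroup = solve-∀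
    on-small : ∀ Z → # Z ≤ t → ∑ (λ z → ⟦ Z z ⟧ * w z) ≤ θ * t
    on-small Z #Z≤ = *-cancelˡ-≤ t {{>-nonZero 0<t}} (begin
      t * ∑ (λ z → ⟦ Z z ⟧ * w z)
        ≡⟨ cong (t *_) (∑-exchange (λ z → ⟦ Z z ⟧) a (λ z x → ⟦ W z x ⟧)) ⟩
      t * ∑ (λ x → a x * g x)
        ≤⟨ ∑-weighted g a t (b * t) f 0<t small a≤f ⟩
      b * t * (f * t + ∑ a)
        ≤⟨ *-monoʳ-≤ (b * t) (+-monoʳ-≤ (f * t) ∑a≤) ⟩
      b * t * (f * t + f * t)
        ≡⟨ regroup b t f ⟩
      t * (θ * t) ∎)
      where
      g : Fin n → ℕ
      g x = ∑ (λ z → ⟦ Z z ⟧ * ⟦ W z x ⟧)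
      small : ∀ T → # T ≤ t → ∑ (λ x → ⟦ T x ⟧ * g x) ≤ b * t
      small T #T≤ = begin
        ∑ (λ x → ⟦ T x ⟧ * g x)
          ≡⟨ ∑-exchange (λ z → ⟦ Z z ⟧) (λ x → ⟦ T x ⟧) (λ z x → ⟦ W z x ⟧) ⟨
        ∑ (λ z → ⟦ Z z ⟧ * ∑ (λ x → ⟦ T x ⟧ * ⟦ W z x ⟧))
          ≤⟨ sparse Z T #Z≤ #T≤ ⟩
        b * t ∎
    #H≤ : # H ≤ t
    #H≤ with # H ≤? t
    ... | yes le = le
    ... | no ≰t with take-first H t (<⇒≤ (≰⇒> ≰t))
    ...   | Z , Z⊆H , #Z , _ = ⊥-elim (<⇒≱ absurd (on-small Z (≤-reflexive #Z)))
      where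
      heavy : ∀ z → suc θ * ⟦ Z z ⟧ ≤ ⟦ Z z ⟧ * w z
      heavy z with Z z in zz
      ... | true = ≤-trans (≤-reflexive (*-identityʳ (suc θ))) (≤-trans (true-≤ᵇ (suc θ) (w z) (Z⊆H z zz)) (≤-reflexive (sym (+-identityʳ (w z)))))
      ... | false = ≤-reflexive (*-zeroʳ (suc θ))
      absurd : θ * t < ∑ (λ z → ⟦ Z z ⟧ * w z)
      absurd = begin-strict
        θ * t                        <⟨ +-monoˡ-≤ (θ * t) 0<t ⟩
        suc θ * t                    ≡⟨ cong (suc θ *_) #Z ⟨
        suc θ * # Z                  ≡⟨ *-distribˡ-sum (suc θ) (λ z → ⟦ Z z ⟧) ⟩
        ∑ (λ z → suc θ * ⟦ Z z ⟧)    ≤⟨ ∑-mono heavy ⟩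
        ∑ (λ z → ⟦ Z z ⟧ * w z)      ∎
    w≤ : ∀ z → w z ≤ f * D
    w≤ z = begin
      w z                             ≤⟨ ∑-mono (λ x → *-monoˡ-≤ ⟦ W z x ⟧ (a≤f x)) ⟩
      ∑ (λ x → f * ⟦ W z x ⟧)         ≡⟨ *-distribˡ-sum f (λ x → ⟦ W z x ⟧) ⟨
      f * ∑ (λ x → ⟦ W z x ⟧)         ≤⟨ *-monoʳ-≤ f (row≤ z) ⟩
      f * D                           ∎
    split : ∀ z → w z * w z ≤ θ * w z + f * D * (⟦ H z ⟧ * w z)
    split z with suc θ ≤ᵇ w z in heavy
    ... | true = ≤-trans (*-monoˡ-≤ (w z) (w≤ z)) (≤-trans (≤-reflexive (cong (f * D *_) (sym (+-identityʳ (w z))))) (m≤n+m _ (θ * w z)))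
    ... | false = ≤-trans (*-monoˡ-≤ (w z) (light (≰⇒> (λ le → false≢true (trans (sym heavy) (≤ᵇ-true le)))))) (m≤m+n (θ * w z) _)
      where
      light : w z < suc θ → w z ≤ θ
      light = s≤s⁻¹
      false≢true : false ≡ true → ⊥
      false≢true ()
    ∑w≤ : ∑ w ≤ f * t * D
    ∑w≤ = begin
      ∑ w                                            ≡⟨ ∑-comm (λ z x → a x * ⟦ W z x ⟧) ⟩
      ∑ (λ x → ∑ (λ z → a x * ⟦ W z x ⟧))            ≡⟨ sum-cong-≗ (λ x → *-distribˡ-sum (a x) (λ z → ⟦ W z x ⟧)) ⟨
      ∑ (λ x → a x * ∑ (λ z → ⟦ W z x ⟧))            ≤⟨ ∑-mono (λ x → *-monoʳ-≤ (a x) (col≤ x)) ⟩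
      ∑ (λ x → a x * D)                              ≡⟨ *-distribʳ-sum D a ⟨
      ∑ a * D                                        ≤⟨ *-monoˡ-≤ D ∑a≤ ⟩
      f * t * D                                      ∎

-- What the count of closed pairs uses of a colour class. A t by t block has mean t²/m, and in the
-- application t/m is below a negative power of n, so `b` can be an absolute constant.
record Spread {k n : ℕ} (W : Fin k → Fin n → Bool) (D b t : ℕ) : Set where
  field
    row≤ : ∀ z → ∑ (λ x → ⟦ W z x ⟧) ≤ D
    col≤ : ∀ x → ∑ (λ z → ⟦ W z x ⟧) ≤ D
    sparse : ∀ Z T → # Z ≤ t → # T ≤ t → ∑ (λ z → ⟦ Z z ⟧ * ∑ (λ x → ⟦ T x ⟧ * ⟦ W z x ⟧)) ≤ b * t
open Spread

transpose-spread : ∀ {k n} {W : Fin k → Fin n → Bool} {D b t} → Spread W D b t → Spread (flip W) D b t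
transpose-spread {W = W} sp = record
  { row≤ = col≤ sp
  ; col≤ = row≤ sp
  ; sparse = λ Z T #Z≤ #T≤ → ≤-trans
      (≤-reflexive (∑-exchange (λ z → ⟦ Z z ⟧) (λ x → ⟦ T x ⟧) (λ z x → ⟦ W x z ⟧)))
      (sparse sp T Z #T≤ #Z≤)
  }

-- A matrix is read as a graph through its entries above the diagonal.
adj↑ : ∀ {n} → (Fin n → Fin n → Bool) → Fin n → Fin n → Bool
adj↑ W x y = ((toℕ x <ᵇ toℕ y) ∧ W x y) ∨ ((toℕ y <ᵇ toℕ x) ∧ W y x)

closed : ∀ {n} → (Fin n → Fin n → Bool) → Fin n → Fin n → Bool
closed W x y = ex (λ z → adj↑ W z x ∧ adj↑ W z y)

⟦adj↑⟧≤ : ∀ {n} (W : Fin n → Fin n → Bool) x y → ⟦ adj↑ W x y ⟧ ≤ ⟦ W x y ⟧ + ⟦ W y x ⟧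
⟦adj↑⟧≤ W x y = ≤-trans (⟦∨⟧ ((toℕ x <ᵇ toℕ y) ∧ W x y) _)
  (+-mono-≤ (⟦⟧-mono {(toℕ x <ᵇ toℕ y) ∧ W x y} (proj₂ ∘ ∧-split {toℕ x <ᵇ toℕ y}))
            (⟦⟧-mono {(toℕ y <ᵇ toℕ x) ∧ W y x} (proj₂ ∘ ∧-split {toℕ y <ᵇ toℕ x})))

square-+ : ∀ a b → (a + b) * (a + b) ≤ 2 * (a * a + b * b)
square-+ a b with ≤-total a b
... | inj₁ a≤b = subst (λ b → (a + b) * (a + b) ≤ 2 * (a * a + b * b)) (m+[n∸m]≡n a≤b) (ordered a (b ∸ a))
  where
  ordered : ∀ a d → (a + (a + d)) * (a + (a + d)) ≤ 2 * (a * a + (a + d) * (a + d))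
  ordered a d = ≤-trans (m≤m+n _ (d * d)) (≤-reflexive (identity a d))
    where
    identity : ∀ a d → (a + (a + d)) * (a + (a + d)) + d * d ≡ 2 * (a * a + (a + d) * (a + d))
    identity = solve-∀
... | inj₂ b≤a = subst (λ a → (a + b) * (a + b) ≤ 2 * (a * a + b * b)) (m+[n∸m]≡n b≤a) (ordered b (a ∸ b))
  where
  ordered : ∀ b d → ((b + d) + b) * ((b + d) + b) ≤ 2 * ((b + d) * (b + d) + b * b)
  ordered b d = ≤-trans (m≤m+n _ (d * d)) (≤-reflexive (identity b d))
    where
    identity : ∀ b d → ((b + d) + b) * ((b + d) + b) + d * d ≡ 2 * ((b + d) * (b + d) + b * b)
    identity = solve-∀

∑-fibres : ∀ {n M} (π : Fin n → Fin M) (p : Fin n → ℕ) (g : Fin M → ℕ) →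
  ∑ (λ u → p u * g (π u)) ≡ ∑ (λ x → ∑ (λ u → p u * ⟦ π u == x ⟧) * g x)
∑-fibres π p g = begin
  ∑ (λ u → p u * g (π u))                              ≡⟨ sum-cong-≗ (λ u → cong (p u *_) (∑-δ (π u) g)) ⟨
  ∑ (λ u → p u * ∑ (λ x → ⟦ π u == x ⟧ * g x))         ≡⟨ sum-cong-≗ (λ u → cong (p u *_) (sum-cong-≗ (λ x → *-comm ⟦ π u == x ⟧ (g x)))) ⟩
  ∑ (λ u → p u * ∑ (λ x → g x * ⟦ π u == x ⟧))         ≡⟨ ∑-exchange p g (λ u x → ⟦ π u == x ⟧) ⟩
  ∑ (λ x → g x * ∑ (λ u → p u * ⟦ π u == x ⟧))         ≡⟨ sum-cong-≗ (λ x → *-comm (g x) _) ⟩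
  ∑ (λ x → ∑ (λ u → p u * ⟦ π u == x ⟧) * g x)         ∎
  where open ≡-Reasoning

-- Push `I` forward along `π`: the weight of a class is the number of its preimages in `I`, at most
-- `f`, and the total weight is the size of `I`.
fibre-degree-square : ∀ {n M} {W : Fin M → Fin M → Bool} {D b t} → Spread W D b t → 0 < t →
  ∀ (π : Fin n → Fin M) f → (∀ x → # (λ u → π u == x) ≤ f) → ∀ I → # I ≤ f * t →
  ∑ (λ z → ∑ (λ u → ⟦ I u ⟧ * ⟦ W z (π u) ⟧) * ∑ (λ u → ⟦ I u ⟧ * ⟦ W z (π u) ⟧)) ≤ 4 * (b * f * (f * t) * D)
fibre-degree-square {W = W} {D} {b} {t} sp 0<t π f fibre≤ I #I≤ = ≤-trans
  (≤-reflexive (sum-cong-≗ (λ z → cong₂ _*_ (∑-fibres π (λ u → ⟦ I u ⟧) (λ x → ⟦ W z x ⟧)) (∑-fibres π (λ u → ⟦ I u ⟧) (λ x → ⟦ W z x ⟧)))))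
  (weighted-degree-square W D b t (row≤ sp) (col≤ sp) 0<t (sparse sp) a f
    (λ x → ≤-trans (∑-mono (λ u → ⟦⟧*≤ (I u) ⟦ π u == x ⟧)) (fibre≤ x))
    (≤-trans (≤-reflexive ∑a) #I≤))
  where
  a : _ → ℕ
  a x = ∑ (λ u → ⟦ I u ⟧ * ⟦ π u == x ⟧)
  ∑a : ∑ a ≡ # I
  ∑a = trans (sum-cong-≗ (λ x → sym (*-identityʳ (a x))))
      (trans (sym (∑-fibres π (λ u → ⟦ I u ⟧) (λ _ → 1))) (sum-cong-≗ (λ u → *-identityʳ ⟦ I u ⟧)))

-- A closed pair comes from a path of length two with some centre z, so the squares of the degrees
-- into `I` bound their number. Since `adj↑` reads either `W z x` or `W x z`, a degree is at most a
-- row degree plus a column degree; the transposed matrix handles the latter, and 2 * (4 + 4) = 16.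
closed-pairs : ∀ {n M} {W : Fin M → Fin M → Bool} {D b t} → Spread W D b t → 0 < t →
  ∀ (π : Fin n → Fin M) f → (∀ x → # (λ u → π u == x) ≤ f) → ∀ I → # I ≤ f * t →
  ∑ (λ u → ⟦ I u ⟧ * ∑ (λ v → ⟦ I v ⟧ * ⟦ closed W (π u) (π v) ⟧)) ≤ 16 * (b * f * (f * t) * D)
closed-pairs {W = W} {D} {b} {t} sp 0<t π f fibre≤ I #I≤ = begin
  ∑ (λ u → i u * ∑ (λ v → i v * ⟦ closed W (π u) (π v) ⟧))
    ≤⟨ ∑-mono (λ u → *-monoʳ-≤ (i u) (∑-mono (λ v → *-monoʳ-≤ (i v) (witness u v)))) ⟩
  ∑ (λ u → i u * ∑ (λ v → i v * ∑ (λ z → A z u * A z v)))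
    ≡⟨ sum-cong-≗ (λ u → cong (i u *_) (∑-exchange i (A′ u) (λ v z → A z v))) ⟩
  ∑ (λ u → i u * ∑ (λ z → A z u * ∑ (λ v → i v * A z v)))
    ≡⟨ sum-cong-≗ (λ u → cong (i u *_) (sum-cong-≗ (λ z → *-comm (A z u) _))) ⟩
  ∑ (λ u → i u * ∑ (λ z → ∑ (λ v → i v * A z v) * A z u))
    ≡⟨ ∑-exchange i (λ z → ∑ (λ v → i v * A z v)) (λ u z → A z u) ⟩
  ∑ (λ z → ∑ (λ v → i v * A z v) * ∑ (λ u → i u * A z u))
    ≤⟨ ∑-mono (λ z → ≤-trans (*-mono-≤ (both z) (both z)) (square-+ (w z) (w′ z))) ⟩
  ∑ (λ z → 2 * (w z * w z + w′ z * w′ z))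
    ≡⟨ trans (sym (*-distribˡ-sum 2 (λ z → w z * w z + w′ z * w′ z))) (cong (2 *_) (∑-distrib-+ (λ z → w z * w z) _)) ⟩
  2 * (∑ (λ z → w z * w z) + ∑ (λ z → w′ z * w′ z))
    ≤⟨ *-monoʳ-≤ 2 (+-mono-≤ (fibre-degree-square sp 0<t π f fibre≤ I #I≤)
                             (fibre-degree-square (transpose-spread sp) 0<t π f fibre≤ I #I≤)) ⟩
  2 * (4 * B + 4 * B)
    ≡⟨ total B ⟩
  16 * B ∎
  where
  open ≤-Reasoning
  B = b * f * (f * t) * D
  total : ∀ B → 2 * (4 * B + 4 * B) ≡ 16 * B
  total = solve-∀
  i : _ → ℕ
  i u = ⟦ I u ⟧
  A : _ → _ → ℕ
  A z u = ⟦ adj↑ W z (π u) ⟧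
  A′ : _ → _ → ℕ
  A′ u z = A z u
  w w′ : _ → ℕ
  w z = ∑ (λ u → i u * ⟦ W z (π u) ⟧)
  w′ z = ∑ (λ u → i u * ⟦ W (π u) z ⟧)
  witness : ∀ u v → ⟦ closed W (π u) (π v) ⟧ ≤ ∑ (λ z → A z u * A z v)
  witness u v = ≤-trans (⟦ex⟧≤# (λ z → adj↑ W z (π u) ∧ adj↑ W z (π v)))
    (≤-reflexive (sum-cong-≗ (λ z → ⟦∧⟧ (adj↑ W z (π u)) _)))
  both : ∀ z → ∑ (λ u → i u * A z u) ≤ w z + w′ z
  both z = ≤-trans
    (∑-mono (λ u → ≤-trans (*-monoʳ-≤ (i u) (⟦adj↑⟧≤ W z (π u))) (≤-reflexive (*-distribˡ-+ (i u) _ _))))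
    (≤-reflexive (∑-distrib-+ (λ u → i u * ⟦ W z (π u) ⟧) _))

-- The graphs

<ᵇ-true : ∀ {m n} → m < n → (m <ᵇ n) ≡ true
<ᵇ-true {m} {n} p with m <ᵇ n | <⇒<ᵇ p
... | true | _ = refl

true-<ᵇ : ∀ m n → (m <ᵇ n) ≡ true → m < n
true-<ᵇ m n eq = <ᵇ⇒< m n (subst T (sym eq) tt)

<ᵇ-irrefl : ∀ m → (m <ᵇ m) ≡ false
<ᵇ-irrefl zero = refl
<ᵇ-irrefl (suc m) = <ᵇ-irrefl m

∨-elim : ∀ {x y} → x ∨ y ≡ true → x ≡ true ⊎ y ≡ true
∨-elim {true} _ = inj₁ refl
∨-elim {false} eq = inj₂ eq

∨-introʳ : ∀ x {y} → y ≡ true → x ∨ y ≡ true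
∨-introʳ true _ = refl
∨-introʳ false eq = eq

not-true : ∀ {x} → not x ≡ true → x ≡ false
not-true {false} _ = refl

true≢false : ∀ {x} → x ≡ true → x ≡ false → ⊥
true≢false refl ()

module _ {n : ℕ} (W : Fin n → Fin n → Bool) where

  adj↑-sym : ∀ x y → adj↑ W x y ≡ adj↑ W y x
  adj↑-sym x y = ∨-comm ((toℕ x <ᵇ toℕ y) ∧ W x y) _

  adj↑-irrefl : ∀ x → adj↑ W x x ≡ false
  adj↑-irrefl x rewrite <ᵇ-irrefl (toℕ x) = refl

  adj↑-elim : ∀ x y → adj↑ W x y ≡ true → (toℕ x < toℕ y × W x y ≡ true) ⊎ (toℕ y < toℕ x × W y x ≡ true)
  adj↑-elim x y eq with ∨-elim {(toℕ x <ᵇ toℕ y) ∧ W x y} eq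
  ... | inj₁ p = inj₁ (true-<ᵇ (toℕ x) (toℕ y) (proj₁ (∧-split {toℕ x <ᵇ toℕ y} p)) , proj₂ (∧-split {toℕ x <ᵇ toℕ y} p))
  ... | inj₂ p = inj₂ (true-<ᵇ (toℕ y) (toℕ x) (proj₁ (∧-split {toℕ y <ᵇ toℕ x} p)) , proj₂ (∧-split {toℕ y <ᵇ toℕ x} p))

  adj↑-intro : ∀ x y → toℕ x < toℕ y → W x y ≡ true → adj↑ W x y ≡ true
  adj↑-intro x y x<y wxy rewrite <ᵇ-true x<y | wxy = refl

  -- Only rows earlier than both `x` and `y` are consulted, so the value is settled before either of
  -- these rows is revealed.
  below : Fin n → Fin n → Bool
  below x y = ex (λ z → (toℕ z <ᵇ toℕ x) ∧ ((toℕ z <ᵇ toℕ y) ∧ (W z x ∧ W z y)))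

  below-intro : ∀ z x y → toℕ z < toℕ x → toℕ z < toℕ y → W z x ≡ true → W z y ≡ true → below x y ≡ true
  below-intro z x y z<x z<y wzx wzy = ex-intro _ z
    (∧-intro (<ᵇ-true z<x) (∧-intro (<ᵇ-true z<y) (∧-intro wzx wzy)))

  below-sym : ∀ x y → below x y ≡ below y x
  below-sym x y = ex-cong (λ z → reorder (toℕ z <ᵇ toℕ x) (toℕ z <ᵇ toℕ y) (W z x) (W z y))
    where
    reorder : ∀ a b c d → a ∧ (b ∧ (c ∧ d)) ≡ b ∧ (a ∧ (d ∧ c))
    reorder true true c d = ∧-comm c d
    reorder true false c d = refl
    reorder false true c d = refl
    reorder false false c d = refl

  closed-sym : ∀ x y → closed W x y ≡ closed W y x
  closed-sym x y = ex-cong (λ z → ∧-comm (adj↑ W z x) (adj↑ W z y))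

  closed-intro : ∀ x y z → adj↑ W z x ≡ true → adj↑ W z y ≡ true → closed W x y ≡ true
  closed-intro x y z p q = ex-intro (λ z → adj↑ W z x ∧ adj↑ W z y) z (∧-intro p q)

  below⇒closed : ∀ x y → below x y ≡ true → closed W x y ≡ true
  below⇒closed x y eq with ex-elim (λ z → (toℕ z <ᵇ toℕ x) ∧ ((toℕ z <ᵇ toℕ y) ∧ (W z x ∧ W z y))) eq
  ... | z , p with ∧-split {toℕ z <ᵇ toℕ x} p
  ...   | z<x , p′ with ∧-split {toℕ z <ᵇ toℕ y} p′
  ...     | z<y , p″ with ∧-split {W z x} p″
  ...       | wzx , wzy = closed-intro x y z
              (adj↑-intro z x (true-<ᵇ (toℕ z) (toℕ x) z<x) wzx) (adj↑-intro z y (true-<ᵇ (toℕ z) (toℕ y) z<y) wzy)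

  -- The earliest vertex of the triangle lies below the other two, so their pair is excluded; the
  -- last two cases are cyclic orders.
  no-triangle-above-below : ∀ x y z → adj↑ W x y ≡ true → adj↑ W y z ≡ true → adj↑ W x z ≡ true →
    below x y ≡ false → below y z ≡ false → below x z ≡ false → ⊥
  no-triangle-above-below x y z xy yz xz nxy nyz nxz
    with adj↑-elim x y xy | adj↑-elim y z yz | adj↑-elim x z xz
  ... | inj₁ (x<y , wxy) | _ | inj₁ (x<z , wxz) = true≢false (below-intro x y z x<y x<z wxy wxz) nyz
  ... | inj₂ (y<x , wyx) | inj₁ (y<z , wyz) | _ = true≢false (below-intro y x z y<x y<z wyx wyz) nxz
  ... | _ | inj₂ (z<y , wzy) | inj₂ (z<x , wzx) = true≢false (below-intro z x y z<x z<y wzx wzy) nxy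
  ... | inj₁ (x<y , _) | inj₁ (y<z , _) | inj₂ (z<x , _) = <-irrefl refl (<-trans x<y (<-trans y<z z<x))
  ... | inj₂ (y<x , _) | inj₂ (z<y , _) | inj₁ (x<z , _) = <-irrefl refl (<-trans x<z (<-trans z<y y<x))

opposite : Fin 2 → Fin 2
opposite zero = suc zero
opposite (suc zero) = zero

-- The pair uv has side s = τ u v and, provided that π s separates u and v, the colour that ω s gives
-- to the images of u and v under π s.  It is discarded if these images have an earlier common
-- neighbour in this colour, or if the images under the other projection have any common neighbour in
-- the same colour of the other side.
module _ {n M m : ℕ} (τ : Fin n → Fin n → Fin 2) (π : Fin 2 → Fin n → Fin M) (ω : Fin 2 → Fin M → Fin M → Fin m) where

  colour-class : Fin 2 → Fin m → Fin M → Fin M → Bool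
  colour-class s i x y = ω s x y == i

  on-side : Fin 2 → Fin n → Fin n → Bool
  on-side s = adj↑ (λ u v → τ u v == s)

  candidate : Fin 2 → Fin m → Fin n → Fin n → Bool
  candidate s i u v = on-side s u v ∧ not (closed (colour-class (opposite s) i) (π (opposite s) u) (π (opposite s) v))

  half : Fin 2 → Fin m → Fin n → Fin n → Bool
  half s i u v = candidate s i u v ∧
    (adj↑ (colour-class s i) (π s u) (π s v) ∧ not (below (colour-class s i) (π s u) (π s v)))

  half-sym : ∀ s i u v → half s i u v ≡ half s i v u
  half-sym s i u v = cong₂ _∧_
    (cong₂ _∧_ (adj↑-sym (λ u v → τ u v == s) u v)
               (cong not (closed-sym (colour-class (opposite s) i) (π (opposite s) u) (π (opposite s) v))))
    (cong₂ _∧_ (adj↑-sym (colour-class s i) (π s u) (π s v)) (cong not (below-sym (colour-class s i) (π s u) (π s v))))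

  half-irrefl : ∀ s i u → half s i u u ≡ false
  half-irrefl s i u rewrite adj↑-irrefl (λ u v → τ u v == s) u = refl

  record Half (s : Fin 2) (i : Fin m) (u v : Fin n) : Set where
    field
      side : on-side s u v ≡ true
      adjacent : adj↑ (colour-class s i) (π s u) (π s v) ≡ true
      not-below : below (colour-class s i) (π s u) (π s v) ≡ false
      not-closed : closed (colour-class (opposite s) i) (π (opposite s) u) (π (opposite s) v) ≡ false
  open Half

  half-elim : ∀ s i u v → half s i u v ≡ true → Half s i u v
  half-elim s i u v eq with ∧-split {candidate s i u v} eq
  ... | c , rest with ∧-split {on-side s u v} c | ∧-split {adj↑ (colour-class s i) (π s u) (π s v)} rest
  ...   | t , nc | a , nb = record { side = t ; adjacent = a ; not-below = not-true nb ; not-closed = not-true nc }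

  Half-sym : ∀ {s i u v} → Half s i u v → Half s i v u
  Half-sym {s} {i} {u} {v} h = record
    { side = trans (adj↑-sym (λ u v → τ u v == s) v u) (side h)
    ; adjacent = trans (adj↑-sym (colour-class s i) (π s v) (π s u)) (adjacent h)
    ; not-below = trans (below-sym (colour-class s i) (π s v) (π s u)) (not-below h)
    ; not-closed = trans (closed-sym (colour-class (opposite s) i) (π (opposite s) v) (π (opposite s) u)) (not-closed h)
    }

  graph : Fin m → Graph n
  graph i = record
    { adj = λ u v → half zero i u v ∨ half (suc zero) i u v
    ; sym = λ u v → cong₂ _∨_ (half-sym zero i u v) (half-sym (suc zero) i u v)
    ; irrefl = λ u → cong₂ _∨_ (half-irrefl zero i u) (half-irrefl (suc zero) i u)
    }

  Adj-elim : ∀ i u v → Adj (graph i) u v → ∃[ s ] Half s i u v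
  Adj-elim i u v eq with ∨-elim {half zero i u v} eq
  ... | inj₁ p = zero , half-elim zero i u v p
  ... | inj₂ p = suc zero , half-elim (suc zero) i u v p

  half⇒Adj : ∀ s i u v → half s i u v ≡ true → Adj (graph i) u v
  half⇒Adj zero i u v eq rewrite eq = refl
  half⇒Adj (suc zero) i u v eq = ∨-introʳ (half zero i u v) eq

  -- The vertex `w` shared by the two edges of the other side has an image that closes the images of
  -- `u` and `v` there.
  no-mixed-triangle : ∀ {i} s {u v w} → Half s i u v → Half (opposite s) i w u → Half (opposite s) i w v → ⊥
  no-mixed-triangle {i} s {u} {v} {w} uv wu wv = true≢false
    (closed-intro (colour-class (opposite s) i) (π (opposite s) u) (π (opposite s) v) (π (opposite s) w) (adjacent wu) (adjacent wv))
    (not-closed uv)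

  no-pure-triangle : ∀ {i} s {u v w} → Half s i u v → Half s i v w → Half s i u w → ⊥
  no-pure-triangle {i} s {u} {v} {w} uv vw uw =
    no-triangle-above-below (colour-class s i) (π s u) (π s v) (π s w) (adjacent uv) (adjacent vw) (adjacent uw)
      (not-below uv) (not-below vw) (not-below uw)

  graph-triangle-free : ∀ i → TriangleFree (graph i)
  graph-triangle-free i (u , v , w , uv , vw , uw)
    with Adj-elim i u v uv | Adj-elim i v w vw | Adj-elim i u w uw
  ... | zero , p | zero , q | zero , r = no-pure-triangle zero p q r
  ... | suc zero , p | suc zero , q | suc zero , r = no-pure-triangle (suc zero) p q r
  ... | zero , p | suc zero , q | suc zero , r = no-mixed-triangle zero p (Half-sym r) (Half-sym q)
  ... | suc zero , p | zero , q | zero , r = no-mixed-triangle (suc zero) p (Half-sym r) (Half-sym q)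
  ... | suc zero , p | zero , q | suc zero , r = no-mixed-triangle zero q p r
  ... | zero , p | suc zero , q | zero , r = no-mixed-triangle (suc zero) q p r
  ... | suc zero , p | suc zero , q | zero , r = no-mixed-triangle zero r (Half-sym p) q
  ... | zero , p | zero , q | suc zero , r = no-mixed-triangle (suc zero) r (Half-sym p) q

  -- For both predicates `adj↑` reads the same entry of `f`, the one above the diagonal. Applied to
  -- sides and then to colours, this gives edge-disjointness.
  adj↑-agree : ∀ {A : Set} {N} (f : Fin N → Fin N → A) (g h : A → Bool) x y →
    adj↑ (λ x y → g (f x y)) x y ≡ true → adj↑ (λ x y → h (f x y)) x y ≡ true → ∃[ a ] (g a ≡ true × h a ≡ true)
  adj↑-agree f g h x y p q with adj↑-elim (λ x y → g (f x y)) x y p | adj↑-elim (λ x y → h (f x y)) x y q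
  ... | inj₁ (_ , a) | inj₁ (_ , b) = f x y , a , b
  ... | inj₁ (x<y , _) | inj₂ (y<x , _) = ⊥-elim (<-asym x<y y<x)
  ... | inj₂ (y<x , _) | inj₁ (x<y , _) = ⊥-elim (<-asym x<y y<x)
  ... | inj₂ (_ , a) | inj₂ (_ , b) = f y x , a , b

  graph-disjoint : PairwiseEdgeDisjoint graph
  graph-disjoint i j i≢j u v (p , q) with Adj-elim i u v p | Adj-elim j u v q
  ... | s , hi | s′ , hj with adj↑-agree τ (_== s) (_== s′) u v (side hi) (side hj)
  ...     | t , e , e′ with trans (sym (==⇒≡ t s e)) (==⇒≡ t s′ e′)
  ...       | refl with adj↑-agree (ω s) (_== i) (_== j) (π s u) (π s v) (adjacent hi) (adjacent hj)
  ...         | c , d , d′ = i≢j (trans (sym (==⇒≡ c i d)) (==⇒≡ c j d′))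

-- Surviving edges inside a set

module _ {M m : ℕ} (q : Fin M → Fin M → Bool) (i : Fin m) where

  entries : Vec (Vec (Fin m) M) M → Fin M → Fin M → Bool
  entries ρ x y = at ρ x y == i

  open-pair : Vec (Vec (Fin m) M) M → Fin M → Fin M → Bool
  open-pair ρ y x = ((toℕ y <ᵇ toℕ x) ∧ (q y x ∨ q x y)) ∧ not (below (entries ρ) y x)

  open-pairs hits : Vec (Vec (Fin m) M) M → ℕ
  open-pairs ρ = ∑ (λ y → # (open-pair ρ y))
  hits ρ = ∑ (λ y → # (λ x → open-pair ρ y x ∧ entries ρ y x))

  open-pair-adapted : ∀ y ρ σ → (∀ z → toℕ z < toℕ y → lookup ρ z ≡ lookup σ z) → ∀ x → open-pair ρ y x ≡ open-pair σ y x
  open-pair-adapted y ρ σ same x = cong (λ b → ((toℕ y <ᵇ toℕ x) ∧ (q y x ∨ q x y)) ∧ not b) (ex-cong point)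
    where
    point : ∀ z → (toℕ z <ᵇ toℕ y) ∧ ((toℕ z <ᵇ toℕ x) ∧ (entries ρ z y ∧ entries ρ z x)) ≡
                  (toℕ z <ᵇ toℕ y) ∧ ((toℕ z <ᵇ toℕ x) ∧ (entries σ z y ∧ entries σ z x))
    point z with toℕ z <ᵇ toℕ y in z<y
    ... | false = refl
    ... | true = cong (λ r → (toℕ z <ᵇ toℕ x) ∧ ((lookup r y == i) ∧ (lookup r x == i))) (same z (true-<ᵇ (toℕ z) (toℕ y) z<y))

-- Which cells of a row are open is known before the row is revealed, and each of them misses `i`
-- with probability m/(m + 1). As `q` is arbitrary, it may depend on the matrix of the other side.
no-hit-bound : ∀ {M m} (q : Fin M → Fin M → Bool) (i : Fin (suc m)) K →
  S (matrixSpace (finSpace (suc m)) M M) (λ ρ → ⟦ K ≤ᵇ open-pairs q i ρ ⟧ * 0 ^ hits q i ρ) * suc m ^ K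
    ≤ m ^ K * size (matrixSpace (finSpace (suc m)) M M)
no-hit-bound {M} {m} q i K = adaptive-bound (vecSpace (finSpace (suc m)) M) m (suc m) K (s≤s z≤n) (n≤1+n m)
  (λ y ρ row → ∑ (λ x → ⟦ open-pair q i ρ y x ∧ (lookup row x == i) ⟧)) (λ y ρ → # (open-pair q i ρ y))
  (λ y ρ σ same →
    (λ row → sum-cong-≗ (λ x → cong (λ b → ⟦ b ∧ (lookup row x == i) ⟧) (open-pair-adapted q i y ρ σ same x))) ,
    sum-cong-≗ (λ x → cong ⟦_⟧ (open-pair-adapted q i y ρ σ same x)))
  (λ y ρ → exponential-moment (finSpace (suc m)) 0 m (suc m) (λ x c → ⟦ open-pair q i ρ y x ∧ (c == i) ⟧) (λ x → ⟦ open-pair q i ρ y x ⟧)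
    (λ x → ≤-trans (hit-cell 0 (open-pair q i ρ y x) i)
      (≤-reflexive (cong (λ P → P ^ ⟦ open-pair q i ρ y x ⟧ * size (finSpace (suc m))) (+-identityʳ m)))))
  (Vec.replicate M (Vec.replicate M zero))

#-fibre-inj : ∀ {n M} (Z : Fin n → Bool) (π : Fin n → Fin M) → (∀ u v → Z u ≡ true → Z v ≡ true → π u ≡ π v → u ≡ v) →
  ∀ x → ∑ (λ u → ⟦ Z u ⟧ * ⟦ π u == x ⟧) ≤ 1
#-fibre-inj {n} Z π inj x with ex (λ u → Z u ∧ (π u == x)) in e
... | false = ≤-trans (≤-reflexive (∑-zero zeros)) z≤n
  where
  zeros : ∀ u → ⟦ Z u ⟧ * ⟦ π u == x ⟧ ≡ 0
  zeros u with Z u in zu | π u == x in pu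
  ... | true | true = ⊥-elim (true≢false (ex-intro (λ u → Z u ∧ (π u == x)) u (∧-intro zu pu)) e)
  ... | true | false = refl
  ... | false | _ = refl
... | true with ex-elim (λ u → Z u ∧ (π u == x)) e
...   | v , zv∧ with ∧-split {Z v} zv∧
...     | zv , πv = ≤-trans (∑-mono point) (≤-reflexive (#-singleton v))
  where
  point : ∀ u → ⟦ Z u ⟧ * ⟦ π u == x ⟧ ≤ ⟦ v == u ⟧
  point u = ≤-trans (≤-reflexive (sym (⟦∧⟧ (Z u) (π u == x)))) (⟦⟧-mono {Z u ∧ (π u == x)} same)
    where
    same : Z u ∧ (π u == x) ≡ true → (v == u) ≡ true
    same p with ∧-split {Z u} p
    ... | zu , πu = ≡⇒== (inj v u zv zu (trans (==⇒≡ (π v) x πv) (sym (==⇒≡ (π u) x πu))))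

∑-image-≤ : ∀ {n M} (Z T : Fin n → Bool) (π : Fin n → Fin M) (F : Fin M → Fin M → ℕ) →
  (∀ u v → Z u ≡ true → Z v ≡ true → π u ≡ π v → u ≡ v) →
  (∀ u v → T u ≡ true → T v ≡ true → π u ≡ π v → u ≡ v) →
  ∑ (λ u → ⟦ Z u ⟧ * ∑ (λ v → ⟦ T v ⟧ * F (π u) (π v))) ≤ ∑ (λ y → ∑ (λ x → F y x))
∑-image-≤ Z T π F injZ injT = begin
  ∑ (λ u → ⟦ Z u ⟧ * ∑ (λ v → ⟦ T v ⟧ * F (π u) (π v)))
    ≤⟨ ∑-mono (λ u → *-monoʳ-≤ ⟦ Z u ⟧ (image T injT (F (π u)))) ⟩
  ∑ (λ u → ⟦ Z u ⟧ * ∑ (F (π u)))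
    ≤⟨ image Z injZ (λ y → ∑ (F y)) ⟩
  ∑ (λ y → ∑ (λ x → F y x)) ∎
  where
  open ≤-Reasoning
  image : ∀ R → (∀ u v → R u ≡ true → R v ≡ true → π u ≡ π v → u ≡ v) → ∀ (g : _ → ℕ) → ∑ (λ v → ⟦ R v ⟧ * g (π v)) ≤ ∑ g
  image R inj g = begin
    ∑ (λ v → ⟦ R v ⟧ * g (π v))                                ≡⟨ ∑-fibres π (λ v → ⟦ R v ⟧) g ⟩
    ∑ (λ x → ∑ (λ v → ⟦ R v ⟧ * ⟦ π v == x ⟧) * g x)           ≤⟨ ∑-mono (λ x → *-monoˡ-≤ (g x) (#-fibre-inj R π inj x)) ⟩
    ∑ (λ x → 1 * g x)                                          ≡⟨ sum-cong-≗ (λ x → +-identityʳ (g x)) ⟩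
    ∑ g                                                        ∎

∑-unordered : ∀ {M} (F G : Fin M → Fin M → ℕ) → (∀ y → F y y ≡ 0) → (∀ y x → toℕ y < toℕ x → F y x + F x y ≤ G y x) →
  ∑ (λ y → ∑ (F y)) ≤ ∑ (λ y → ∑ (G y))
∑-unordered F G diag pair = begin
  ∑ (λ y → ∑ (F y))
    ≤⟨ ∑-mono (λ y → ∑-mono (split y)) ⟩
  ∑ (λ y → ∑ (λ x → lt y x * F y x + lt x y * F y x))
    ≡⟨ trans (sum-cong-≗ (λ y → ∑-distrib-+ (λ x → lt y x * F y x) _)) (∑-distrib-+ (λ y → ∑ (λ x → lt y x * F y x)) _) ⟩
  ∑ (λ y → ∑ (λ x → lt y x * F y x)) + ∑ (λ y → ∑ (λ x → lt x y * F y x))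
    ≡⟨ cong (∑ (λ y → ∑ (λ x → lt y x * F y x)) +_) (∑-comm (λ y x → lt x y * F y x)) ⟩
  ∑ (λ y → ∑ (λ x → lt y x * F y x)) + ∑ (λ y → ∑ (λ x → lt y x * F x y))
    ≡⟨ trans (sum-cong-≗ (λ y → ∑-distrib-+ (λ x → lt y x * F y x) (λ x → lt y x * F x y)))
             (∑-distrib-+ (λ y → ∑ (λ x → lt y x * F y x)) _) ⟨
  ∑ (λ y → ∑ (λ x → lt y x * F y x + lt y x * F x y))
    ≤⟨ ∑-mono (λ y → ∑-mono (merge y)) ⟩
  ∑ (λ y → ∑ (G y)) ∎
  where
  open ≤-Reasoning
  lt : _ → _ → ℕ
  lt y x = ⟦ toℕ y <ᵇ toℕ x ⟧
  split : ∀ y x → F y x ≤ lt y x * F y x + lt x y * F y x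
  split y x with <-cmp (toℕ y) (toℕ x)
  ... | tri< y<x _ _ rewrite <ᵇ-true y<x = ≤-trans (≤-reflexive (sym (+-identityʳ (F y x)))) (m≤m+n (F y x + 0) _)
  ... | tri≈ _ y≡x _ with refl ← Fin.toℕ-injective y≡x = ≤-trans (≤-reflexive (diag y)) z≤n
  ... | tri> _ _ x<y rewrite <ᵇ-true x<y = ≤-trans (≤-reflexive (sym (+-identityʳ (F y x)))) (m≤n+m (F y x + 0) (lt y x * F y x))
  merge : ∀ y x → lt y x * F y x + lt y x * F x y ≤ G y x
  merge y x with toℕ y <ᵇ toℕ x in y<x
  ... | false = z≤n
  ... | true = ≤-trans (≤-reflexive (cong₂ _+_ (+-identityʳ (F y x)) (+-identityʳ (F x y)))) (pair y x (true-<ᵇ (toℕ y) (toℕ x) y<x))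

module _ {n M m : ℕ} (τ : Fin n → Fin n → Fin 2) (π : Fin 2 → Fin n → Fin M) where

  -- Built from `τ`, `π` and the matrix `σ` of the other side, so it is fixed while the matrix of
  -- side `s` is revealed.
  link : Fin 2 → Fin m → Vec (Vec (Fin m) M) M → (Z T : Fin n → Bool) → (y x : Fin M) → (u v : Fin n) → Bool
  link s i σ Z T y x u v = ((Z u ∧ T v) ∧ (on-side τ π (λ _ → at σ) s u v ∧ not (closed (λ x y → at σ x y == i) (π (opposite s) u) (π (opposite s) v))))
    ∧ ((π s u == y) ∧ (π s v == x))

  -- The pairs whose colouring by i on side s would put an edge between Z and T into graph i, unless
  -- they lie above an earlier common neighbour; σ is the matrix of the other side.
  allowed : Fin 2 → Fin m → Vec (Vec (Fin m) M) M → (Z T : Fin n → Bool) → Fin M → Fin M → Bool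
  allowed s i σ Z T y x = ex (λ u → ex (λ v → link s i σ Z T y x u v))

  record Link (s : Fin 2) (i : Fin m) (σ : Vec (Vec (Fin m) M) M) (Z T : Fin n → Bool) (y x : Fin M) : Set where
    field
      u v : Fin n
      Zu : Z u ≡ true
      Tv : T v ≡ true
      sided : on-side τ π (λ _ → at σ) s u v ≡ true
      unclosed : closed (λ x y → at σ x y == i) (π (opposite s) u) (π (opposite s) v) ≡ false
      πu : π s u ≡ y
      πv : π s v ≡ x
  open Link

  allowed-elim : ∀ s i σ Z T y x → allowed s i σ Z T y x ≡ true → Link s i σ Z T y x
  allowed-elim s i σ Z T y x eq with ex-elim (λ u → ex (λ v → link s i σ Z T y x u v)) eq
  ... | u , eq′ with ex-elim (λ v → link s i σ Z T y x u v) eq′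
  ...   | v , l with ∧-split {(Z u ∧ T v) ∧ _} l
  ...     | zc , p with ∧-split {Z u ∧ T v} zc | ∧-split {π s u == y} p
  ...       | zt , c | p₁ , p₂ with ∧-split {Z u} zt | ∧-split {on-side τ π (λ _ → at σ) s u v} c
  ...         | z , t | d , k = record
    { u = u ; v = v ; Zu = z ; Tv = t ; sided = d ; unclosed = not-true k ; πu = ==⇒≡ (π s u) y p₁ ; πv = ==⇒≡ (π s v) x p₂ }

  allowed-intro : ∀ s i σ Z T u v → Z u ≡ true → T v ≡ true → on-side τ π (λ _ → at σ) s u v ≡ true →
    closed (λ x y → at σ x y == i) (π (opposite s) u) (π (opposite s) v) ≡ false → allowed s i σ Z T (π s u) (π s v) ≡ true
  allowed-intro s i σ Z T u v z t d c = ex-intro (λ u′ → ex (λ v′ → link s i σ Z T (π s u) (π s v) u′ v′)) u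
    (ex-intro (λ v′ → link s i σ Z T (π s u) (π s v) u v′) v
      (∧-intro (∧-intro (∧-intro z t) (∧-intro d (cong not c))) (∧-intro (≡⇒== {x = π s u} refl) (≡⇒== {x = π s v} refl))))

  module _ (ω : Fin 2 → Vec (Vec (Fin m) M) M) (s : Fin 2) (i : Fin m) (Z T : Fin n → Bool) where

    private
      σ = ω (opposite s)
      q = allowed s i σ Z T
      W = entries q i (ω s)
      W′ = entries q i σ

    -- An open cell of colour `i` is a surviving edge: its link guarantees the side and the test in
    -- the other projection, and openness excludes an earlier common neighbour.
    independent⇒no-hits : (∀ u v → Z u ≡ true → T v ≡ true → ¬ Adj (graph τ π (λ s → at (ω s)) i) u v) → hits q i (ω s) ≡ 0
    independent⇒no-hits indep = ∑-zero (λ y → ∑-zero (λ x → no-hit y x))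
      where
      edge : ∀ u v → Z u ≡ true → T v ≡ true → on-side τ π (λ _ → at σ) s u v ≡ true → closed W′ (π (opposite s) u) (π (opposite s) v) ≡ false →
        adj↑ W (π s u) (π s v) ≡ true → below W (π s u) (π s v) ≡ false → ⊥
      edge u v z t d c a b = indep u v z t (half⇒Adj τ π (λ s → at (ω s)) s i u v
        (∧-intro (∧-intro d (cong not c)) (∧-intro a (cong not b))))
      no-hit : ∀ y x → ⟦ open-pair q i (ω s) y x ∧ W y x ⟧ ≡ 0
      no-hit y x with open-pair q i (ω s) y x in o | W y x in w
      ... | false | _ = refl
      ... | true | false = refl
      ... | true | true with ∧-split {(toℕ y <ᵇ toℕ x) ∧ (q y x ∨ q x y)} o
      ...   | lq , nb with ∧-split {toℕ y <ᵇ toℕ x} lq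
      ...     | y<x , qq with ∨-elim {q y x} qq
      ...       | inj₁ qyx with allowed-elim s i σ Z T y x qyx
      ...         | record { u = u ; v = v ; Zu = z ; Tv = t ; sided = d ; unclosed = c ; πu = refl ; πv = refl } =
                    ⊥-elim (edge u v z t d c (adj↑-intro W y x (true-<ᵇ (toℕ y) (toℕ x) y<x) w) (not-true nb))
      no-hit y x | true | true | lq , nb | y<x , qq | inj₂ qxy with allowed-elim s i σ Z T x y qxy
      ...         | record { u = u ; v = v ; Zu = z ; Tv = t ; sided = d ; unclosed = c ; πu = refl ; πv = refl } =
                    ⊥-elim (edge u v z t d c (trans (adj↑-sym W x y) (adj↑-intro W y x (true-<ᵇ (toℕ y) (toℕ x) y<x) w))
                                             (trans (below-sym W x y) (not-true nb)))

    -- A pair of side `s` gives an open cell unless it is closed in one of the projections.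
    -- Injectivity on `J` sends distinct pairs to distinct cells; disjointness of `Z` and `T`
    -- excludes the diagonal and a cell reached in both orientations.
    many-open-pairs : ∀ (J : Fin n → Bool) → (∀ u v → J u ≡ true → J v ≡ true → π s u ≡ π s v → u ≡ v) →
      (∀ u → Z u ≡ true → J u ≡ true) → (∀ u → T u ≡ true → J u ≡ true) → (∀ u → Z u ≡ true → T u ≡ true → ⊥) →
      ∑ (λ u → ⟦ Z u ⟧ * ∑ (λ v → ⟦ T v ⟧ * ⟦ on-side τ π (λ _ → at σ) s u v ⟧)) ≤
        open-pairs q i (ω s)
        + (∑ (λ u → ⟦ Z u ⟧ * ∑ (λ v → ⟦ T v ⟧ * ⟦ closed W′ (π (opposite s) u) (π (opposite s) v) ⟧))
        + ∑ (λ u → ⟦ Z u ⟧ * ∑ (λ v → ⟦ T v ⟧ * ⟦ closed W (π s u) (π s v) ⟧)))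
    many-open-pairs J inj Z⊆J T⊆J disjoint = begin
      ∑∑ (λ u v → ⟦ on-side τ π (λ _ → at σ) s u v ⟧)
        ≤⟨ ∑-mono (λ u → ⟦⟧*-mono (Z u) λ zu → ∑-mono (λ v → ⟦⟧*-mono (T v) (classify u v zu))) ⟩
      ∑∑ (λ u v → F (π s u) (π s v) + (C′ u v + C u v))
        ≡⟨ trans (∑∑-+ (λ u v → F (π s u) (π s v)) (λ u v → C′ u v + C u v)) (cong (∑∑ (λ u v → F (π s u) (π s v)) +_) (∑∑-+ C′ C)) ⟩
      ∑∑ (λ u v → F (π s u) (π s v)) + (∑∑ C′ + ∑∑ C)
        ≤⟨ +-monoˡ-≤ (∑∑ C′ + ∑∑ C) (≤-trans
             (∑-image-≤ Z T (π s) F (λ u v zu zv → inj u v (Z⊆J u zu) (Z⊆J v zv)) (λ u v tu tv → inj u v (T⊆J u tu) (T⊆J v tv)))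
             (∑-unordered F (λ y x → ⟦ open-pair q i (ω s) y x ⟧) diagonal unordered)) ⟩
      open-pairs q i (ω s) + (∑∑ C′ + ∑∑ C) ∎
      where
      open ≤-Reasoning
      ∑∑ : (Fin n → Fin n → ℕ) → ℕ
      ∑∑ f = ∑ (λ u → ⟦ Z u ⟧ * ∑ (λ v → ⟦ T v ⟧ * f u v))
      ∑∑-+ : ∀ f g → ∑∑ (λ u v → f u v + g u v) ≡ ∑∑ f + ∑∑ g
      ∑∑-+ f g = trans (sum-cong-≗ (λ u → trans (cong (⟦ Z u ⟧ *_)
          (trans (sum-cong-≗ (λ v → *-distribˡ-+ ⟦ T v ⟧ (f u v) (g u v))) (∑-distrib-+ (λ v → ⟦ T v ⟧ * f u v) _)))
          (*-distribˡ-+ ⟦ Z u ⟧ _ _)))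
        (∑-distrib-+ (λ u → ⟦ Z u ⟧ * ∑ (λ v → ⟦ T v ⟧ * f u v)) _)
      F : Fin M → Fin M → ℕ
      F y x = ⟦ q y x ∧ not (below W y x) ⟧
      C′ C : Fin n → Fin n → ℕ
      C′ u v = ⟦ closed W′ (π (opposite s) u) (π (opposite s) v) ⟧
      C u v = ⟦ closed W (π s u) (π s v) ⟧
      classify : ∀ u v → Z u ≡ true → T v ≡ true → ⟦ on-side τ π (λ _ → at σ) s u v ⟧ ≤ F (π s u) (π s v) + (C′ u v + C u v)
      classify u v zu tv with on-side τ π (λ _ → at σ) s u v in d
      ... | false = z≤n
      ... | true with closed W′ (π (opposite s) u) (π (opposite s) v) in c′
      ...   | true = ≤-trans (s≤s z≤n) (m≤n+m _ (F (π s u) (π s v)))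
      ...   | false with below W (π s u) (π s v) in b
      ...     | true rewrite below⇒closed W (π s u) (π s v) b = m≤n+m 1 _
      ...     | false rewrite allowed-intro s i σ Z T u v zu tv d c′ = s≤s z≤n
      diagonal : ∀ y → F y y ≡ 0
      diagonal y with q y y in e
      ... | false = refl
      ... | true with allowed-elim s i σ Z T y y e
      ...   | l with inj (u l) (v l) (Z⊆J _ (Zu l)) (T⊆J _ (Tv l)) (trans (πu l) (sym (πv l)))
      ...     | u≡v = ⊥-elim (disjoint (u l) (Zu l) (trans (cong T u≡v) (Tv l)))
      unordered : ∀ y x → toℕ y < toℕ x → F y x + F x y ≤ ⟦ open-pair q i (ω s) y x ⟧
      unordered y x y<x rewrite <ᵇ-true y<x | below-sym W x y with q y x in e | q x y in e′ | below W y x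
      ... | true | true | b with allowed-elim s i σ Z T y x e | allowed-elim s i σ Z T x y e′
      ...   | l | l′ with inj (u l) (v l′) (Z⊆J _ (Zu l)) (T⊆J _ (Tv l′)) (trans (πu l) (sym (πv l′)))
      ...     | u≡v = ⊥-elim (disjoint (u l) (Zu l) (trans (cong T u≡v) (Tv l′)))
      unordered y x y<x | true | false | true = z≤n
      unordered y x y<x | true | false | false = ≤-refl
      unordered y x y<x | false | true | true = z≤n
      unordered y x y<x | false | true | false = ≤-refl
      unordered y x y<x | false | false | b = z≤n

-- Random projections, sides and colourings

-- Turns a union bound over `I` events into a total probability of at most 1/c. The values 4, 2 and
-- 10 of `c` leave room for adding up several kinds of bad events.
fraction-bound : ∀ c I s {P Q z} → 0 < Q → s * Q ≤ I * (P * z) → c * (I * P) ≤ Q → c * s ≤ z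
fraction-bound c I s {P} {Q} {z} 0<Q le small = *-cancelʳ-≤ _ _ Q {{>-nonZero 0<Q}} (begin
  c * s * Q            ≡⟨ *-assoc c s Q ⟩
  c * (s * Q)          ≤⟨ *-monoʳ-≤ c le ⟩
  c * (I * (P * z))    ≡⟨ regroup c I P z ⟩
  c * (I * P) * z      ≤⟨ *-monoˡ-≤ z small ⟩
  Q * z                ≡⟨ *-comm Q z ⟩
  z * Q                ∎)
  where
  open ≤-Reasoning
  regroup : ∀ c I P z → c * (I * (P * z)) ≡ c * (I * P) * z
  regroup = solve-∀

avoid : ∀ {A} (X : Space A) f → S X f < size X → ∃[ a ] f a ≡ 0
avoid X f lt with S-find X f (λ _ → 1) lt
... | a , fa<1 = a , n≤0⇒n≡0 (s≤s⁻¹ fa<1)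

none : ∀ {A} (X : Space A) f a → S X f ≡ 0 → f a ≡ 0
none X f a eq = n≤0⇒n≡0 (≤-trans (term≤S X f a) (≤-reflexive eq))

⟦≤ᵇ⟧≡0⇒< : ∀ E x → ⟦ E ≤ᵇ x ⟧ ≡ 0 → x < E
⟦≤ᵇ⟧≡0⇒< E x eq with E ≤? x
... | yes p with () ← trans (sym (cong ⟦_⟧ (≤ᵇ-true p))) eq
... | no ¬p = ≰⇒> ¬p

∑-rectangle : ∀ {k n} (Z : Fin k → Bool) (T : Fin n → Bool) → ∑ (λ z → ∑ (λ x → ⟦ Z z ∧ T x ⟧)) ≡ # Z * # T
∑-rectangle Z T = begin
  ∑ (λ z → ∑ (λ x → ⟦ Z z ∧ T x ⟧))        ≡⟨ sum-cong-≗ (λ z → trans (sum-cong-≗ (λ x → ⟦∧⟧ (Z z) (T x))) (sym (*-distribˡ-sum ⟦ Z z ⟧ (λ x → ⟦ T x ⟧)))) ⟩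
  ∑ (λ z → ⟦ Z z ⟧ * # T)                  ≡⟨ *-distribʳ-sum (# T) (λ z → ⟦ Z z ⟧) ⟨
  # Z * # T                                ∎
  where open ≡-Reasoning

-- b is the free parameter of Chernoff's bound.
rectangle-bound : ∀ {k n m} (Z : Fin k → Bool) (T : Fin n → Bool) (i : Fin (suc m)) b E K → 0 < b → # Z * # T ≤ K →
  S (matrixSpace (finSpace (suc m)) k n) (λ ω → ⟦ E ≤ᵇ ∑ (λ z → ∑ (λ x → ⟦ (Z z ∧ T x) ∧ (at ω z x == i) ⟧)) ⟧) * (b ^ E * suc m ^ K)
    ≤ (m + b) ^ K * size (matrixSpace (finSpace (suc m)) k n)
rectangle-bound {k} {n} {m} Z T i b E K 0<b ≤K = begin
  S Ω (λ ω → ⟦ E ≤ᵇ e ω ⟧) * (b ^ E * suc m ^ K)    ≡⟨ *-assoc (S Ω (λ ω → ⟦ E ≤ᵇ e ω ⟧)) _ _ ⟨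
  S Ω (λ ω → ⟦ E ≤ᵇ e ω ⟧) * b ^ E * suc m ^ K      ≤⟨ *-monoˡ-≤ (suc m ^ K) (markov Ω b e E 0<b) ⟩
  S Ω (λ ω → b ^ e ω) * suc m ^ K                  ≤⟨ raise-exponent (S Ω (λ ω → b ^ e ω)) 1+m≤m+b ≤K exact ⟩
  (m + b) ^ K * size Ω                             ∎
  where
  open ≤-Reasoning
  Ω = matrixSpace (finSpace (suc m)) k n
  e : _ → ℕ
  e ω = ∑ (λ z → ∑ (λ x → ⟦ (Z z ∧ T x) ∧ (at ω z x == i) ⟧))
  1+m≤m+b : suc m ≤ m + b
  1+m≤m+b = ≤-trans (≤-reflexive (+-comm 1 m)) (+-monoʳ-≤ m 0<b)
  exact : S Ω (λ ω → b ^ e ω) * suc m ^ (# Z * # T) ≤ (m + b) ^ (# Z * # T) * size Ω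
  exact = subst (λ N → S Ω (λ ω → b ^ e ω) * suc m ^ N ≤ (m + b) ^ N * size Ω) (∑-rectangle Z T)
    (matrix-moment (finSpace (suc m)) b (m + b) (suc m) (λ z x c → ⟦ (Z z ∧ T x) ∧ (c == i) ⟧) (λ z x → ⟦ Z z ∧ T x ⟧)
      (λ z x → hit-cell b (Z z ∧ T x) i))

proj : ∀ {A : Set} → Fin 2 → A × A → A
proj zero = proj₁
proj (suc zero) = proj₂

module _ (n M f t k b : ℕ) (0<M : 0 < M) (0<b : 0 < b)
  (fibres-rare : 4 * (2 * M * suc M ^ n) ≤ 2 ^ f * M ^ n)
  (boxes-rare : 4 * (M ^ t * M ^ t * (M * M + b * (t * t)) ^ n) ≤ b ^ k * (M * M) ^ n) where

  private
    A = finSpace M ×ₛ finSpace M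
    Ω = vecSpace A n
    Boxes = vecSpace (finSpace M) t ×ₛ vecSpace (finSpace M) t

    fibre : Fin 2 → Fin M → Vec (Fin M × Fin M) n → ℕ
    fibre s x π = # (λ u → proj s (lookup π u) == x)

    box : Vec (Fin M) t × Vec (Fin M) t → Vec (Fin M × Fin M) n → ℕ
    box (zs , ts) π = # (λ u → mem zs (proj₁ (lookup π u)) ∧ mem ts (proj₂ (lookup π u)))

    size-A : size A ≡ M * M
    size-A = trans (size-× (finSpace M) (finSpace M)) (cong₂ _*_ (size-fin M) (size-fin M))

    size>0 : 0 < size Ω
    size>0 = subst (0 <_) (sym (trans (size-vec A n) (cong (_^ n) size-A))) (m^n>0 (M * M) {{>-nonZero (*-mono-≤ 0<M 0<M)}} n)

    hit-size : ∀ s x → S A (λ a → 2 ^ ⟦ proj s a == x ⟧) ≡ M * suc M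
    hit-size s x = trans (both s) (cong (M *_) (sum-hit M x))
      where
      sum-hit : ∀ M (x : Fin M) → ∑ (λ c → 2 ^ ⟦ c == x ⟧) ≡ suc M
      sum-hit (suc M) x = trans (∑-hit 2 x) (+-comm M 2)
      both : ∀ s → S A (λ a → 2 ^ ⟦ proj s a == x ⟧) ≡ M * ∑ (λ c → 2 ^ ⟦ c == x ⟧)
      both zero = trans (sum-cong-≗ (λ c → trans (∑-const M (2 ^ ⟦ c == x ⟧)) (*-comm M (2 ^ ⟦ c == x ⟧))))
        (trans (sym (*-distribʳ-sum M (λ c → 2 ^ ⟦ c == x ⟧))) (*-comm (∑ (λ c → 2 ^ ⟦ c == x ⟧)) M))
      both (suc zero) = ∑-const M (∑ (λ c → 2 ^ ⟦ c == x ⟧))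

    fibre-bound : ∀ s x → S Ω (λ π → ⟦ f ≤ᵇ fibre s x π ⟧) * (2 ^ f * M ^ n) ≤ suc M ^ n * size Ω
    fibre-bound s x = begin
      S Ω (λ π → ⟦ f ≤ᵇ fibre s x π ⟧) * (2 ^ f * M ^ n)  ≡⟨ *-assoc (S Ω (λ π → ⟦ f ≤ᵇ fibre s x π ⟧)) _ _ ⟨
      S Ω (λ π → ⟦ f ≤ᵇ fibre s x π ⟧) * 2 ^ f * M ^ n    ≤⟨ *-monoˡ-≤ (M ^ n) (markov Ω 2 (fibre s x) f (s≤s z≤n)) ⟩
      S Ω (λ π → 2 ^ fibre s x π) * M ^ n
        ≤⟨ subst (λ N → S Ω (λ π → 2 ^ fibre s x π) * M ^ N ≤ suc M ^ N * size Ω) (trans (∑-const n 1) (*-identityʳ n))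
             (exponential-moment A {n} 2 (suc M) M (λ u a → ⟦ proj s a == x ⟧) (λ _ → 1) (λ _ → ≤-reflexive cell)) ⟩
      suc M ^ n * size Ω ∎
      where
      open ≤-Reasoning
      cell : S A (λ a → 2 ^ ⟦ proj s a == x ⟧) * M ^ 1 ≡ suc M ^ 1 * size A
      cell = trans (cong (_* M ^ 1) (hit-size s x)) (trans (identity M) (cong (suc M ^ 1 *_) (sym size-A)))
        where
        identity : ∀ M → M * suc M * (M * 1) ≡ suc M * 1 * (M * M)
        identity = solve-∀

    box-bound : ∀ zt → S Ω (λ π → ⟦ k ≤ᵇ box zt π ⟧) * (b ^ k * (M * M) ^ n) ≤ (M * M + b * (t * t)) ^ n * size Ω
    box-bound zt@(zs , ts) = begin
      S Ω (λ π → ⟦ k ≤ᵇ box zt π ⟧) * (b ^ k * (M * M) ^ n)  ≡⟨ *-assoc (S Ω (λ π → ⟦ k ≤ᵇ box zt π ⟧)) _ _ ⟨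
      S Ω (λ π → ⟦ k ≤ᵇ box zt π ⟧) * b ^ k * (M * M) ^ n    ≤⟨ *-monoˡ-≤ ((M * M) ^ n) (markov Ω b (box zt) k 0<b) ⟩
      S Ω (λ π → b ^ box zt π) * (M * M) ^ n
        ≤⟨ subst (λ N → S Ω (λ π → b ^ box zt π) * (M * M) ^ N ≤ (M * M + b * (t * t)) ^ N * size Ω) (trans (∑-const n 1) (*-identityʳ n))
             (exponential-moment A {n} b (M * M + b * (t * t)) (M * M) (λ u a → ⟦ mem zs (proj₁ a) ∧ mem ts (proj₂ a) ⟧) (λ _ → 1) (λ _ → cell)) ⟩
      (M * M + b * (t * t)) ^ n * size Ω ∎
      where
      open ≤-Reasoning
      b^≤ : ∀ c → b ^ ⟦ c ⟧ ≤ 1 + b * ⟦ c ⟧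
      b^≤ true = n≤1+n _
      b^≤ false = s≤s z≤n
      cell : S A (λ a → b ^ ⟦ mem zs (proj₁ a) ∧ mem ts (proj₂ a) ⟧) * (M * M) ^ 1 ≤ (M * M + b * (t * t)) ^ 1 * size A
      cell = begin
        S A (λ a → b ^ ⟦ hit a ⟧) * (M * M) ^ 1
          ≤⟨ *-monoˡ-≤ ((M * M) ^ 1) (S-mono A (b^≤ ∘ hit)) ⟩
        S A (λ a → 1 + b * ⟦ hit a ⟧) * (M * M) ^ 1
          ≡⟨ cong (_* (M * M) ^ 1) (trans (S-+ A (λ _ → 1) (λ a → b * ⟦ hit a ⟧)) (cong₂ _+_ size-A (trans (S-* A b (λ a → ⟦ hit a ⟧)) (cong (b *_) (∑-rectangle (mem zs) (mem ts)))))) ⟩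
        (M * M + b * (# (mem zs) * # (mem ts))) * (M * M) ^ 1
          ≤⟨ *-monoˡ-≤ ((M * M) ^ 1) (+-monoʳ-≤ (M * M) (*-monoʳ-≤ b (*-mono-≤ (#-mem zs) (#-mem ts)))) ⟩
        (M * M + b * (t * t)) * (M * M) ^ 1
          ≡⟨ cong₂ _*_ (sym (*-identityʳ (M * M + b * (t * t)))) (trans (*-identityʳ (M * M)) (sym size-A)) ⟩
        (M * M + b * (t * t)) ^ 1 * size A ∎
        where
        hit : Fin M × Fin M → Bool
        hit a = mem zs (proj₁ a) ∧ mem ts (proj₂ a)

    fibre-event : Vec (Fin M × Fin M) n → Fin 2 × Fin M → ℕ
    fibre-event π (s , x) = ⟦ f ≤ᵇ fibre s x π ⟧

    bad : Vec (Fin M × Fin M) n → ℕ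
    bad π = S (finSpace 2 ×ₛ finSpace M) (fibre-event π) + S Boxes (λ zt → ⟦ k ≤ᵇ box zt π ⟧)

    bad-rare : S Ω bad < size Ω
    bad-rare = *-cancelˡ-< 4 _ _ (begin-strict
      4 * S Ω bad                      ≡⟨ cong (4 *_) (S-+ Ω F B) ⟩
      4 * (S Ω F + S Ω B)              ≡⟨ *-distribˡ-+ 4 (S Ω F) _ ⟩
      4 * S Ω F + 4 * S Ω B            ≤⟨ +-mono-≤
        (fraction-bound 4 (2 * M) (S Ω F) (*-mono-≤ (m^n>0 2 f) (m^n>0 M {{>-nonZero 0<M}} n))
          (subst (λ I → S Ω F * (2 ^ f * M ^ n) ≤ I * (suc M ^ n * size Ω)) (trans (size-× (finSpace 2) (finSpace M)) (cong (2 *_) (size-fin M)))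
            (union-bound Ω (finSpace 2 ×ₛ finSpace M) (λ sx π → fibre-event π sx) (λ { (s , x) → fibre-bound s x })))
          fibres-rare)
        (fraction-bound 4 (M ^ t * M ^ t) (S Ω B) (*-mono-≤ (m^n>0 b {{>-nonZero 0<b}} k) (m^n>0 (M * M) {{>-nonZero (*-mono-≤ 0<M 0<M)}} n))
          (subst (λ I → S Ω B * (b ^ k * (M * M) ^ n) ≤ I * ((M * M + b * (t * t)) ^ n * size Ω)) size-Boxes
            (union-bound Ω Boxes (λ zt π → ⟦ k ≤ᵇ box zt π ⟧) box-bound))
          boxes-rare) ⟩
      size Ω + size Ω                  <⟨ m<m+n (size Ω + size Ω) (≤-trans size>0 (m≤m+n _ _)) ⟩
      size Ω + size Ω + (size Ω + size Ω) ≡⟨ four (size Ω) ⟩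
      4 * size Ω                       ∎)
      where
      open ≤-Reasoning
      four : ∀ z → z + z + (z + z) ≡ 4 * z
      four = solve-∀
      F B : _ → ℕ
      F π = S (finSpace 2 ×ₛ finSpace M) (fibre-event π)
      B π = S Boxes (λ zt → ⟦ k ≤ᵇ box zt π ⟧)
      size-Boxes : size Boxes ≡ M ^ t * M ^ t
      size-Boxes = trans (size-× (vecSpace (finSpace M) t) (vecSpace (finSpace M) t)) (cong₂ _*_ size-V size-V)
        where
        size-V = trans (size-vec (finSpace M) t) (cong (_^ t) (size-fin M))

  -- A set with two small images lies in a box, hence the second property. There are `M ^ (2 * t)`
  -- boxes, so for `k` linear in `t` the Chernoff parameter `b` must be a power of n; boxes are
  -- sparse enough for that.
  exists-projections : ∃[ π ] ((∀ s x → # (λ u → π s u == x) ≤ f) ×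
    (∀ (zs ts : Vec (Fin M) t) → # {n} (λ u → mem zs (π zero u) ∧ mem ts (π (suc zero) u)) < k))
  exists-projections = let π , bad≡0 = avoid Ω bad bad-rare in
    (λ s u → proj s (lookup π u)) , small-fibres π bad≡0 , small-boxes π bad≡0
    where
    small-fibres : ∀ π → bad π ≡ 0 → ∀ s x → fibre s x π ≤ f
    small-fibres π bad≡0 s x = <⇒≤ (⟦≤ᵇ⟧≡0⇒< f (fibre s x π)
      (none (finSpace 2 ×ₛ finSpace M) (fibre-event π) (s , x) (m+n≡0⇒m≡0 (S (finSpace 2 ×ₛ finSpace M) (fibre-event π)) bad≡0)))
    small-boxes : ∀ π → bad π ≡ 0 → ∀ zs ts → box (zs , ts) π < k
    small-boxes π bad≡0 zs ts = ⟦≤ᵇ⟧≡0⇒< k (box (zs , ts) π)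
      (none Boxes (λ zt → ⟦ k ≤ᵇ box zt π ⟧) (zs , ts) (m+n≡0⇒n≡0 (S (finSpace 2 ×ₛ finSpace M) (fibre-event π)) bad≡0))

∑-rectangle-nested : ∀ {k n} (Z : Fin k → Bool) (T : Fin n → Bool) (W : Fin k → Fin n → Bool) →
  ∑ (λ z → ∑ (λ x → ⟦ (Z z ∧ T x) ∧ W z x ⟧)) ≡ ∑ (λ z → ⟦ Z z ⟧ * ∑ (λ x → ⟦ T x ⟧ * ⟦ W z x ⟧))
∑-rectangle-nested Z T W = sum-cong-≗ (λ z → trans
  (sum-cong-≗ (λ x → trans (⟦∧⟧ (Z z ∧ T x) (W z x)) (trans (cong (_* ⟦ W z x ⟧) (⟦∧⟧ (Z z) (T x))) (*-assoc ⟦ Z z ⟧ ⟦ T x ⟧ ⟦ W z x ⟧))))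
  (sym (*-distribˡ-sum ⟦ Z z ⟧ (λ x → ⟦ T x ⟧ * ⟦ W z x ⟧))))

vec-pairs : ∀ n h → Space (Vec (Fin n) h × Vec (Fin n) h)
vec-pairs n h = vecSpace (finSpace n) h ×ₛ vecSpace (finSpace n) h

size-vec-pairs : ∀ n h → size (vec-pairs n h) ≡ n ^ h * n ^ h
size-vec-pairs n h = trans (size-× (vecSpace (finSpace n) h) (vecSpace (finSpace n) h)) (cong₂ _*_ size-V size-V)
  where
  size-V = trans (size-vec (finSpace n) h) (cong (_^ h) (size-fin n))

size-matrix>0 : ∀ m k n → 0 < size (matrixSpace (finSpace (suc m)) k n)
size-matrix>0 m k n = subst (0 <_)
  (sym (trans (size-vec (vecSpace (finSpace (suc m)) n) k) (cong (_^ k) (trans (size-vec (finSpace (suc m)) n) (cong (_^ n) (size-fin (suc m)))))))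
  (m^n>0 (suc m ^ n) {{>-nonZero (m^n>0 (suc m) n)}} k)

==-opposite : ∀ (c s : Fin 2) → ⟦ c == s ⟧ + ⟦ c == opposite s ⟧ ≡ 1
==-opposite zero zero = refl
==-opposite zero (suc zero) = refl
==-opposite (suc zero) zero = refl
==-opposite (suc zero) (suc zero) = refl

-- A lower tail for side `s` is an upper tail for the opposite side, so `markov` suffices. With
-- parameter 2 each pair contributes a moment of 3/2.
exists-sides : ∀ n h E → 2 * (2 * (n ^ h * n ^ h) * 3 ^ (h * h)) ≤ 2 ^ E * 2 ^ (h * h) →
  ∃[ τ ] (∀ s (Z T : Fin n → Bool) → # Z ≡ h → # T ≡ h → h * h ≤ E + ∑ (λ u → ⟦ Z u ⟧ * ∑ (λ v → ⟦ T v ⟧ * ⟦ τ u v == s ⟧)))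
exists-sides n h E rare = let τ , none-bad = avoid Ω bad bad-rare in at τ , balanced τ none-bad
  where
  Ω = matrixSpace (finSpace 2) n n
  I = finSpace 2 ×ₛ vec-pairs n h
  event : Fin 2 × (Vec (Fin n) h × Vec (Fin n) h) → Vec (Vec (Fin 2) n) n → ℕ
  event (s , zs , ts) τ = ⟦ E ≤ᵇ ∑ (λ u → ∑ (λ v → ⟦ (mem zs u ∧ mem ts v) ∧ (at τ u v == s) ⟧)) ⟧
  bad : Vec (Vec (Fin 2) n) n → ℕ
  bad τ = S I (λ i → event i τ)
  bad-rare : S Ω bad < size Ω
  bad-rare = *-cancelˡ-< 2 _ _ (≤-<-trans
    (fraction-bound 2 (2 * (n ^ h * n ^ h)) (S Ω bad) (*-mono-≤ (m^n>0 2 E) (m^n>0 2 (h * h)))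
      (subst (λ N → S Ω bad * (2 ^ E * 2 ^ (h * h)) ≤ N * (3 ^ (h * h) * size Ω)) (trans (size-× (finSpace 2) (vec-pairs n h)) (cong (2 *_) (size-vec-pairs n h)))
        (union-bound Ω I event (λ { (s , zs , ts) → rectangle-bound (mem zs) (mem ts) s 2 E (h * h) (s≤s z≤n) (*-mono-≤ (#-mem zs) (#-mem ts)) })))
      rare)
    (m<m+n (size Ω) (≤-trans (size-matrix>0 1 n n) (m≤m+n _ 0))))
  balanced : ∀ τ → bad τ ≡ 0 → ∀ s (Z T : Fin n → Bool) → # Z ≡ h → # T ≡ h → h * h ≤ E + ∑ (λ u → ⟦ Z u ⟧ * ∑ (λ v → ⟦ T v ⟧ * ⟦ at τ u v == s ⟧))
  balanced τ none-bad s Z T #Z #T with enumerate-exact Z h #Z | enumerate-exact T h #T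
  ... | zs , zs≗Z | ts , ts≗T = begin
    h * h
      ≡⟨ trans (cong₂ _*_ (sym #Z) (sym #T)) (trans (sym (∑-rectangle Z T)) (sum-cong-≗ (λ u → sum-cong-≗ (λ v → partition (Z u ∧ T v) (at τ u v))))) ⟩
    ∑ (λ u → ∑ (λ v → cell (opposite s) u v + cell s u v))
      ≡⟨ trans (sum-cong-≗ (λ u → ∑-distrib-+ (cell (opposite s) u) (cell s u))) (∑-distrib-+ (λ u → ∑ (cell (opposite s) u)) _) ⟩
    ∑ (λ u → ∑ (cell (opposite s) u)) + ∑ (λ u → ∑ (cell s u))
      ≤⟨ +-mono-≤ few (≤-reflexive (∑-rectangle-nested Z T (λ u v → at τ u v == s))) ⟩
    E + ∑ (λ u → ⟦ Z u ⟧ * ∑ (λ v → ⟦ T v ⟧ * ⟦ at τ u v == s ⟧)) ∎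
    where
    open ≤-Reasoning
    cell : Fin 2 → Fin n → Fin n → ℕ
    cell s u v = ⟦ (Z u ∧ T v) ∧ (at τ u v == s) ⟧
    partition : ∀ b c → ⟦ b ⟧ ≡ ⟦ b ∧ (c == opposite s) ⟧ + ⟦ b ∧ (c == s) ⟧
    partition true c = trans (sym (==-opposite c s)) (+-comm ⟦ c == s ⟧ _)
    partition false c = refl
    few : ∑ (λ u → ∑ (cell (opposite s) u)) ≤ E
    few = subst (_≤ E)
      (sum-cong-≗ (λ u → sum-cong-≗ (λ v → cong (λ b → ⟦ b ∧ (at τ u v == opposite s) ⟧) (cong₂ _∧_ (zs≗Z u) (ts≗T v)))))
      (<⇒≤ (⟦≤ᵇ⟧≡0⇒< E (∑ (λ u → ∑ (λ v → ⟦ (mem zs u ∧ mem ts v) ∧ (at τ u v == opposite s) ⟧)))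
        (none I (λ i → event i τ) (opposite s , zs , ts) none-bad)))

-- Expected numbers of edges, paths and triangles of one colour

selects : ∀ {M r} → Vec (Fin M × Fin M) r → Fin M → Fin M → Bool
selects [] z x = false
selects ((a , b) ∷ es) z x = ((a == z) ∧ (b == x)) ∨ selects es z x

Distinct : ∀ {M r} → Vec (Fin M × Fin M) r → Set
Distinct [] = ⊤
Distinct ((a , b) ∷ es) = selects es a b ≡ false × Distinct es

all-equal : ∀ {M m r} → Vec (Vec (Fin m) M) M → Fin m → Vec (Fin M × Fin M) r → Bool
all-equal ρ i [] = true
all-equal ρ i ((a , b) ∷ es) = (at ρ a b == i) ∧ all-equal ρ i es

all-equal-at : ∀ {M m r} (ρ : Vec (Vec (Fin m) M) M) i (es : Vec (Fin M × Fin M) r) z x →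
  all-equal ρ i es ≡ true → selects es z x ≡ true → (at ρ z x == i) ≡ true
all-equal-at ρ i ((a , b) ∷ es) z x all sel with ∧-split {at ρ a b == i} all | ∨-elim {(a == z) ∧ (b == x)} sel
... | _ , rest | inj₂ later = all-equal-at ρ i es z x rest later
... | here , _ | inj₁ eq with ∧-split {a == z} eq
...   | az , bx with refl ← ==⇒≡ a z az | refl ← ==⇒≡ b x bx = here

count-selected : ∀ {M r} (es : Vec (Fin M × Fin M) r) → Distinct es → ∑ (λ z → ∑ (λ x → ⟦ selects es z x ⟧)) ≡ r
count-selected {M} [] _ = ∑-zero {M} (λ z → ∑-zero {M} (λ x → refl))
count-selected {M} {suc r} ((a , b) ∷ es) (fresh , distinct) = begin
  ∑ (λ z → ∑ (λ x → ⟦ ((a == z) ∧ (b == x)) ∨ selects es z x ⟧))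
    ≡⟨ sum-cong-≗ (λ z → sum-cong-≗ (λ x → exclusive z x)) ⟩
  ∑ (λ z → ∑ (λ x → ⟦ (a == z) ∧ (b == x) ⟧ + ⟦ selects es z x ⟧))
    ≡⟨ trans (sum-cong-≗ (λ z → ∑-distrib-+ (λ x → ⟦ (a == z) ∧ (b == x) ⟧) _)) (∑-distrib-+ (λ z → ∑ (λ x → ⟦ (a == z) ∧ (b == x) ⟧)) _) ⟩
  ∑ (λ z → ∑ (λ x → ⟦ (a == z) ∧ (b == x) ⟧)) + ∑ (λ z → ∑ (λ x → ⟦ selects es z x ⟧))
    ≡⟨ cong₂ _+_ (trans (∑-rectangle (a ==_) (b ==_)) (cong₂ _*_ (#-singleton a) (#-singleton b))) (count-selected es distinct) ⟩
  suc r ∎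
  where
  open ≡-Reasoning
  exclusive : ∀ z x → ⟦ ((a == z) ∧ (b == x)) ∨ selects es z x ⟧ ≡ ⟦ (a == z) ∧ (b == x) ⟧ + ⟦ selects es z x ⟧
  exclusive z x with (a == z) ∧ (b == x) in e
  ... | false = refl
  ... | true with ∧-split {a == z} e
  ...   | az , bx with refl ← ==⇒≡ a z az | refl ← ==⇒≡ b x bx = cong (λ c → 1 + ⟦ c ⟧) (sym fresh)

-- The moment with base 0 of the number of selected entries that differ from `i`; distinctness makes
-- the number of charged cells exactly `r`.
fixed-entries : ∀ {M m r} (es : Vec (Fin M × Fin M) r) (i : Fin m) → Distinct es →
  S (matrixSpace (finSpace m) M M) (λ ρ → ⟦ all-equal ρ i es ⟧) * m ^ r ≤ size (matrixSpace (finSpace m) M M)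
fixed-entries {M} {m} {r} es i distinct = begin
  S Ω (λ ρ → ⟦ all-equal ρ i es ⟧) * m ^ r
    ≤⟨ *-monoˡ-≤ (m ^ r) (S-mono Ω indicator) ⟩
  S Ω (λ ρ → 0 ^ misses ρ) * m ^ r
    ≡⟨ cong (λ N → S Ω (λ ρ → 0 ^ misses ρ) * m ^ N) (count-selected es distinct) ⟨
  S Ω (λ ρ → 0 ^ misses ρ) * m ^ N
    ≤⟨ matrix-moment (finSpace m) 0 1 m (λ z x c → ⟦ selects es z x ∧ not (c == i) ⟧) (λ z x → ⟦ selects es z x ⟧) (λ z x → miss-cell (selects es z x) i) ⟩
  1 ^ N * size Ω
    ≡⟨ trans (cong (_* size Ω) (^-zeroˡ N)) (*-identityˡ (size Ω)) ⟩
  size Ω ∎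
  where
  open ≤-Reasoning
  Ω = matrixSpace (finSpace m) M M
  N = ∑ (λ z → ∑ (λ x → ⟦ selects es z x ⟧))
  misses : _ → ℕ
  misses ρ = ∑ (λ z → ∑ (λ x → ⟦ selects es z x ∧ not (at ρ z x == i) ⟧))
  indicator : ∀ ρ → ⟦ all-equal ρ i es ⟧ ≤ 0 ^ misses ρ
  indicator ρ with all-equal ρ i es in all
  ... | false = z≤n
  ... | true = ≤-reflexive (cong (0 ^_) (sym (∑-zero (λ z → ∑-zero (λ x → hit z x)))))
    where
    hit : ∀ z x → ⟦ selects es z x ∧ not (at ρ z x == i) ⟧ ≡ 0
    hit z x with selects es z x in sel
    ... | false = refl
    ... | true rewrite all-equal-at ρ i es z x all sel = refl

ordered : ∀ {M} → Fin M → Fin M → Fin M × Fin M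
ordered x y = if toℕ x <ᵇ toℕ y then (x , y) else (y , x)

ordered-inj : ∀ {M} (x y z w : Fin M) → ordered x y ≡ ordered z w → (x ≡ z × y ≡ w) ⊎ (x ≡ w × y ≡ z)
ordered-inj x y z w eq with toℕ x <ᵇ toℕ y | toℕ z <ᵇ toℕ w
ordered-inj x y z w refl | true | true = inj₁ (refl , refl)
ordered-inj x y z w refl | true | false = inj₂ (refl , refl)
ordered-inj x y z w refl | false | true = inj₂ (refl , refl)
ordered-inj x y z w refl | false | false = inj₁ (refl , refl)

adj↑-ordered : ∀ {M} (W : Fin M → Fin M → Bool) x y → adj↑ W x y ≡ true → W (proj₁ (ordered x y)) (proj₂ (ordered x y)) ≡ true
adj↑-ordered W x y a with adj↑-elim W x y a
... | inj₁ (x<y , w) rewrite <ᵇ-true x<y = w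
... | inj₂ (y<x , w) with toℕ x <ᵇ toℕ y in e
...   | true = ⊥-elim (<-asym y<x (true-<ᵇ (toℕ x) (toℕ y) e))
...   | false = w

not-selected : ∀ {M r} (es : Vec (Fin M × Fin M) r) (e : Fin M × Fin M) → (∀ j → lookup es j ≡ e → ⊥) → selects es (proj₁ e) (proj₂ e) ≡ false
not-selected [] e fresh = refl
not-selected ((a , b) ∷ es) (c , d) fresh with (a == c) ∧ (b == d) in eq
... | false = not-selected es (c , d) (fresh ∘ suc)
... | true with ∧-split {a == c} eq
...   | ac , bd = ⊥-elim (fresh zero (cong₂ _,_ (==⇒≡ a c ac) (==⇒≡ b d bd)))

module _ {M m : ℕ} (i : Fin m) where

  private
    Ω = matrixSpace (finSpace m) M M
    W : Vec (Vec (Fin m) M) M → Fin M → Fin M → Bool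
    W ρ x y = at ρ x y == i

  edge-moment : ∀ x y → S Ω (λ ρ → ⟦ adj↑ (W ρ) x y ⟧) * m ≤ size Ω
  edge-moment x y = ≤-trans
    (*-mono-≤ (S-mono Ω (λ ρ → ⟦⟧-mono {adj↑ (W ρ) x y} (λ a → ∧-intro (adj↑-ordered (W ρ) x y a) refl))) (≤-reflexive (sym (*-identityʳ m))))
    (fixed-entries (ordered x y ∷ []) i (refl , tt))

  path-moment : ∀ x y z → x ≢ y → S Ω (λ ρ → ⟦ adj↑ (W ρ) z x ∧ adj↑ (W ρ) z y ⟧) * m ^ 2 ≤ size Ω
  path-moment x y z x≢y = ≤-trans
    (*-monoˡ-≤ (m ^ 2) (S-mono Ω (λ ρ → ⟦⟧-mono {adj↑ (W ρ) z x ∧ adj↑ (W ρ) z y} (λ a → let p , q = ∧-split {adj↑ (W ρ) z x} a in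
      ∧-intro (adj↑-ordered (W ρ) z x p) (∧-intro (adj↑-ordered (W ρ) z y q) refl)))))
    (fixed-entries (ordered z x ∷ ordered z y ∷ []) i (not-selected (ordered z y ∷ []) (ordered z x) fresh , refl , tt))
    where
    fresh : ∀ j → lookup (ordered z y ∷ []) j ≡ ordered z x → ⊥
    fresh zero eq with ordered-inj z y z x eq
    ... | inj₁ (_ , y≡x) = x≢y (sym y≡x)
    ... | inj₂ (z≡x , y≡z) = x≢y (sym (trans y≡z z≡x))

  -- Three different entries have to equal `i`. If `z` is `x` or `y` the event is empty, because
  -- `adj↑` is irreflexive.
  triangle-moment : ∀ x y z → x ≢ y → S Ω (λ ρ → ⟦ adj↑ (W ρ) x y ∧ (adj↑ (W ρ) z x ∧ adj↑ (W ρ) z y) ⟧) * m ^ 3 ≤ size Ω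
  triangle-moment x y z x≢y with z Fin.≟ x | z Fin.≟ y
  ... | yes refl | _ = ≤-trans (≤-reflexive (cong (_* m ^ 3) (trans (S-cong Ω (λ ρ → vanish ρ)) (S-const Ω 0)))) z≤n
    where
    vanish : ∀ ρ → ⟦ adj↑ (W ρ) x y ∧ (adj↑ (W ρ) x x ∧ adj↑ (W ρ) x y) ⟧ ≡ 0
    vanish ρ rewrite adj↑-irrefl (W ρ) x with adj↑ (W ρ) x y
    ... | true = refl
    ... | false = refl
  ... | no _ | yes refl = ≤-trans (≤-reflexive (cong (_* m ^ 3) (trans (S-cong Ω (λ ρ → vanish ρ)) (S-const Ω 0)))) z≤n
    where
    vanish : ∀ ρ → ⟦ adj↑ (W ρ) x y ∧ (adj↑ (W ρ) y x ∧ adj↑ (W ρ) y y) ⟧ ≡ 0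
    vanish ρ rewrite adj↑-irrefl (W ρ) y with adj↑ (W ρ) x y | adj↑ (W ρ) y x
    ... | true | true = refl
    ... | true | false = refl
    ... | false | _ = refl
  ... | no z≢x | no z≢y = ≤-trans
    (*-monoˡ-≤ (m ^ 3) (S-mono Ω (λ ρ → ⟦⟧-mono {adj↑ (W ρ) x y ∧ (adj↑ (W ρ) z x ∧ adj↑ (W ρ) z y)} (λ a →
      let r , pq = ∧-split {adj↑ (W ρ) x y} a ; p , q = ∧-split {adj↑ (W ρ) z x} pq in
      ∧-intro (adj↑-ordered (W ρ) x y r) (∧-intro (adj↑-ordered (W ρ) z x p) (∧-intro (adj↑-ordered (W ρ) z y q) refl))))))
    (fixed-entries (ordered x y ∷ ordered z x ∷ ordered z y ∷ []) i
      (not-selected (ordered z x ∷ ordered z y ∷ []) (ordered x y) fresh₁ , not-selected (ordered z y ∷ []) (ordered z x) fresh₂ , refl , tt))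
    where
    fresh₁ : ∀ j → lookup (ordered z x ∷ ordered z y ∷ []) j ≡ ordered x y → ⊥
    fresh₁ zero eq with ordered-inj z x x y eq
    ... | inj₁ (z≡x , _) = z≢x z≡x
    ... | inj₂ (z≡y , _) = z≢y z≡y
    fresh₁ (suc zero) eq with ordered-inj z y x y eq
    ... | inj₁ (z≡x , _) = z≢x z≡x
    ... | inj₂ (z≡y , _) = z≢y z≡y
    fresh₂ : ∀ j → lookup (ordered z y ∷ []) j ≡ ordered z x → ⊥
    fresh₂ zero eq with ordered-inj z y z x eq
    ... | inj₁ (_ , y≡x) = x≢y (sym y≡x)
    ... | inj₂ (z≡x , _) = z≢x z≡x

  S-exists : ∀ {k} (P : Fin k → Vec (Vec (Fin m) M) M → Bool) Q B → (∀ z → S Ω (λ ρ → ⟦ P z ρ ⟧) * Q ≤ B) →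
    S Ω (λ ρ → ⟦ ex (λ z → P z ρ) ⟧) * Q ≤ k * B
  S-exists {k} P Q B bound = ≤-trans (*-monoˡ-≤ Q (S-mono Ω (λ ρ → ⟦ex⟧≤# (λ z → P z ρ))))
    (subst (λ N → S Ω (λ ρ → # (λ z → P z ρ)) * Q ≤ N * B) (size-fin k) (union-bound Ω (finSpace k) (λ z ρ → ⟦ P z ρ ⟧) bound))

  closed-moment : ∀ x y → x ≢ y → S Ω (λ ρ → ⟦ closed (W ρ) x y ⟧) * m ^ 2 ≤ M * size Ω
  closed-moment x y x≢y = S-exists (λ z ρ → adj↑ (W ρ) z x ∧ adj↑ (W ρ) z y) (m ^ 2) (size Ω) (λ z → path-moment x y z x≢y)

  closed-edge-moment : ∀ x y → x ≢ y → S Ω (λ ρ → ⟦ adj↑ (W ρ) x y ⟧ * ⟦ closed (W ρ) x y ⟧) * m ^ 3 ≤ M * size Ω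
  closed-edge-moment x y x≢y = ≤-trans
    (*-monoˡ-≤ (m ^ 3) (S-mono Ω (λ ρ → ≤-trans (≤-reflexive (sym (⟦∧⟧ (adj↑ (W ρ) x y) _)))
      (⟦⟧-mono {adj↑ (W ρ) x y ∧ closed (W ρ) x y} (distribute ρ)))))
    (S-exists (λ z ρ → adj↑ (W ρ) x y ∧ (adj↑ (W ρ) z x ∧ adj↑ (W ρ) z y)) (m ^ 3) (size Ω) (λ z → triangle-moment x y z x≢y))
    where
    distribute : ∀ ρ → adj↑ (W ρ) x y ∧ closed (W ρ) x y ≡ true → ex (λ z → adj↑ (W ρ) x y ∧ (adj↑ (W ρ) z x ∧ adj↑ (W ρ) z y)) ≡ true
    distribute ρ p with ∧-split {adj↑ (W ρ) x y} p
    ... | a , c with ex-elim (λ z → adj↑ (W ρ) z x ∧ adj↑ (W ρ) z y) c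
    ...   | z , path = ex-intro (λ z → adj↑ (W ρ) x y ∧ (adj↑ (W ρ) z x ∧ adj↑ (W ρ) z y)) z (∧-intro a path)

-- Colouring both sides without bad events

pairSpace : ∀ {A} → Space A → Space (A × A)
pairSpace X = X ×ₛ X

-- Sum over the matrix of the other side last: a bound that is uniform in `σ` survives averaging.
condition : ∀ {A} (X : Space A) s (F : A → A → ℕ) Q P → (∀ σ → S X (λ ρ → F ρ σ) * Q ≤ P * size X) →
  S (pairSpace X) (λ ω → F (proj s ω) (proj (opposite s) ω)) * Q ≤ P * size (pairSpace X)
condition X s F Q P bound = begin
  S (pairSpace X) (λ ω → F (proj s ω) (proj (opposite s) ω)) * Q   ≡⟨ cong (_* Q) (outer s) ⟩
  S X (λ σ → S X (λ ρ → F ρ σ)) * Q                               ≤⟨ union-bound′ ⟩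
  size X * (P * size X)                                           ≡⟨ regroup (size X) P ⟩
  P * (size X * size X)                                           ≡⟨ cong (P *_) (size-× X X) ⟨
  P * size (pairSpace X)                                          ∎
  where
  open ≤-Reasoning
  union-bound′ : S X (λ σ → S X (λ ρ → F ρ σ)) * Q ≤ size X * (P * size X)
  union-bound′ = subst (λ N → N * Q ≤ size X * (P * size X)) (S-swap X (S-linear X) F) (union-bound X X (λ σ ρ → F ρ σ) bound)
  regroup : ∀ z P → z * (P * z) ≡ P * (z * z)
  regroup = solve-∀
  outer : ∀ s → S (pairSpace X) (λ ω → F (proj s ω) (proj (opposite s) ω)) ≡ S X (λ σ → S X (λ ρ → F ρ σ))
  outer zero = S-swap X (S-linear X) F
  outer (suc zero) = refl

S-product : ∀ {A} (X : Space A) s (f g : A → ℕ) → S (pairSpace X) (λ ω → f (proj s ω) * g (proj (opposite s) ω)) ≡ S X f * S X g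
S-product X zero f g = trans (S-cong X (λ ρ → S-* X (f ρ) g)) (S-*ʳ X f (S X g))
S-product X (suc zero) f g = trans (S-cong X (λ σ → S-*ʳ X f (g σ))) (S-* X (S X f) g)

-- With the bad events weighted by `R`, a single averaging argument yields both that none of them
-- occurs and that the loss `l` stays below `R`.
factor≡0 : ∀ R e l → R * e + l < R → e ≡ 0
factor≡0 R zero l lt = refl
factor≡0 R (suc e) l lt = ⊥-elim (<⇒≱ lt (≤-trans (m≤m*n R (suc e)) (m≤m+n (R * suc e) l)))

module _ {n M m : ℕ} (π : Fin 2 → Fin n → Fin M) where

  private
    Mat = Vec (Vec (Fin m) M) M
    W : Mat → Fin m → Fin M → Fin M → Bool
    W ρ i x y = at ρ x y == i

  apart : Fin n → Fin n → Bool
  apart u v = not (π zero v == π zero u) ∧ not (π (suc zero) v == π (suc zero) u)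

  -- On the own side `closed` replaces `below`: it is implied by it and its mean is still small. The
  -- sum over both `s`, whatever `τ u v` is, makes the loss independent of the sides.
  lost-term : Mat × Mat → Fin n → Fin n → Fin 2 → Fin m → ℕ
  lost-term ω u v s i = ⟦ adj↑ (W (proj s ω) i) (π s u) (π s v) ⟧ * ⟦ closed (W (proj s ω) i) (π s u) (π s v) ⟧
    + ⟦ adj↑ (W (proj s ω) i) (π s u) (π s v) ⟧ * ⟦ closed (W (proj (opposite s) ω) i) (π (opposite s) u) (π (opposite s) v) ⟧

  lost : Mat × Mat → ℕ
  lost ω = ∑ (λ u → ∑ (λ v → ⟦ apart u v ⟧ * ∑ (λ s → ∑ (λ i → lost-term ω u v s i))))

module _ {n M m : ℕ} (h t b D K R₀ : ℕ) (τ : Fin n → Fin n → Fin 2) (π : Fin 2 → Fin n → Fin M) where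

  -- `hit` says that `K` open pairs cannot all miss colour `i`. It is stated as a vanishing product,
  -- the form whose mean was bounded.
  record Colouring : Set where
    field
      ω : Vec (Vec (Fin m) M) M × Vec (Vec (Fin m) M) M
      spread : ∀ s i → Spread (λ x y → at (proj s ω) x y == i) D b t
      hit : ∀ s i zs ts → ⟦ K ≤ᵇ open-pairs (allowed τ π s i (proj (opposite s) ω) (mem {n} {h} zs) (mem {n} {h} ts)) i (proj s ω) ⟧
        * 0 ^ hits (allowed τ π s i (proj (opposite s) ω) (mem zs) (mem ts)) i (proj s ω) ≡ 0
      lost< : lost π ω < R₀

module _ (n M m′ h t b D c K R₀ : ℕ) (0<c : 0 < c) (x₀ : Fin M)
  (τ : Fin n → Fin n → Fin 2) (π : Fin 2 → Fin n → Fin M)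
  (degrees-rare : 10 * (2 * (suc m′ * M) * (m′ + 2) ^ M) ≤ 2 ^ D * suc m′ ^ M)
  (dense-rare : 10 * (2 * (suc m′ * (M ^ t * M ^ t)) * (m′ + c) ^ (t * t)) ≤ c ^ (b * t) * suc m′ ^ (t * t))
  (missing-rare : 10 * (2 * (suc m′ * (n ^ h * n ^ h)) * m′ ^ K) ≤ suc m′ ^ K)
  (few-lost : 10 * (n * (n * (2 * (suc m′ * (M + M))))) ≤ R₀ * suc m′ ^ 3) where

  private
    m = suc m′
    Mat = Vec (Vec (Fin m) M) M
    X = matrixSpace (finSpace m) M M
    Ω = pairSpace X
    W : Mat → Fin m → Fin M → Fin M → Bool
    W ρ i x y = at ρ x y == i

  private
    apart⇒≢ : ∀ s u v → apart {m = m} π u v ≡ true → π s u ≢ π s v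
    apart⇒≢ zero u v ap eq = true≢false (≡⇒== (sym eq)) (not-true (proj₁ (∧-split {not (π zero v == π zero u)} ap)))
    apart⇒≢ (suc zero) u v ap eq = true≢false (≡⇒== (sym eq)) (not-true (proj₂ (∧-split {not (π zero v == π zero u)} ap)))

    -- Both summands have mean at most M/m³: the first prescribes three entries of one matrix, the
    -- second splits by independence into an edge, 1/m, and a closed pair, M/m².
    lost-term-moment : ∀ u v s i → apart {m = m} π u v ≡ true → S Ω (λ ω → lost-term π ω u v s i) * m ^ 3 ≤ (M + M) * size Ω
    lost-term-moment u v s i ap = begin
      S Ω (λ ω → lost-term π ω u v s i) * m ^ 3
        ≡⟨ trans (cong (_* m ^ 3) (S-+ Ω (λ ω → f (proj s ω) * g₁ (proj s ω)) (λ ω → f (proj s ω) * g (proj (opposite s) ω)))) (*-distribʳ-+ (m ^ 3) (S Ω (λ ω → f (proj s ω) * g₁ (proj s ω))) _) ⟩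
      S Ω (λ ω → f (proj s ω) * g₁ (proj s ω)) * m ^ 3 + S Ω (λ ω → f (proj s ω) * g (proj (opposite s) ω)) * m ^ 3
        ≤⟨ +-mono-≤ (condition X s (λ ρ _ → f ρ * g₁ ρ) (m ^ 3) M (λ _ → closed-edge-moment i (π s u) (π s v) (apart⇒≢ s u v ap))) mixed ⟩
      M * size Ω + M * size Ω
        ≡⟨ *-distribʳ-+ (size Ω) M M ⟨
      (M + M) * size Ω ∎
      where
      open ≤-Reasoning
      f g₁ g : Mat → ℕ
      f ρ = ⟦ adj↑ (W ρ i) (π s u) (π s v) ⟧
      g₁ ρ = ⟦ closed (W ρ i) (π s u) (π s v) ⟧
      g σ = ⟦ closed (W σ i) (π (opposite s) u) (π (opposite s) v) ⟧
      arrange : ∀ a b p q → a * b * (p * q) ≡ (a * p) * (b * q)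
      arrange = solve-∀
      mixed : S Ω (λ ω → f (proj s ω) * g (proj (opposite s) ω)) * m ^ 3 ≤ M * size Ω
      mixed = begin
        S Ω (λ ω → f (proj s ω) * g (proj (opposite s) ω)) * (m * m ^ 2)  ≡⟨ cong (_* (m * m ^ 2)) (S-product X s f g) ⟩
        S X f * S X g * (m * m ^ 2)                  ≡⟨ arrange (S X f) (S X g) m (m ^ 2) ⟩
        (S X f * m) * (S X g * m ^ 2)                ≤⟨ *-mono-≤ (edge-moment i (π s u) (π s v)) (closed-moment i (π (opposite s) u) (π (opposite s) v) (apart⇒≢ (opposite s) u v ap)) ⟩
        size X * (M * size X)                        ≡⟨ exchange (size X) M ⟩
        M * (size X * size X)                        ≡⟨ cong (M *_) (size-× X X) ⟨
        M * size Ω                                   ∎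
        where
        exchange : ∀ z M → z * (M * z) ≡ M * (z * z)
        exchange = solve-∀

    ∑-moment : ∀ {k} (f : Fin k → Mat × Mat → ℕ) P → (∀ j → S Ω (f j) * m ^ 3 ≤ P * size Ω) → S Ω (λ ω → ∑ (λ j → f j ω)) * m ^ 3 ≤ k * P * size Ω
    ∑-moment {k} f P bound = ≤-trans (subst (λ N → S Ω (λ ω → ∑ (λ j → f j ω)) * m ^ 3 ≤ N * (P * size Ω)) (size-fin k)
      (union-bound Ω (finSpace k) f bound)) (≤-reflexive (sym (*-assoc k P (size Ω))))

    lost-moment : S Ω (lost π) * m ^ 3 ≤ n * (n * (2 * (m * (M + M)))) * size Ω
    lost-moment = ∑-moment (λ u ω → ∑ (λ v → ⟦ apart {m = m} π u v ⟧ * ∑ (λ s → ∑ (λ i → lost-term π ω u v s i)))) (n * (2 * (m * (M + M)))) (λ u →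
      ∑-moment (λ v ω → ⟦ apart {m = m} π u v ⟧ * ∑ (λ s → ∑ (λ i → lost-term π ω u v s i))) (2 * (m * (M + M))) (λ v → pair u v))
      where
      pair : ∀ u v → S Ω (λ ω → ⟦ apart {m = m} π u v ⟧ * ∑ (λ s → ∑ (λ i → lost-term π ω u v s i))) * m ^ 3 ≤ 2 * (m * (M + M)) * size Ω
      pair u v with apart {m = m} π u v in ap
      ... | false = ≤-trans (≤-reflexive (cong (_* m ^ 3) (S-const Ω 0))) z≤n
      ... | true = ≤-trans (≤-reflexive (cong (_* m ^ 3) (S-cong Ω (λ ω → +-identityʳ (∑ (λ s → ∑ (λ i → lost-term π ω u v s i)))))))
        (∑-moment (λ s ω → ∑ (λ i → lost-term π ω u v s i)) (m * (M + M)) (λ s → ∑-moment (λ i ω → lost-term π ω u v s i) (M + M) (λ i → lost-term-moment u v s i ap)))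

    Cells = finSpace 2 ×ₛ (finSpace m ×ₛ finSpace M)
    Blocks = finSpace 2 ×ₛ (finSpace m ×ₛ vec-pairs M t)
    Sets = finSpace 2 ×ₛ (finSpace m ×ₛ vec-pairs n h)

    count : Mat → Fin m → (Fin M → Bool) → (Fin M → Bool) → ℕ
    count ρ i Z T = ∑ (λ z → ∑ (λ x → ⟦ (Z z ∧ T x) ∧ W ρ i z x ⟧))

    all : Fin M → Bool
    all _ = true

    row-event col-event : Fin 2 × (Fin m × Fin M) → Mat × Mat → ℕ
    row-event (s , i , z) ω = ⟦ D ≤ᵇ count (proj s ω) i (z ==_) all ⟧
    col-event (s , i , x) ω = ⟦ D ≤ᵇ count (proj s ω) i all (x ==_) ⟧

    block-event : Fin 2 × (Fin m × (Vec (Fin M) t × Vec (Fin M) t)) → Mat × Mat → ℕ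
    block-event (s , i , zs , ts) ω = ⟦ b * t ≤ᵇ count (proj s ω) i (mem zs) (mem ts) ⟧

    set-event : Fin 2 × (Fin m × (Vec (Fin n) h × Vec (Fin n) h)) → Mat × Mat → ℕ
    set-event (s , i , zs , ts) ω =
      ⟦ K ≤ᵇ open-pairs (allowed τ π s i (proj (opposite s) ω) (mem zs) (mem ts)) i (proj s ω) ⟧
        * 0 ^ hits (allowed τ π s i (proj (opposite s) ω) (mem zs) (mem ts)) i (proj s ω)

    #-all : # all ≡ M
    #-all = trans (∑-const M 1) (*-identityʳ M)

    rare : ∀ {I} (Y : Space I) (event : I → Mat × Mat → ℕ) N {P Q} → size Y ≡ N → 0 < Q →
      (∀ j → S Ω (event j) * Q ≤ P * size Ω) → 10 * (N * P) ≤ Q → 10 * S Ω (λ ω → S Y (λ j → event j ω)) ≤ size Ω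
    rare Y event N {P} {Q} eq 0<Q bound small = fraction-bound 10 N (S Ω (λ ω → S Y (λ j → event j ω))) 0<Q
      (subst (λ N → S Ω (λ ω → S Y (λ j → event j ω)) * Q ≤ N * (P * size Ω)) eq (union-bound Ω Y event bound)) small

    size-indexed : ∀ {I} (Y : Space I) N → size Y ≡ N → size (finSpace 2 ×ₛ (finSpace m ×ₛ Y)) ≡ 2 * (m * N)
    size-indexed Y N eq = trans (size-× (finSpace 2) (finSpace m ×ₛ Y)) (cong (2 *_) (trans (size-× (finSpace m) Y) (cong₂ _*_ (size-fin m) eq)))

    pow>0 : ∀ e → 0 < m ^ e
    pow>0 e = m^n>0 m e

    rows-rare : 10 * S Ω (λ ω → S Cells (λ j → row-event j ω)) ≤ size Ω
    rows-rare = rare Cells row-event (2 * (m * M)) (size-indexed (finSpace M) M (size-fin M)) (*-mono-≤ (m^n>0 2 D) (pow>0 M))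
      (λ { (s , i , z) → condition X s (λ ρ _ → ⟦ D ≤ᵇ count ρ i (z ==_) all ⟧) _ ((m′ + 2) ^ M)
        (λ _ → rectangle-bound (z ==_) all i 2 D M (s≤s z≤n) (≤-reflexive (trans (cong₂ _*_ (#-singleton z) #-all) (*-identityˡ M)))) }) degrees-rare

    cols-rare : 10 * S Ω (λ ω → S Cells (λ j → col-event j ω)) ≤ size Ω
    cols-rare = rare Cells col-event (2 * (m * M)) (size-indexed (finSpace M) M (size-fin M)) (*-mono-≤ (m^n>0 2 D) (pow>0 M))
      (λ { (s , i , x) → condition X s (λ ρ _ → ⟦ D ≤ᵇ count ρ i all (x ==_) ⟧) _ ((m′ + 2) ^ M)
        (λ _ → rectangle-bound all (x ==_) i 2 D M (s≤s z≤n) (≤-reflexive (trans (cong₂ _*_ #-all (#-singleton x)) (*-identityʳ M)))) }) degrees-rare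

    blocks-rare : 10 * S Ω (λ ω → S Blocks (λ j → block-event j ω)) ≤ size Ω
    blocks-rare = rare Blocks block-event (2 * (m * (M ^ t * M ^ t))) (size-indexed (vec-pairs M t) _ (size-vec-pairs M t))
      (*-mono-≤ (m^n>0 c {{>-nonZero 0<c}} (b * t)) (pow>0 (t * t)))
      (λ { (s , i , zs , ts) → condition X s (λ ρ _ → ⟦ b * t ≤ᵇ count ρ i (mem zs) (mem ts) ⟧) _ ((m′ + c) ^ (t * t))
        (λ _ → rectangle-bound (mem zs) (mem ts) i c (b * t) (t * t) 0<c (*-mono-≤ (#-mem zs) (#-mem ts))) }) dense-rare

    sets-rare : 10 * S Ω (λ ω → S Sets (λ j → set-event j ω)) ≤ size Ω
    sets-rare = rare Sets set-event (2 * (m * (n ^ h * n ^ h))) (size-indexed (vec-pairs n h) _ (size-vec-pairs n h)) (pow>0 K)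
      (λ { (s , i , zs , ts) → condition X s (λ ρ σ → ⟦ K ≤ᵇ open-pairs (allowed τ π s i σ (mem zs) (mem ts)) i ρ ⟧ * 0 ^ hits (allowed τ π s i σ (mem zs) (mem ts)) i ρ)
        (m ^ K) (m′ ^ K) (λ σ → no-hit-bound (allowed τ π s i σ (mem zs) (mem ts)) i K) }) missing-rare

    events : Mat × Mat → ℕ
    events ω = (S Cells (λ j → row-event j ω) + S Cells (λ j → col-event j ω)) + (S Blocks (λ j → block-event j ω) + S Sets (λ j → set-event j ω))

    lost-small : 10 * S Ω (lost π) ≤ R₀ * size Ω
    lost-small = *-cancelʳ-≤ _ _ (m ^ 3) {{>-nonZero (pow>0 3)}} (begin
      10 * S Ω (lost π) * m ^ 3                              ≡⟨ *-assoc 10 (S Ω (lost π)) _ ⟩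
      10 * (S Ω (lost π) * m ^ 3)                            ≤⟨ *-monoʳ-≤ 10 lost-moment ⟩
      10 * (n * (n * (2 * (m * (M + M)))) * size Ω)      ≡⟨ *-assoc 10 (n * (n * (2 * (m * (M + M))))) (size Ω) ⟨
      10 * (n * (n * (2 * (m * (M + M))))) * size Ω      ≤⟨ *-monoˡ-≤ (size Ω) few-lost ⟩
      R₀ * m ^ 3 * size Ω                                ≡⟨ swap R₀ (m ^ 3) (size Ω) ⟩
      R₀ * size Ω * m ^ 3                                ∎)
      where
      open ≤-Reasoning
      swap : ∀ a b c → a * b * c ≡ a * c * b
      swap = solve-∀

    combined-rare : 0 < R₀ → S Ω (λ ω → R₀ * events ω + lost π ω) < S Ω (λ _ → R₀)
    combined-rare 0<R₀ = *-cancelˡ-< 10 _ _ (begin-strict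
      10 * S Ω (λ ω → R₀ * events ω + lost π ω)
        ≡⟨ cong (10 *_) (trans (S-+ Ω (λ ω → R₀ * events ω) (lost π)) (cong (_+ S Ω (lost π)) (trans (S-* Ω R₀ events) (cong (R₀ *_) sum-events)))) ⟩
      10 * (R₀ * (e₁ + e₂ + (e₃ + e₄)) + S Ω (lost π))
        ≡⟨ expand R₀ e₁ e₂ e₃ e₄ (S Ω (lost π)) ⟩
      R₀ * (10 * e₁ + 10 * e₂ + (10 * e₃ + 10 * e₄)) + 10 * S Ω (lost π)
        ≤⟨ +-mono-≤ (*-monoʳ-≤ R₀ (+-mono-≤ (+-mono-≤ rows-rare cols-rare) (+-mono-≤ blocks-rare sets-rare))) lost-small ⟩
      R₀ * (z + z + (z + z)) + R₀ * z
        -- Four kinds of events and the loss take a tenth each; the remaining half makes the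
        -- inequality strict.
        <⟨ m<m+n _ (*-mono-≤ 0<R₀ (≤-trans size>0 (m≤n*m z 5))) ⟩
      R₀ * (z + z + (z + z)) + R₀ * z + R₀ * (5 * z)
        ≡⟨ ten R₀ z ⟩
      10 * (R₀ * z)
        ≡⟨ cong (10 *_) (S-const Ω R₀) ⟨
      10 * S Ω (λ _ → R₀) ∎)
      where
      open ≤-Reasoning
      z = size Ω
      e₁ = S Ω (λ ω → S Cells (λ j → row-event j ω))
      e₂ = S Ω (λ ω → S Cells (λ j → col-event j ω))
      e₃ = S Ω (λ ω → S Blocks (λ j → block-event j ω))
      e₄ = S Ω (λ ω → S Sets (λ j → set-event j ω))
      size>0 : 0 < z
      size>0 = subst (0 <_) (sym (size-× X X)) (*-mono-≤ (size-matrix>0 m′ M M) (size-matrix>0 m′ M M))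
      sum-events : S Ω events ≡ e₁ + e₂ + (e₃ + e₄)
      sum-events = trans (S-+ Ω (λ ω → S Cells (λ j → row-event j ω) + S Cells (λ j → col-event j ω)) _)
        (cong₂ _+_ (S-+ Ω (λ ω → S Cells (λ j → row-event j ω)) _) (S-+ Ω (λ ω → S Blocks (λ j → block-event j ω)) _))
      expand : ∀ R a b c d l → 10 * (R * (a + b + (c + d)) + l) ≡ R * (10 * a + 10 * b + (10 * c + 10 * d)) + 10 * l
      expand = solve-∀
      ten : ∀ R z → R * (z + z + (z + z)) + R * z + R * (5 * z) ≡ 10 * (R * z)
      ten = solve-∀

  private
    colouring : ∀ ω → R₀ * events ω + lost π ω < R₀ → Colouring h t b D K R₀ τ π
    colouring ω small = record
      { ω = ω
      ; spread = λ s i → record { row≤ = row s i ; col≤ = col s i ; sparse = block s i }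
      ; hit = λ s i zs ts → none Sets (λ j → set-event j ω) (s , i , zs , ts) sets≡0
      ; lost< = ≤-<-trans (m≤n+m (lost π ω) _) small
      }
      where
      rows cols blocks sets : ℕ
      rows = S Cells (λ j → row-event j ω)
      cols = S Cells (λ j → col-event j ω)
      blocks = S Blocks (λ j → block-event j ω)
      sets = S Sets (λ j → set-event j ω)
      events≡0 : rows + cols + (blocks + sets) ≡ 0
      events≡0 = factor≡0 R₀ (rows + cols + (blocks + sets)) (lost π ω) small
      first≡0 : rows + cols ≡ 0
      first≡0 = m+n≡0⇒m≡0 (rows + cols) events≡0
      second≡0 : blocks + sets ≡ 0
      second≡0 = m+n≡0⇒n≡0 (rows + cols) events≡0
      sets≡0 : sets ≡ 0
      sets≡0 = m+n≡0⇒n≡0 blocks second≡0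
      row : ∀ s i z → ∑ (λ x → ⟦ W (proj s ω) i z x ⟧) ≤ D
      row s i z = begin
        ∑ (λ x → ⟦ W (proj s ω) i z x ⟧)
          ≡⟨ sum-cong-≗ (λ x → +-identityʳ ⟦ W (proj s ω) i z x ⟧) ⟨
        ∑ (λ x → 1 * ⟦ W (proj s ω) i z x ⟧)
          ≡⟨ ∑-δ z (λ z → ∑ (λ x → 1 * ⟦ W (proj s ω) i z x ⟧)) ⟨
        ∑ (λ z′ → ⟦ z == z′ ⟧ * ∑ (λ x → 1 * ⟦ W (proj s ω) i z′ x ⟧))
          ≡⟨ ∑-rectangle-nested (z ==_) all (W (proj s ω) i) ⟨
        count (proj s ω) i (z ==_) all
          ≤⟨ <⇒≤ (⟦≤ᵇ⟧≡0⇒< D (count (proj s ω) i (z ==_) all) (none Cells (λ j → row-event j ω) (s , i , z) (m+n≡0⇒m≡0 rows first≡0))) ⟩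
        D ∎
        where open ≤-Reasoning
      col : ∀ s i x → ∑ (λ z → ⟦ W (proj s ω) i z x ⟧) ≤ D
      col s i x = begin
        ∑ (λ z → ⟦ W (proj s ω) i z x ⟧)
          ≡⟨ sum-cong-≗ (λ z → trans (+-identityʳ _) (∑-δ x (λ x → ⟦ W (proj s ω) i z x ⟧))) ⟨
        ∑ (λ z → 1 * ∑ (λ x′ → ⟦ x == x′ ⟧ * ⟦ W (proj s ω) i z x′ ⟧))
          ≡⟨ ∑-rectangle-nested all (x ==_) (W (proj s ω) i) ⟨
        count (proj s ω) i all (x ==_)
          ≤⟨ <⇒≤ (⟦≤ᵇ⟧≡0⇒< D (count (proj s ω) i all (x ==_)) (none Cells (λ j → col-event j ω) (s , i , x) (m+n≡0⇒n≡0 rows first≡0))) ⟩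
        D ∎
        where open ≤-Reasoning
      block : ∀ s i Z T → # Z ≤ t → # T ≤ t → ∑ (λ z → ⟦ Z z ⟧ * ∑ (λ x → ⟦ T x ⟧ * ⟦ W (proj s ω) i z x ⟧)) ≤ b * t
      block s i Z T #Z≤ #T≤ with enumerate-cover Z t x₀ #Z≤ | enumerate-cover T t x₀ #T≤
      ... | zs , Z⊆zs | ts , T⊆ts = begin
        ∑ (λ z → ⟦ Z z ⟧ * ∑ (λ x → ⟦ T x ⟧ * ⟦ W (proj s ω) i z x ⟧))
          ≤⟨ ∑-mono (λ z → *-mono-≤ (⟦⟧-mono (Z⊆zs z)) (∑-mono (λ x → *-monoˡ-≤ ⟦ W (proj s ω) i z x ⟧ (⟦⟧-mono (T⊆ts x))))) ⟩
        ∑ (λ z → ⟦ mem zs z ⟧ * ∑ (λ x → ⟦ mem ts x ⟧ * ⟦ W (proj s ω) i z x ⟧))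
          ≡⟨ ∑-rectangle-nested (mem zs) (mem ts) (W (proj s ω) i) ⟨
        count (proj s ω) i (mem zs) (mem ts)
          ≤⟨ <⇒≤ (⟦≤ᵇ⟧≡0⇒< (b * t) (count (proj s ω) i (mem zs) (mem ts)) (none Blocks (λ j → block-event j ω) (s , i , zs , ts) (m+n≡0⇒m≡0 blocks second≡0))) ⟩
        b * t ∎
        where open ≤-Reasoning

  exists-colouring : 0 < R₀ → Colouring {m = m} h t b D K R₀ τ π
  exists-colouring 0<R₀ =
    let ω , small = S-find Ω (λ ω → R₀ * events ω + lost π ω) (λ _ → R₀) (combined-rare 0<R₀) in colouring ω small

-- Counting edges

contrapositive : ∀ {a b} → (a ≡ true → b ≡ true) → b ≡ false → a ≡ false
contrapositive {false} f nb = refl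
contrapositive {true} f nb = ⊥-elim (true≢false (f refl) nb)

sum-map-allFin : ∀ {n} (f : Fin n → ℕ) → ListAction.sum (List.map f (List.allFin n)) ≡ ∑ f
sum-map-allFin {n} f = trans (cong ListAction.sum (List.map-tabulate (λ i → i) f)) (sum-tabulate f)
  where
  sum-tabulate : ∀ {n} (f : Fin n → ℕ) → ListAction.sum (List.tabulate f) ≡ ∑ f
  sum-tabulate {zero} f = refl
  sum-tabulate {suc n} f = cong (f zero +_) (sum-tabulate (f ∘ suc))

edges-∑ : ∀ {n} (G : Graph n) → edges G ≡ ∑ (λ u → ∑ (λ v → ⟦ (toℕ u <ᵇ toℕ v) ∧ adj G u v ⟧))
edges-∑ {n} G = trans (sum-map-allFin (λ u → ListAction.sum (List.map (cell u) (List.allFin n))))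
  (sum-cong-≗ (λ u → trans (sum-map-allFin (cell u)) (sum-cong-≗ (λ v → if-⟦⟧ ((toℕ u <ᵇ toℕ v) ∧ adj G u v)))))
  where
  cell : Fin n → Fin n → ℕ
  cell u v = if (toℕ u <ᵇ toℕ v) ∧ adj G u v then 1 else 0
  if-⟦⟧ : ∀ b → (if b then 1 else 0) ≡ ⟦ b ⟧
  if-⟦⟧ true = refl
  if-⟦⟧ false = refl

pairs : ℕ → ℕ
pairs n = ∑ {n} (λ u → ∑ {n} (λ v → ⟦ toℕ u <ᵇ toℕ v ⟧))

pairs-suc : ∀ n → pairs (suc n) ≡ n + pairs n
pairs-suc n = cong₂ _+_ (trans (∑-const n 1) (*-identityʳ n)) refl

C2≡pairs : ∀ n → n C 2 ≡ pairs n
C2≡pairs zero = refl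
C2≡pairs (suc n) = begin
  suc n C 2        ≡⟨ nCk+nC[k+1]≡[n+1]C[k+1] n 1 ⟨
  n C 1 + n C 2    ≡⟨ cong₂ _+_ (nC1≡n n) (C2≡pairs n) ⟩
  n + pairs n      ≡⟨ pairs-suc n ⟨
  pairs (suc n)    ∎
  where open ≡-Reasoning

2*pairs : ∀ n → 2 * pairs n + n ≡ n * n
2*pairs zero = refl
2*pairs (suc n) = begin
  2 * pairs (suc n) + suc n          ≡⟨ cong (λ p → 2 * p + suc n) (pairs-suc n) ⟩
  2 * (n + pairs n) + suc n          ≡⟨ regroup n (pairs n) ⟩
  (2 * pairs n + n) + (n + n + 1)    ≡⟨ cong (_+ (n + n + 1)) (2*pairs n) ⟩
  n * n + (n + n + 1)                ≡⟨ square n ⟩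
  suc n * suc n                      ∎
  where
  open ≡-Reasoning
  regroup : ∀ n p → 2 * (n + p) + suc n ≡ (2 * p + n) + (n + n + 1)
  regroup = solve-∀
  square : ∀ n → n * n + (n + n + 1) ≡ suc n * suc n
  square = solve-∀

module _ {n M m : ℕ} (τ : Fin n → Fin n → Fin 2) (π : Fin 2 → Fin n → Fin M) (ω : Vec (Vec (Fin m) M) M × Vec (Vec (Fin m) M) M) where

  private
    G : Fin m → Graph n
    G = graph τ π (λ s → at (proj s ω))
    W : Fin 2 → Fin m → Fin M → Fin M → Bool
    W s i x y = at (proj s ω) x y == i

  colour-of : Fin 2 → Fin n → Fin n → Fin m
  colour-of s u v = at (proj s ω) (proj₁ (ordered (π s u) (π s v))) (proj₂ (ordered (π s u) (π s v)))

  adj↑-colour-of : ∀ s u v → π s u ≢ π s v → adj↑ (W s (colour-of s u v)) (π s u) (π s v) ≡ true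
  adj↑-colour-of s u v ≢ with <-cmp (toℕ (π s u)) (toℕ (π s v))
  ... | tri≈ _ eq _ = ⊥-elim (≢ (Fin.toℕ-injective eq))
  ... | tri< u<v _ _ = adj↑-intro (W s (colour-of s u v)) (π s u) (π s v) u<v
    (≡⇒== (sym (cong (λ e → at (proj s ω) (proj₁ e) (proj₂ e)) (ordered-< u<v))))
    where
    ordered-< : ∀ {x y : Fin M} → toℕ x < toℕ y → ordered x y ≡ (x , y)
    ordered-< x<y rewrite <ᵇ-true x<y = refl
  ... | tri> _ _ v<u = trans (adj↑-sym (W s (colour-of s u v)) (π s u) (π s v)) (adj↑-intro (W s (colour-of s u v)) (π s v) (π s u) v<u
    (≡⇒== (sym (cong (λ e → at (proj s ω) (proj₁ e) (proj₂ e)) (ordered-> (π s u) (π s v) v<u)))))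
    where
    ordered-> : ∀ (x y : Fin M) → toℕ y < toℕ x → ordered x y ≡ (y , x)
    ordered-> x y y<x with toℕ x <ᵇ toℕ y in e
    ... | true = ⊥-elim (<-asym y<x (true-<ᵇ (toℕ x) (toℕ y) e))
    ... | false = refl

  kept-or-lost : ∀ s i u v → on-side τ π (λ s → at (proj s ω)) s u v ≡ true → adj↑ (W s i) (π s u) (π s v) ≡ true →
    1 ≤ ⟦ adj (G i) u v ⟧ + lost-term π ω u v s i
  kept-or-lost s i u v d a with closed (W s i) (π s u) (π s v) in c
  ... | true rewrite a = ≤-trans (s≤s z≤n) (m≤n+m _ ⟦ adj (G i) u v ⟧)
  ... | false with closed (W (opposite s) i) (π (opposite s) u) (π (opposite s) v) in c′
  ...   | true rewrite a = m≤n+m 1 _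
  ...   | false rewrite half⇒Adj τ π (λ s → at (proj s ω)) s i u v
            (∧-intro (∧-intro d (cong not c′)) (∧-intro a (cong not (contrapositive (below⇒closed (W s i) (π s u) (π s v)) c)))) = s≤s z≤n

  -- A pair that is absent from the graph of its own colour is identified by a projection or has
  -- been discarded, and each reason is paid for by a term on the right.
  pair-cost : ∀ u v → ⟦ toℕ u <ᵇ toℕ v ⟧ ≤
    ∑ (λ i → ⟦ (toℕ u <ᵇ toℕ v) ∧ adj (G i) u v ⟧)
    + (⟦ π zero v == π zero u ⟧ + ⟦ π (suc zero) v == π (suc zero) u ⟧
    + ⟦ apart {m = m} π u v ⟧ * ∑ (λ s → ∑ (λ i → lost-term π ω u v s i)))
  pair-cost u v = cases (toℕ u <ᵇ toℕ v) (π zero v == π zero u) (π (suc zero) v == π (suc zero) u) main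
    where
    L : ℕ
    L = ∑ (λ s → ∑ (λ i → lost-term π ω u v s i))
    cases : ∀ a e₀ e₁ → (a ≡ true → e₀ ≡ false → e₁ ≡ false → 1 ≤ ∑ (λ i → ⟦ adj (G i) u v ⟧) + L) →
      ⟦ a ⟧ ≤ ∑ (λ i → ⟦ a ∧ adj (G i) u v ⟧) + (⟦ e₀ ⟧ + ⟦ e₁ ⟧ + ⟦ not e₀ ∧ not e₁ ⟧ * L)
    cases false _ _ _ = z≤n
    cases true true _ _ = ≤-trans (s≤s z≤n) (m≤n+m _ (∑ (λ i → ⟦ adj (G i) u v ⟧)))
    cases true false true _ = ≤-trans (s≤s z≤n) (m≤n+m _ (∑ (λ i → ⟦ adj (G i) u v ⟧)))
    cases true false false le = ≤-trans (le refl refl refl) (≤-reflexive (cong (∑ (λ i → ⟦ adj (G i) u v ⟧) +_) (sym (+-identityʳ L))))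
    main : (toℕ u <ᵇ toℕ v) ≡ true → (π zero v == π zero u) ≡ false → (π (suc zero) v == π (suc zero) u) ≡ false →
      1 ≤ ∑ (λ i → ⟦ adj (G i) u v ⟧) + L
    main u<v e₀ e₁ = ≤-trans (kept-or-lost s i u v on (adj↑-colour-of s u v (separate s)))
      (+-mono-≤ (term≤∑ (λ i → ⟦ adj (G i) u v ⟧) i)
        (≤-trans (term≤∑ (λ i → lost-term π ω u v s i) i) (term≤∑ (λ s → ∑ (λ i → lost-term π ω u v s i)) s)))
      where
      s = τ u v
      i = colour-of s u v
      on : on-side τ π (λ s → at (proj s ω)) s u v ≡ true
      on = adj↑-intro (λ u v → τ u v == s) u v (true-<ᵇ (toℕ u) (toℕ v) u<v) (≡⇒== {x = s} refl)
      separate : ∀ s → π s u ≢ π s v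
      separate zero eq = true≢false (≡⇒== (sym eq)) e₀
      separate (suc zero) eq = true≢false (≡⇒== (sym eq)) e₁

  sumEdges-bound : ∀ f → (∀ s x → # (λ u → π s u == x) ≤ f) → pairs n ≤ sumEdges G + (n * f + n * f + lost π ω)
  sumEdges-bound f fibre≤ = begin
    pairs n
      ≤⟨ ∑-mono (λ u → ∑-mono (pair-cost u)) ⟩
    ∑∑ (λ u v → E u v + (F zero u v + F (suc zero) u v + L u v))
      ≡⟨ trans (∑∑-+ E _) (cong (∑∑ E +_) (trans (∑∑-+ (λ u v → F zero u v + F (suc zero) u v) L) (cong (_+ ∑∑ L) (∑∑-+ (F zero) (F (suc zero)))))) ⟩
    ∑∑ E + (∑∑ (F zero) + ∑∑ (F (suc zero)) + ∑∑ L)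
      ≤⟨ +-mono-≤ (≤-reflexive total) (+-monoˡ-≤ (∑∑ L) (+-mono-≤ (fibres zero) (fibres (suc zero)))) ⟩
    sumEdges G + (n * f + n * f + lost π ω) ∎
    where
    open ≤-Reasoning
    ∑∑ : (Fin n → Fin n → ℕ) → ℕ
    ∑∑ g = ∑ (λ u → ∑ (g u))
    ∑∑-+ : ∀ g k → ∑∑ (λ u v → g u v + k u v) ≡ ∑∑ g + ∑∑ k
    ∑∑-+ g k = trans (sum-cong-≗ (λ u → ∑-distrib-+ (g u) (k u))) (∑-distrib-+ (λ u → ∑ (g u)) _)
    E L : Fin n → Fin n → ℕ
    E u v = ∑ (λ i → ⟦ (toℕ u <ᵇ toℕ v) ∧ adj (G i) u v ⟧)
    L u v = ⟦ apart {m = m} π u v ⟧ * ∑ (λ s → ∑ (λ i → lost-term π ω u v s i))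
    F : Fin 2 → Fin n → Fin n → ℕ
    F s u v = ⟦ π s v == π s u ⟧
    fibres : ∀ s → ∑∑ (F s) ≤ n * f
    fibres s = ≤-trans (∑-mono (λ u → fibre≤ s (π s u))) (≤-reflexive (∑-const n f))
    total : ∑∑ E ≡ sumEdges G
    total = begin-equality
      ∑ (λ u → ∑ (λ v → ∑ (λ i → ⟦ (toℕ u <ᵇ toℕ v) ∧ adj (G i) u v ⟧)))
        ≡⟨ sum-cong-≗ (λ u → ∑-comm (λ v i → ⟦ (toℕ u <ᵇ toℕ v) ∧ adj (G i) u v ⟧)) ⟩
      ∑ (λ u → ∑ (λ i → ∑ (λ v → ⟦ (toℕ u <ᵇ toℕ v) ∧ adj (G i) u v ⟧)))
        ≡⟨ ∑-comm (λ u i → ∑ (λ v → ⟦ (toℕ u <ᵇ toℕ v) ∧ adj (G i) u v ⟧)) ⟩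
      ∑ (λ i → ∑ (λ u → ∑ (λ v → ⟦ (toℕ u <ᵇ toℕ v) ∧ adj (G i) u v ⟧)))
        ≡⟨ trans (sum-map-allFin (λ i → edges (G i))) (sum-cong-≗ (λ i → edges-∑ (G i))) ⟨
      sumEdges G ∎

-- Independent sets

choose : ∀ {n} → (Fin n → Bool) → Fin n → Fin n
choose {n} P d = pick (ex P) refl
  module Choose where
  pick : ∀ b → ex P ≡ b → Fin n
  pick true eq = proj₁ (ex-elim P eq)
  pick false _ = d

choose-satisfies : ∀ {n} (P : Fin n → Bool) d → ex P ≡ true → P (choose P d) ≡ true
choose-satisfies P d p = go (ex P) refl p
  where
  go : ∀ b eq → b ≡ true → P (Choose.pick P d b eq) ≡ true
  go true eq _ = proj₂ (ex-elim P eq)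

-- In `transversal` the default is the vertex itself; this independence makes the representative a
-- function of the class alone.
choose-default : ∀ {n} (P : Fin n → Bool) d d′ → ex P ≡ true → choose P d ≡ choose P d′
choose-default P d d′ p = go (ex P) refl p
  where
  go : ∀ b eq → b ≡ true → Choose.pick P d b eq ≡ Choose.pick P d′ b eq
  go true eq _ = refl

module _ {n M : ℕ} (I : Fin n → Bool) (π : Fin n → Fin M) where

  image : Fin M → Bool
  image x = ex (λ u → I u ∧ (π u == x))

  transversal : Fin n → Bool
  transversal u = I u ∧ (choose (λ v → I v ∧ (π v == π u)) u == u)

  private
    over : Fin M → Fin n → Bool
    over x v = I v ∧ (π v == x)

  transversal⊆ : ∀ u → transversal u ≡ true → I u ≡ true
  transversal⊆ u p = proj₁ (∧-split {I u} p)

  transversal-inj : ∀ u v → transversal u ≡ true → transversal v ≡ true → π u ≡ π v → u ≡ v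
  transversal-inj u v p q πu≡πv = trans (sym (chosen u p)) (trans
    (choose-default (over (π u)) u v (ex-intro (over (π u)) u (∧-intro (transversal⊆ u p) (≡⇒== {x = π u} refl))))
    (trans (cong (λ x → choose (over x) v) πu≡πv) (chosen v q)))
    where
    chosen : ∀ w → transversal w ≡ true → choose (over (π w)) w ≡ w
    chosen w r = ==⇒≡ _ w (proj₂ (∧-split {I w} r))

  #image≤#transversal : # image ≤ # transversal
  #image≤#transversal = begin
    # image                                              ≤⟨ ∑-mono represented ⟩
    ∑ (λ x → ∑ (λ u → ⟦ transversal u ⟧ * ⟦ π u == x ⟧))  ≡⟨ sum-cong-≗ (λ x → *-identityʳ (∑ (λ u → ⟦ transversal u ⟧ * ⟦ π u == x ⟧))) ⟨
    ∑ (λ x → ∑ (λ u → ⟦ transversal u ⟧ * ⟦ π u == x ⟧) * 1)  ≡⟨ ∑-fibres π (λ u → ⟦ transversal u ⟧) (λ _ → 1) ⟨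
    ∑ (λ u → ⟦ transversal u ⟧ * 1)                      ≡⟨ sum-cong-≗ (λ u → *-identityʳ ⟦ transversal u ⟧) ⟩
    # transversal                                        ∎
    where
    open ≤-Reasoning
    represented : ∀ x → ⟦ image x ⟧ ≤ ∑ (λ u → ⟦ transversal u ⟧ * ⟦ π u == x ⟧)
    represented x = bool≤ (image x) (λ ix → member (ex-elim (over x) ix) ix)
      where
      bool≤ : ∀ b {k} → (b ≡ true → 1 ≤ k) → ⟦ b ⟧ ≤ k
      bool≤ true le = le refl
      bool≤ false le = z≤n
      member : ∃[ d ] over x d ≡ true → image x ≡ true → 1 ≤ ∑ (λ u → ⟦ transversal u ⟧ * ⟦ π u == x ⟧)
      member (d , _) ix = ≤-trans (≤-reflexive (sym (trans (sym (⟦∧⟧ (transversal u) (π u == x))) (cong ⟦_⟧ (∧-intro tr πu≡x)))))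
        (term≤∑ (λ u → ⟦ transversal u ⟧ * ⟦ π u == x ⟧) u)
        where
        u = choose (over x) d
        uover : over x u ≡ true
        uover = choose-satisfies (over x) d ix
        Iu = proj₁ (∧-split {I u} uover)
        πu≡x : (π u == x) ≡ true
        πu≡x = proj₂ (∧-split {I u} uover)
        tr : transversal u ≡ true
        tr = ∧-intro Iu (≡⇒== (trans (cong (λ y → choose (over y) u) (==⇒≡ (π u) x πu≡x)) (choose-default (over x) u d ix)))

∣∣≡# : ∀ {n} (S : Subset n) → ∣ S ∣ ≡ # (lookup S)
∣∣≡# [] = refl
∣∣≡# (true ∷ S) = cong suc (∣∣≡# S)
∣∣≡# (false ∷ S) = ∣∣≡# S

module _ {n M m : ℕ} (h t b D K R₀ f k E : ℕ) (x₀ : Fin M) (0<t : 0 < t) (τ : Fin n → Fin n → Fin 2) (π : Fin 2 → Fin n → Fin M)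
  (fibre≤ : ∀ s x → # (λ u → π s u == x) ≤ f)
  (boxes : ∀ (zs ts : Vec (Fin M) (h + h)) → # {n} (λ u → mem zs (π zero u) ∧ mem ts (π (suc zero) u)) < k)
  (sides : ∀ s (Z T : Fin n → Bool) → # Z ≡ h → # T ≡ h → h * h ≤ E + ∑ (λ u → ⟦ Z u ⟧ * ∑ (λ v → ⟦ T v ⟧ * ⟦ τ u v == s ⟧)))
  (col : Colouring {m = m} h t b D K R₀ τ π)
  (h≤ft : h + h ≤ f * t) (room : K + E + 32 * (b * f * (f * t) * D) ≤ h * h) where

  open Colouring col

  private
    G : Fin m → Graph n
    G = graph τ π (λ s → at (proj s ω))

    -- Otherwise `I` lies in the box spanned by its two images, and a box has fewer than `k`
    -- vertices.
    large-image : ∀ (I : Fin n → Bool) → k ≤ # I → ∃[ s ] h + h < # (image I (π s))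
    large-image I k≤ with # (image I (π zero)) ≤? h + h | # (image I (π (suc zero))) ≤? h + h
    ... | no ≰ | _ = zero , ≰⇒> ≰
    ... | yes _ | no ≰ = suc zero , ≰⇒> ≰
    ... | yes p | yes q with enumerate-cover (image I (π zero)) (h + h) x₀ p | enumerate-cover (image I (π (suc zero))) (h + h) x₀ q
    ...   | zs , ⊆zs | ts , ⊆ts = ⊥-elim (<⇒≱ (boxes zs ts) (≤-trans k≤ (#-mono (λ u Iu →
            ∧-intro (⊆zs _ (in-image zero u Iu)) (⊆ts _ (in-image (suc zero) u Iu))))))
      where
      in-image : ∀ s u → I u ≡ true → image I (π s) (π s u) ≡ true
      in-image s u Iu = ex-intro (λ v → I v ∧ (π s v == π s u)) u (∧-intro Iu (≡⇒== {x = π s u} refl))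

    -- Two parts of a transversal, one wholly before the other: every pair between them is then
    -- oriented as `τ u v`, which is the entry that `sides` counts.
    record Blocks (s : Fin 2) (I : Fin n → Bool) : Set where
      field
        J : Fin n → Bool
        inj : ∀ u v → J u ≡ true → J v ≡ true → π s u ≡ π s v → u ≡ v
        zs ts : Vec (Fin n) h
        zs⊆J : ∀ u → mem zs u ≡ true → J u ≡ true
        ts⊆J : ∀ u → mem ts u ≡ true → J u ≡ true
        J⊆I : ∀ u → J u ≡ true → I u ≡ true
        #zs : # (mem zs) ≡ h
        #ts : # (mem ts) ≡ h
        zs<ts : ∀ u v → mem zs u ≡ true → mem ts v ≡ true → toℕ u < toℕ v

    blocks : ∀ s (I : Fin n → Bool) → h + h < # (image I (π s)) → Blocks s I
    blocks s I large with take-first (transversal I (π s)) h (≤-trans (m≤m+n h h) (≤-trans (<⇒≤ large) (#image≤#transversal I (π s))))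
    ... | Z , Z⊆J , #Z , Z< with take-first (transversal I (π s) ∖ Z) h (+-cancelˡ-≤ h h _
             (≤-trans (<⇒≤ large) (≤-trans (#image≤#transversal I (π s))
               (≤-reflexive (trans (#-split (transversal I (π s)) Z Z⊆J) (cong (_+ # (transversal I (π s) ∖ Z)) #Z))))))
    ...   | T , T⊆ , #T , _ with enumerate-exact Z h #Z | enumerate-exact T h #T
    ...     | zs , zs≗Z | ts , ts≗T = record
      { J = transversal I (π s)
      ; inj = transversal-inj I (π s)
      ; zs = zs
      ; ts = ts
      ; zs⊆J = λ u zu → Z⊆J u (trans (sym (zs≗Z u)) zu)
      ; ts⊆J = λ u tu → proj₁ (∧-split {transversal I (π s) u} (T⊆ u (trans (sym (ts≗T u)) tu)))
      ; J⊆I = transversal⊆ I (π s)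
      ; #zs = trans (sum-cong-≗ (λ u → cong ⟦_⟧ (zs≗Z u))) #Z
      ; #ts = trans (sum-cong-≗ (λ u → cong ⟦_⟧ (ts≗T u))) #T
      ; zs<ts = λ u v zu tv → let Jv , ¬Zv = ∧-split {transversal I (π s) v} (T⊆ v (trans (sym (ts≗T v)) tv)) in
          Z< u v (trans (sym (zs≗Z u)) zu) Jv (not-true ¬Zv)
      }

    -- The union of zs and ts has at most f t elements, so few of its pairs are closed.
    enough-open : ∀ s i I (bl : Blocks s I) →
      K ≤ open-pairs (allowed τ π s i (proj (opposite s) ω) (mem (Blocks.zs bl)) (mem (Blocks.ts bl))) i (proj s ω)
    enough-open s i I bl = +-cancelʳ-≤ (E + 32 * B) _ _ (begin
      K + (E + 32 * B)                     ≡⟨ +-assoc K E _ ⟨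
      K + E + 32 * B                       ≤⟨ room ⟩
      h * h                                ≤⟨ sides s (mem zs) (mem ts) #zs #ts ⟩
      E + ∑∑ (λ u v → ⟦ τ u v == s ⟧)
        ≤⟨ +-monoʳ-≤ E (∑-mono (λ u → ⟦⟧*-mono (mem zs u) (λ zu → ∑-mono (λ v → ⟦⟧*-mono (mem ts v) (λ tv → ⟦⟧-mono {τ u v == s} (adj↑-intro (λ u v → τ u v == s) u v (zs<ts u v zu tv))))))) ⟩
      E + ∑∑ (λ u v → ⟦ on-side τ π (λ _ → at (proj (opposite s) ω)) s u v ⟧)
        ≤⟨ +-monoʳ-≤ E (many-open-pairs τ π (λ s → proj s ω) s i (mem zs) (mem ts) J inj zs⊆J ts⊆J (λ u zu tu → <-irrefl refl (zs<ts u u zu tu))) ⟩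
      E + (O + (∑∑ (closed-at (opposite s)) + ∑∑ (closed-at s)))
        ≤⟨ +-monoʳ-≤ E (+-monoʳ-≤ O (+-mono-≤ (few-closed (opposite s)) (few-closed s))) ⟩
      E + (O + (16 * B + 16 * B))          ≡⟨ regroup E O B ⟩
      O + (E + 32 * B)                     ∎)
      where
      open ≤-Reasoning
      open Blocks bl
      B = b * f * (f * t) * D
      O = open-pairs (allowed τ π s i (proj (opposite s) ω) (mem zs) (mem ts)) i (proj s ω)
      ∑∑ : (Fin n → Fin n → ℕ) → ℕ
      ∑∑ g = ∑ (λ u → ⟦ mem zs u ⟧ * ∑ (λ v → ⟦ mem ts v ⟧ * g u v))
      regroup : ∀ E O B → E + (O + (16 * B + 16 * B)) ≡ O + (E + 32 * B)
      regroup = solve-∀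
      closed-at : Fin 2 → Fin n → Fin n → ℕ
      closed-at r u v = ⟦ closed (λ x y → at (proj r ω) x y == i) (π r u) (π r v) ⟧
      ZT : Fin n → Bool
      ZT u = mem zs u ∨ mem ts u
      #ZT : # ZT ≤ f * t
      #ZT = ≤-trans (∑-mono (λ u → ⟦∨⟧ (mem zs u) (mem ts u)))
        (≤-trans (≤-reflexive (trans (∑-distrib-+ (λ u → ⟦ mem zs u ⟧) _) (cong₂ _+_ #zs #ts))) h≤ft)
      few-closed : ∀ r → ∑∑ (closed-at r) ≤ 16 * B
      few-closed r = ≤-trans
        (∑-mono (λ u → *-mono-≤ (⟦⟧-mono {mem zs u} (λ zu → cong (_∨ mem ts u) zu))
          (∑-mono (λ v → *-monoˡ-≤ (closed-at r u v) (⟦⟧-mono {mem ts v} (∨-introʳ (mem zs v)))))))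
        (closed-pairs (spread r i) 0<t (π r) f (fibre≤ r) ZT #ZT)

  independent-small : ∀ i S → Independent (G i) S → ∣ S ∣ < k
  independent-small i S indep with ∣ S ∣ <? k
  ... | yes lt = lt
  ... | no ≮k with large-image (lookup S) (≤-trans (≮⇒≥ ≮k) (≤-reflexive (∣∣≡# S)))
  ...   | s , large = ⊥-elim (contradictory (blocks s (lookup S) large))
    where
    contradictory : Blocks s (lookup S) → ⊥
    -- With `K` open pairs and no hit, the product in `hit` is `1 * 0 ^ 0`, that is 1.
    contradictory bl = absurd (trans (sym (cong₂ (λ x y → ⟦ x ⟧ * 0 ^ y) (≤ᵇ-true (enough-open s i (lookup S) bl))
      (independent⇒no-hits τ π (λ s → proj s ω) s i (mem zs) (mem ts) separated))) (hit s i zs ts))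
      where
      open Blocks bl
      absurd : 1 ≡ 0 → ⊥
      absurd ()
      separated : ∀ u v → mem zs u ≡ true → mem ts v ≡ true → ¬ Adj (G i) u v
      separated u v zu tv = indep u v (lookup⇒[]= u S (J⊆I u (zs⊆J u zu))) (lookup⇒[]= v S (J⊆I v (ts⊆J v tv)))

-- Growth of powers

bernoulli-below : ∀ a n → a ^ n * (a + n) ≤ suc a ^ n * a
bernoulli-below a zero = ≤-reflexive (cong (1 *_) (+-identityʳ a))
bernoulli-below a (suc n) = begin
  a * a ^ n * (a + suc n)             ≡⟨ regroup a (a ^ n) n ⟩
  a ^ n * (a * (a + suc n))           ≤⟨ *-monoʳ-≤ (a ^ n) (≤-trans (m≤m+n _ n) (≤-reflexive (factor a n))) ⟩
  a ^ n * (suc a * (a + n))           ≡⟨ exchange (a ^ n) (suc a) (a + n) ⟩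
  suc a * (a ^ n * (a + n))           ≤⟨ *-monoʳ-≤ (suc a) (bernoulli-below a n) ⟩
  suc a * (suc a ^ n * a)             ≡⟨ *-assoc (suc a) (suc a ^ n) a ⟨
  suc a * suc a ^ n * a               ∎
  where
  open ≤-Reasoning
  regroup : ∀ a p n → a * p * (a + suc n) ≡ p * (a * (a + suc n))
  regroup = solve-∀
  factor : ∀ a n → a * (a + suc n) + n ≡ suc a * (a + n)
  factor = solve-∀
  exchange : ∀ p x y → p * (x * y) ≡ x * (p * y)
  exchange = solve-∀

-- Bernoulli with exponent 1 + a. For m = 1 + a it reads (1 - 1/m)^m ≤ 1/2, so every m cells that
-- miss a colour gain a factor 2.
2*a^[1+a]≤[1+a]^[1+a] : ∀ a → 2 * a ^ suc a ≤ suc a ^ suc a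
2*a^[1+a]≤[1+a]^[1+a] zero = z≤n
2*a^[1+a]≤[1+a]^[1+a] a@(suc _) = *-cancelʳ-≤ _ _ a (begin
  2 * a ^ suc a * a               ≡⟨ regroup (a ^ suc a) a ⟩
  a ^ suc a * (a + a)             ≤⟨ *-monoʳ-≤ (a ^ suc a) (+-monoʳ-≤ a (n≤1+n a)) ⟩
  a ^ suc a * (a + suc a)         ≤⟨ bernoulli-below a (suc a) ⟩
  suc a ^ suc a * a               ∎)
  where
  open ≤-Reasoning
  regroup : ∀ p a → 2 * p * a ≡ p * (a + a)
  regroup = solve-∀

bernoulli-above : ∀ a h → suc a ^ h * (suc a ∸ h) ≤ a ^ h * suc a
bernoulli-above a zero = ≤-refl
bernoulli-above a (suc h) with suc a ∸ h in eq
... | zero = ≤-trans (≤-reflexive (trans (cong (suc a ^ suc h *_) (trans (sym (pred[m∸n]≡m∸[1+n] (suc a) h)) (cong pred eq))) (*-zeroʳ (suc a ^ suc h)))) z≤n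
... | suc r = begin
  suc a * suc a ^ h * (a ∸ h)         ≡⟨ cong (suc a * suc a ^ h *_) (trans (sym (pred[m∸n]≡m∸[1+n] (suc a) h)) (cong pred eq)) ⟩
  suc a * suc a ^ h * r               ≡⟨ regroup (suc a) (suc a ^ h) r ⟩
  suc a ^ h * (suc a * r)             ≤⟨ *-monoʳ-≤ (suc a ^ h) (≤-trans (+-monoˡ-≤ (a * r) r≤a) (≤-reflexive (sym (*-suc a r)))) ⟩
  suc a ^ h * (a * suc r)             ≡⟨ exchange (suc a ^ h) a (suc r) ⟩
  a * (suc a ^ h * suc r)             ≡⟨ cong (λ s → a * (suc a ^ h * s)) eq ⟨
  a * (suc a ^ h * (suc a ∸ h))       ≤⟨ *-monoʳ-≤ a (bernoulli-above a h) ⟩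
  a * (a ^ h * suc a)                 ≡⟨ *-assoc a (a ^ h) (suc a) ⟨
  a * a ^ h * suc a                   ∎
  where
  open ≤-Reasoning
  r≤a : r ≤ a
  r≤a = s≤s⁻¹ (subst (_≤ suc a) eq (m∸n≤m (suc a) h))
  regroup : ∀ x p r → x * p * r ≡ p * (x * r)
  regroup = solve-∀
  exchange : ∀ p x y → p * (x * y) ≡ x * (p * y)
  exchange = solve-∀

-- Follows from (1 + 1/a)ʰ ≤ 2 for h = ⌊(a + 1)/2⌋.
[1+a]^a≤4*a^a : ∀ a → 0 < a → suc a ^ a ≤ 4 * a ^ a
[1+a]^a≤4*a^a a@(suc _) _ = *-cancelʳ-≤ _ _ (a ^ d) {{m^n≢0 a d}} (begin
  suc a ^ a * a ^ d               ≤⟨ *-monoʳ-≤ (suc a ^ a) (^-monoˡ-≤ d (n≤1+n a)) ⟩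
  suc a ^ a * suc a ^ d           ≡⟨ trans (sym (^-distribˡ-+-* (suc a) a d)) (cong (suc a ^_) (trans (m+[n∸m]≡n a≤h+h) refl)) ⟩
  suc a ^ (h + h)                 ≡⟨ ^-distribˡ-+-* (suc a) h h ⟩
  suc a ^ h * suc a ^ h           ≤⟨ *-mono-≤ upto2 upto2 ⟩
  2 * a ^ h * (2 * a ^ h)         ≡⟨ square (a ^ h) ⟩
  4 * (a ^ h * a ^ h)             ≡⟨ cong (4 *_) (trans (sym (^-distribˡ-+-* a h h)) (trans (cong (a ^_) (sym (m+[n∸m]≡n a≤h+h))) (^-distribˡ-+-* a a d))) ⟩
  4 * (a ^ a * a ^ d)             ≡⟨ *-assoc 4 (a ^ a) (a ^ d) ⟨
  4 * a ^ a * a ^ d               ∎)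
  where
  open ≤-Reasoning
  h d : ℕ
  h = ⌊ suc a /2⌋
  d = h + h ∸ a
  square : ∀ p → 2 * p * (2 * p) ≡ 4 * (p * p)
  square = solve-∀
  a≤h+h : a ≤ h + h
  a≤h+h = s≤s⁻¹ (≤-trans (≤-reflexive (sym (⌊n/2⌋+⌈n/2⌉≡n (suc a)))) (≤-trans (+-monoʳ-≤ h (⌈n/2⌉≤1+⌊n/2⌋ (suc a))) (≤-reflexive (+-suc h h))))
    where
    ⌈n/2⌉≤1+⌊n/2⌋ : ∀ n → ⌈ n /2⌉ ≤ suc ⌊ n /2⌋
    ⌈n/2⌉≤1+⌊n/2⌋ zero = z≤n
    ⌈n/2⌉≤1+⌊n/2⌋ (suc zero) = ≤-refl
    ⌈n/2⌉≤1+⌊n/2⌋ (suc (suc n)) = s≤s (⌈n/2⌉≤1+⌊n/2⌋ n)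
  rest≥ : suc a ≤ 2 * (suc a ∸ h)
  rest≥ = ≤-trans (≤-reflexive (sym (⌊n/2⌋+⌈n/2⌉≡n (suc a)))) (≤-trans (+-monoˡ-≤ ⌈ suc a /2⌉ (⌊n/2⌋≤⌈n/2⌉ (suc a)))
    (≤-trans (≤-reflexive (cong (⌈ suc a /2⌉ +_) (sym (+-identityʳ ⌈ suc a /2⌉)))) (*-monoʳ-≤ 2 (≤-reflexive ceil))))
    where
    ceil : ⌈ suc a /2⌉ ≡ suc a ∸ h
    ceil = sym (trans (cong (_∸ h) (sym (⌊n/2⌋+⌈n/2⌉≡n (suc a)))) (m+n∸m≡n h ⌈ suc a /2⌉))
  upto2 : suc a ^ h ≤ 2 * a ^ h
  upto2 = *-cancelʳ-≤ _ _ (suc a) (begin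
    suc a ^ h * suc a                  ≤⟨ *-monoʳ-≤ (suc a ^ h) rest≥ ⟩
    suc a ^ h * (2 * (suc a ∸ h))      ≡⟨ exchange (suc a ^ h) (suc a ∸ h) ⟩
    2 * (suc a ^ h * (suc a ∸ h))      ≤⟨ *-monoʳ-≤ 2 (bernoulli-above a h) ⟩
    2 * (a ^ h * suc a)                ≡⟨ *-assoc 2 (a ^ h) (suc a) ⟨
    2 * a ^ h * suc a                  ∎)
    where
    exchange : ∀ p x → p * (2 * x) ≡ 2 * (p * x)
    exchange = solve-∀

^-distribʳ-* : ∀ a b n → (a * b) ^ n ≡ a ^ n * b ^ n
^-distribʳ-* a b zero = refl
^-distribʳ-* a b (suc n) = trans (cong (a * b *_) (^-distribʳ-* a b n)) (interchange a b (a ^ n) (b ^ n))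

-- The substitute for 1 + x ≤ exp x: B/A is at most 1/G, and (1 + 1/G)^G ≤ 4 is applied `k` times.
growth : ∀ A B G n k → 0 < G → B * G ≤ A → n ≤ k * G → (A + B) ^ n ≤ 4 ^ k * A ^ n
growth A B G@(suc _) n k 0<G BG≤A n≤kG = *-cancelʳ-≤ _ _ (G ^ n) {{m^n≢0 G n}} (begin
  (A + B) ^ n * G ^ n              ≡⟨ ^-distribʳ-* (A + B) G n ⟨
  ((A + B) * G) ^ n                ≤⟨ ^-monoˡ-≤ n (≤-trans (≤-reflexive (*-distribʳ-+ G A B)) (≤-trans (+-monoʳ-≤ (A * G) BG≤A) (≤-reflexive (trans (+-comm (A * G) A) (sym (*-suc A G)))))) ⟩
  (A * suc G) ^ n                  ≡⟨ ^-distribʳ-* A (suc G) n ⟩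
  A ^ n * suc G ^ n                ≤⟨ *-monoʳ-≤ (A ^ n) unit ⟩
  A ^ n * (4 ^ k * G ^ n)          ≡⟨ regroup (A ^ n) (4 ^ k) (G ^ n) ⟩
  4 ^ k * A ^ n * G ^ n            ∎)
  where
  open ≤-Reasoning
  regroup : ∀ a b c → a * (b * c) ≡ b * a * c
  regroup = solve-∀
  d = k * G ∸ n
  n+d : n + d ≡ k * G
  n+d = m+[n∸m]≡n n≤kG
  unit : suc G ^ n ≤ 4 ^ k * G ^ n
  unit = *-cancelʳ-≤ _ _ (G ^ d) {{m^n≢0 G d}} (begin
    suc G ^ n * G ^ d               ≤⟨ *-monoʳ-≤ (suc G ^ n) (^-monoˡ-≤ d (n≤1+n G)) ⟩
    suc G ^ n * suc G ^ d           ≡⟨ trans (sym (^-distribˡ-+-* (suc G) n d)) (trans (cong (suc G ^_) (trans n+d (*-comm k G))) (sym (^-*-assoc (suc G) G k))) ⟩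
    (suc G ^ G) ^ k                 ≤⟨ ^-monoˡ-≤ k ([1+a]^a≤4*a^a G 0<G) ⟩
    (4 * G ^ G) ^ k                 ≡⟨ ^-distribʳ-* 4 (G ^ G) k ⟩
    4 ^ k * (G ^ G) ^ k             ≡⟨ cong (4 ^ k *_) (trans (^-*-assoc G G k) (trans (cong (G ^_) (trans (*-comm G k) (sym n+d))) (^-distribˡ-+-* G n d))) ⟩
    4 ^ k * (G ^ n * G ^ d)         ≡⟨ *-assoc (4 ^ k) (G ^ n) (G ^ d) ⟨
    4 ^ k * G ^ n * G ^ d           ∎)

-- The packing under numerical hypotheses

record Packing (n m k ℓ : ℕ) : Set where
  field
    G : Fin m → Graph n
    disjoint : PairwiseEdgeDisjoint G
    triangle-free : ∀ i → TriangleFree (G i)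
    independent< : ∀ i S → Independent (G i) S → ∣ S ∣ < k
    covered : pairs n ≤ sumEdges G + ℓ

-- `β` and `c` are the Chernoff parameters for boxes and for dense blocks. Projections and sides are
-- fixed before the colours, because the events on colourings refer to them.
packing : ∀ (n M m′ h t b D c K R₀ f k E β : ℕ) → 0 < M → 0 < t → 0 < c → 0 < β → 0 < R₀ →
  4 * (2 * M * suc M ^ n) ≤ 2 ^ f * M ^ n →
  4 * (M ^ (h + h) * M ^ (h + h) * (M * M + β * ((h + h) * (h + h))) ^ n) ≤ β ^ k * (M * M) ^ n →
  2 * (2 * (n ^ h * n ^ h) * 3 ^ (h * h)) ≤ 2 ^ E * 2 ^ (h * h) →
  10 * (2 * (suc m′ * M) * (m′ + 2) ^ M) ≤ 2 ^ D * suc m′ ^ M →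
  10 * (2 * (suc m′ * (M ^ t * M ^ t)) * (m′ + c) ^ (t * t)) ≤ c ^ (b * t) * suc m′ ^ (t * t) →
  10 * (2 * (suc m′ * (n ^ h * n ^ h)) * m′ ^ K) ≤ suc m′ ^ K →
  10 * (n * (n * (2 * (suc m′ * (M + M))))) ≤ R₀ * suc m′ ^ 3 →
  h + h ≤ f * t → K + E + 32 * (b * f * (f * t) * D) ≤ h * h →
  Packing n (suc m′) k (n * f + n * f + R₀)
packing n M@(suc _) m′ h t b D c K R₀ f k E β 0<M 0<t 0<c 0<β 0<R₀ fibres-rare boxes-rare sides-rare degrees-rare dense-rare missing-rare few-lost h≤ft room =
  let π , fibre≤ , boxes = exists-projections n M f (h + h) k β 0<M 0<β fibres-rare boxes-rare
      τ , sides = exists-sides n h E sides-rare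
      col = exists-colouring n M m′ h t b D c K R₀ 0<c zero τ π degrees-rare dense-rare missing-rare few-lost 0<R₀
      ω = Colouring.ω col
  in record
    { G = graph τ π (λ s → at (proj s ω))
    ; disjoint = graph-disjoint τ π (λ s → at (proj s ω))
    ; triangle-free = graph-triangle-free τ π (λ s → at (proj s ω))
    ; independent< = independent-small h t b D K R₀ f k E zero 0<t τ π fibre≤ boxes sides col h≤ft room
    ; covered = ≤-trans (sumEdges-bound τ π ω f fibre≤)
        (+-monoʳ-≤ (sumEdges (graph τ π (λ s → at (proj s ω)))) (+-monoʳ-≤ (n * f + n * f) (<⇒≤ (Colouring.lost< col))))
    }

-- Choice of parameters

-- Kept abstract so that large constants are not unfolded.
abstract
  two^ : ℕ → ℕ
  two^ k = 2 ^ k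

  two^-def : ∀ k → two^ k ≡ 2 ^ k
  two^-def k = refl

two^-+ : ∀ a b → two^ (a + b) ≡ two^ a * two^ b
two^-+ a b = trans (two^-def (a + b)) (trans (^-distribˡ-+-* 2 a b) (sym (cong₂ _*_ (two^-def a) (two^-def b))))

two^-mono : ∀ {a b} → a ≤ b → two^ a ≤ two^ b
two^-mono {a} {b} le = ≤-trans (≤-reflexive (two^-def a)) (≤-trans (^-monoʳ-≤ 2 le) (≤-reflexive (sym (two^-def b))))

two^>0 : ∀ a → 0 < two^ a
two^>0 a = ≤-trans (m^n>0 2 a) (≤-reflexive (sym (two^-def a)))

square-cancel-≤ : ∀ a b → a * a ≤ b * b → a ≤ b
square-cancel-≤ a b le with a ≤? b
... | yes p = p
... | no ¬p = ⊥-elim (<⇒≱ (*-mono-< (≰⇒> ¬p) (≰⇒> ¬p)) le)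

2^-cancel-≤ : ∀ a b → 2 ^ a ≤ 2 ^ b → a ≤ b
2^-cancel-≤ a b le with a ≤? b
... | yes p = p
... | no ¬p = ⊥-elim (<⇒≱ (^-monoʳ-< 2 (s≤s (s≤s z≤n)) (≰⇒> ¬p)) le)

m<[1+m/n]*n : ∀ m n .{{_ : NonZero n}} → m < suc (m / n) * n
m<[1+m/n]*n m n = ≤-<-trans (≤-reflexive (m≡m%n+[m/n]*n m n)) (+-monoˡ-< (m / n * n) (m%n<n m n))

-- Up to factors polynomial in i ≈ (log n)/16, which u = 2ⁱ exceeds: n ≈ u¹⁶, m ≈ u⁸, the projections
-- have M = u¹⁴ classes of size at most f ≈ u², colour classes have degrees at most D ≈ M/m ≈ u⁶, and
-- g ≈ √(n log n) is the scale of independent sets.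
module Numerics (q i m′ n : ℕ) (0<q : 0 < q) (0<i : 0 < i)
  (big : two^ 64 * (q * i) ≤ 2 ^ i)
  (n≥ : (2 ^ i) ^ 16 ≤ n) (n≤ : n ≤ two^ 16 * (2 ^ i) ^ 16)
  (m-lower : n ≤ 32 * (i * (suc m′ * suc m′))) (m-upper : 4 * (i * (suc m′ * suc m′)) ≤ n) where

  open ≤-Reasoning

  m u M ψ f e D g h E K t k G R₀ : ℕ
  m = suc m′
  u = 2 ^ i
  M = u ^ 14
  -- `ψ` bounds the mean fibre size n/M. Of the three parts of `f`, two pay for `4 ^ ψ` from
  -- `growth` and one for the union over the classes; `e` and `D` are related in the same way.
  ψ = two^ 16 * (u * u)
  f = 3 * ψ
  e = suc (M / m)
  D = 3 * e
  -- Chosen so that `room` leaves only 2 g² closed pairs: 2^16 comes from `ψ`, and 2^24 from the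
  -- other constants there.
  g = two^ 40 * (i * m)
  h = 4 * g
  -- The 16 g² pairs between two blocks are shared out: 12 g² for the wrong side, 2 g² for closed
  -- pairs, and `K` = 2 g² left open.
  E = 12 * (g * g)
  K = 2 * (g * g)

  0<u : 0 < u
  0<u = m^n>0 2 i

  instance
    u-nonZero : NonZero u
    u-nonZero = >-nonZero 0<u

  u^-mono : ∀ {a b} → a ≤ b → u ^ a ≤ u ^ b
  u^-mono le = ^-monoʳ-≤ u le

  const*q*i≤u : ∀ c → c ≤ two^ 64 → c * (q * i) ≤ u
  const*q*i≤u c le = ≤-trans (*-monoˡ-≤ (q * i) le) big

  const*i≤u : ∀ c → c ≤ two^ 64 → c * i ≤ u
  const*i≤u c le = ≤-trans (*-monoʳ-≤ c (m≤n*m i q {{>-nonZero 0<q}})) (const*q*i≤u c le)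

  const≤u : ∀ c → c ≤ two^ 64 → c ≤ u
  const≤u c le = ≤-trans (m≤m*n c i {{>-nonZero 0<i}}) (const*i≤u c le)

  literal : ∀ c → T (c ≤ᵇ 2 ^ 64) → c ≤ two^ 64
  literal c p = ≤-trans (≤ᵇ⇒≤ c (2 ^ 64) p) (≤-reflexive (sym (two^-def 64)))

  n≤u^17 : n ≤ u ^ 17
  n≤u^17 = ≤-trans n≤ (*-monoˡ-≤ (u ^ 16) (const≤u (two^ 16) (two^-mono (≤ᵇ⇒≤ 16 64 tt))))

  m*m≤n : m * m ≤ n
  m*m≤n = ≤-trans (≤-trans (m≤n*m (m * m) i {{>-nonZero 0<i}}) (m≤n*m (i * (m * m)) 4)) m-upper

  m≤2^8*u^8 : m ≤ two^ 8 * u ^ 8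
  m≤2^8*u^8 = square-cancel-≤ m (two^ 8 * u ^ 8) (begin
    m * m                                  ≤⟨ ≤-trans m*m≤n n≤ ⟩
    two^ 16 * u ^ 16                       ≡⟨ cong₂ _*_ (two^-+ 8 8) (^-distribˡ-+-* u 8 8) ⟩
    two^ 8 * two^ 8 * (u ^ 8 * u ^ 8)      ≡⟨ interchange (two^ 8) (two^ 8) (u ^ 8) (u ^ 8) ⟩
    two^ 8 * u ^ 8 * (two^ 8 * u ^ 8)      ∎)

  m≤u^9 : m ≤ u ^ 9
  m≤u^9 = ≤-trans m≤2^8*u^8 (*-monoˡ-≤ (u ^ 8) (const≤u (two^ 8) (two^-mono (≤ᵇ⇒≤ 8 64 tt))))

  g≤u^9 : g ≤ u ^ 9
  g≤u^9 = begin
    two^ 40 * (i * m)                      ≤⟨ *-monoʳ-≤ (two^ 40) (*-monoʳ-≤ i m≤2^8*u^8) ⟩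
    two^ 40 * (i * (two^ 8 * u ^ 8))       ≡⟨ regroup (two^ 40) i (two^ 8) (u ^ 8) ⟩
    two^ 40 * two^ 8 * i * u ^ 8           ≡⟨ cong (λ c → c * i * u ^ 8) (two^-+ 40 8) ⟨
    two^ 48 * i * u ^ 8                    ≤⟨ *-monoˡ-≤ (u ^ 8) (const*i≤u (two^ 48) (two^-mono (≤ᵇ⇒≤ 48 64 tt))) ⟩
    u ^ 9                                  ∎
    where
    regroup : ∀ a i b p → a * (i * (b * p)) ≡ a * b * i * p
    regroup = solve-∀

  u*u≤m : u * u ≤ m
  u*u≤m = square-cancel-≤ (u * u) m (begin
    u * u * (u * u)         ≡⟨ fourth u ⟩
    u ^ 4                   ≤⟨ u^-mono (≤ᵇ⇒≤ 4 15 tt) ⟩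
    u ^ 15                  ≤⟨ *-cancelˡ-≤ u (≤-trans n≥ (≤-trans m-lower bound)) ⟩
    m * m                   ∎)
    where
    fourth : ∀ u → u * u * (u * u) ≡ u * (u * (u * (u * 1)))
    fourth = solve-∀
    bound : 32 * (i * (m * m)) ≤ u * (m * m)
    bound = ≤-trans (≤-reflexive (sym (*-assoc 32 i (m * m)))) (*-monoˡ-≤ (m * m) (const*i≤u 32 (literal 32 tt)))

  0<g : 0 < g
  0<g = *-mono-≤ (two^>0 40) (*-mono-≤ 0<i (s≤s z≤n))

  0<M : 0 < M
  0<M = m^n>0 u 14

  0<f : 0 < f
  0<f = *-mono-≤ {1} {3} (s≤s z≤n) (*-mono-≤ (two^>0 16) (*-mono-≤ 0<u 0<u))

  instance
    f-nonZero : NonZero f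
    f-nonZero = >-nonZero 0<f
    g-nonZero : NonZero g
    g-nonZero = >-nonZero 0<g

  t = suc (8 * g / f)
  k = 512 * g

  instance
    k-nonZero : NonZero k
    k-nonZero = >-nonZero (*-mono-≤ {1} {512} (s≤s z≤n) 0<g)

  G = suc (n / k)
  -- Ten times the bound 4 n² M / m² on the mean loss, with n ≤ 32 i m²: 1280 = 40 * 32.
  R₀ = 1280 * (i * (n * M))

  M<e*m : M < e * m
  M<e*m = m<[1+m/n]*n M m

  u^9≤M : u ^ 9 ≤ M
  u^9≤M = u^-mono (≤ᵇ⇒≤ 9 14 tt)

  e*m≤2M : e * m ≤ 2 * M
  e*m≤2M = begin
    m + M / m * m        ≤⟨ +-mono-≤ (≤-trans m≤u^9 u^9≤M) (m/n*n≤m M m) ⟩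
    M + M                ≡⟨ cong (M +_) (+-identityʳ M) ⟨
    2 * M                ∎

  M≡2^ : M ≡ 2 ^ (i * 14)
  M≡2^ = ^-*-assoc 2 i 14

  u^≡2^ : ∀ a → u ^ a ≡ 2 ^ (i * a)
  u^≡2^ a = ^-*-assoc 2 i a

  4^≡2^ : ∀ a → 4 ^ a ≡ 2 ^ (2 * a)
  4^≡2^ a = ^-*-assoc 2 2 a

  14*i+3≤ψ : 3 + i * 14 ≤ ψ
  14*i+3≤ψ = begin
    3 + i * 14            ≤⟨ +-monoˡ-≤ (i * 14) (m≤m*n 3 i {{>-nonZero 0<i}}) ⟩
    3 * i + i * 14        ≡⟨ sum i ⟩
    17 * i                ≤⟨ const*i≤u 17 (literal 17 tt) ⟩
    u                     ≤⟨ m≤n*m u (two^ 16 * u) {{>-nonZero (*-mono-≤ (two^>0 16) 0<u)}} ⟩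
    two^ 16 * u * u       ≡⟨ *-assoc (two^ 16) u u ⟩
    ψ                     ∎
    where
    sum : ∀ i → 3 * i + i * 14 ≡ 17 * i
    sum = solve-∀

  fibres-rare : 4 * (2 * M * suc M ^ n) ≤ 2 ^ f * M ^ n
  fibres-rare = begin
    4 * (2 * M * suc M ^ n)                ≤⟨ *-monoʳ-≤ 4 (*-monoʳ-≤ (2 * M) (subst (λ x → x ^ n ≤ 4 ^ ψ * M ^ n) (+-comm M 1) (growth M 1 M n ψ 0<M (≤-reflexive (+-identityʳ M)) n≤ψM))) ⟩
    4 * (2 * M * (4 ^ ψ * M ^ n))          ≡⟨ regroup M (4 ^ ψ) (M ^ n) ⟩
    8 * M * 4 ^ ψ * M ^ n                  ≤⟨ *-monoˡ-≤ (M ^ n) powers ⟩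
    2 ^ f * M ^ n                          ∎
    where
    regroup : ∀ M a b → 4 * (2 * M * (a * b)) ≡ 8 * M * a * b
    regroup = solve-∀
    n≤ψM : n ≤ ψ * M
    n≤ψM = ≤-trans n≤ (≤-reflexive (shape (two^ 16) u (u ^ 14)))
      where
      shape : ∀ c u p → c * (u * (u * p)) ≡ c * (u * u) * p
      shape = solve-∀
    powers : 8 * M * 4 ^ ψ ≤ 2 ^ f
    powers = begin
      2 ^ 3 * M * 4 ^ ψ                      ≡⟨ cong₂ (λ x y → 2 ^ 3 * x * y) M≡2^ (4^≡2^ ψ) ⟩
      2 ^ 3 * 2 ^ (i * 14) * 2 ^ (2 * ψ)     ≡⟨ cong (_* 2 ^ (2 * ψ)) (^-distribˡ-+-* 2 3 (i * 14)) ⟨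
      2 ^ (3 + i * 14) * 2 ^ (2 * ψ)         ≡⟨ ^-distribˡ-+-* 2 (3 + i * 14) (2 * ψ) ⟨
      2 ^ (3 + i * 14 + 2 * ψ)               ≤⟨ ^-monoʳ-≤ 2 (+-monoˡ-≤ (2 * ψ) 14*i+3≤ψ) ⟩
      2 ^ (3 * ψ)                            ∎

  k≤n : k ≤ n
  k≤n = begin
    512 * g         ≤⟨ *-mono-≤ (const≤u 512 (literal 512 tt)) g≤u^9 ⟩
    u ^ 10          ≤⟨ u^-mono (≤ᵇ⇒≤ 10 16 tt) ⟩
    u ^ 16          ≤⟨ n≥ ⟩
    n               ∎

  k*G≤2n : k * G ≤ 2 * n
  k*G≤2n = begin
    k * suc (n / k)        ≡⟨ *-comm k (suc (n / k)) ⟩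
    k + n / k * k          ≤⟨ +-mono-≤ k≤n (m/n*n≤m n k) ⟩
    n + n                  ≡⟨ cong (n +_) (+-identityʳ n) ⟨
    2 * n                  ∎

  -- The mean number n (2h)² / M² of vertices in a box has to stay below k by a factor `u`. The
  -- bounds on g and n use up u^28 = `M * M` exactly; this is the constraint that keeps M above
  -- n^(3/4).
  box-room : u * ((h + h) * (h + h)) * G ≤ M * M
  box-room = begin
    u * ((h + h) * (h + h)) * G         ≤⟨ m≤n*m _ 8 ⟩
    8 * (u * ((h + h) * (h + h)) * G)   ≡⟨ shape u g G ⟩
    u * g * (512 * g * G)               ≤⟨ *-mono-≤ (*-monoʳ-≤ u g≤u^9) k*G≤2n ⟩
    u ^ 10 * (2 * n)                    ≤⟨ *-monoʳ-≤ (u ^ 10) (*-mono-≤ (const≤u 2 (literal 2 tt)) n≤u^17) ⟩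
    u ^ 10 * u ^ 18                     ≡⟨ trans (sym (^-distribˡ-+-* u 10 18)) (^-distribˡ-+-* u 14 14) ⟩
    M * M                               ∎
    where
    shape : ∀ u g G → 8 * (u * ((4 * g + 4 * g) * (4 * g + 4 * g)) * G) ≡ u * g * (512 * g * G)
    shape = solve-∀

  boxes-rare : 4 * (M ^ (h + h) * M ^ (h + h) * (M * M + u * ((h + h) * (h + h))) ^ n) ≤ u ^ k * (M * M) ^ n
  boxes-rare = begin
    4 * (M ^ (h + h) * M ^ (h + h) * (M * M + u * ((h + h) * (h + h))) ^ n)
      ≤⟨ *-monoʳ-≤ 4 (*-monoʳ-≤ (M ^ (h + h) * M ^ (h + h)) (growth (M * M) (u * ((h + h) * (h + h))) G n k (s≤s z≤n) box-room (≤-trans (<⇒≤ (m<[1+m/n]*n n k)) (≤-reflexive (*-comm G k))))) ⟩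
    4 * (M ^ (h + h) * M ^ (h + h) * (4 ^ k * (M * M) ^ n))
      ≡⟨ regroup (M ^ (h + h)) (4 ^ k) ((M * M) ^ n) ⟩
    4 * (M ^ (h + h) * M ^ (h + h)) * 4 ^ k * (M * M) ^ n
      ≤⟨ *-monoˡ-≤ ((M * M) ^ n) powers ⟩
    u ^ k * (M * M) ^ n ∎
    where
    regroup : ∀ a b c → 4 * (a * a * (b * c)) ≡ 4 * (a * a) * b * c
    regroup = solve-∀
    exponents : ∀ g → g + 14 * (4 * g + 4 * g + (4 * g + 4 * g)) + 256 * g ≡ 481 * g
    exponents = solve-∀
    powers : 4 * (M ^ (h + h) * M ^ (h + h)) * 4 ^ k ≤ u ^ k
    powers = begin
      4 * (M ^ (h + h) * M ^ (h + h)) * 4 ^ k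
        ≡⟨ cong₂ (λ x y → 4 * x * y) (trans (sym (^-distribˡ-+-* M (h + h) (h + h))) (^-*-assoc u 14 (h + h + (h + h))))
             (trans (cong (4 ^_) (double g)) (sym (^-*-assoc 4 2 (256 * g)))) ⟩
      4 * u ^ (14 * (h + h + (h + h))) * 16 ^ (256 * g)
        ≤⟨ *-mono-≤ (*-monoˡ-≤ (u ^ (14 * (h + h + (h + h)))) (≤-trans (const≤u 4 (literal 4 tt)) (≤-trans (≤-reflexive (sym (*-identityʳ u))) (u^-mono 0<g)))) (^-monoˡ-≤ (256 * g) (const≤u 16 (literal 16 tt))) ⟩
      u ^ g * u ^ (14 * (h + h + (h + h))) * u ^ (256 * g)
        ≡⟨ cong (_* u ^ (256 * g)) (^-distribˡ-+-* u g (14 * (h + h + (h + h)))) ⟨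
      u ^ (g + 14 * (h + h + (h + h))) * u ^ (256 * g)
        ≡⟨ trans (sym (^-distribˡ-+-* u (g + 14 * (h + h + (h + h))) (256 * g))) (cong (u ^_) (exponents g)) ⟩
      u ^ (481 * g)
        -- 481 = 1 + 224 + 256: the constant 4, the choice of two sets of 8 g classes among u^14,
        -- and `4 ^ k` at the price of k/2. With k = 256 g the sum would be 353, which is too much.
        ≤⟨ u^-mono (*-monoˡ-≤ g (≤ᵇ⇒≤ 481 512 tt)) ⟩
      u ^ k ∎
      where
      double : ∀ g → 512 * g ≡ 2 * (256 * g)
      double = solve-∀

  n^h*n^h≤2^ : n ^ h * n ^ h ≤ 2 ^ (136 * (i * g))
  n^h*n^h≤2^ = begin
    n ^ h * n ^ h               ≡⟨ ^-distribˡ-+-* n h h ⟨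
    n ^ (h + h)                 ≤⟨ ^-monoˡ-≤ (h + h) n≤u^17 ⟩
    (u ^ 17) ^ (h + h)          ≡⟨ trans (cong (_^ (h + h)) (u^≡2^ 17)) (^-*-assoc 2 (i * 17) (h + h)) ⟩
    2 ^ (i * 17 * (h + h))      ≡⟨ cong (2 ^_) (shape i g) ⟩
    2 ^ (136 * (i * g))         ∎
    where
    shape : ∀ i g → i * 17 * (4 * g + 4 * g) ≡ 136 * (i * g)
    shape = solve-∀

  constant*i≤g : ∀ c → c ≤ two^ 40 → c * i ≤ g
  constant*i≤g c le = *-mono-≤ le (m≤m*n i m)

  i*g>0 : 0 < i * g
  i*g>0 = *-mono-≤ 0<i 0<g

  literal40 : ∀ c → T (c ≤ᵇ 2 ^ 40) → c ≤ two^ 40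
  literal40 c p = ≤-trans (≤ᵇ⇒≤ c (2 ^ 40) p) (≤-reflexive (sym (two^-def 40)))

  sides-rare : 2 * (2 * (n ^ h * n ^ h) * 3 ^ (h * h)) ≤ 2 ^ E * 2 ^ (h * h)
  sides-rare = begin
    2 * (2 * (n ^ h * n ^ h) * 3 ^ (h * h))
      ≤⟨ *-monoʳ-≤ 2 (*-monoˡ-≤ (3 ^ (h * h)) (*-monoʳ-≤ 2 n^h*n^h≤2^)) ⟩
    2 * (2 * 2 ^ (136 * (i * g)) * 3 ^ (h * h))
      ≡⟨ regroup (2 ^ (136 * (i * g))) (3 ^ (h * h)) ⟩
    2 ^ (2 + 136 * (i * g)) * 3 ^ (h * h)
      ≤⟨ *-monoˡ-≤ (3 ^ (h * h)) (^-monoʳ-≤ 2 exponent≤) ⟩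
    2 ^ (2 * (g * g)) * 3 ^ (h * h)
      ≡⟨ cong (2 ^ (2 * (g * g)) *_) (trans (cong (3 ^_) (eight g)) (sym (^-*-assoc 3 8 (2 * (g * g))))) ⟩
    2 ^ (2 * (g * g)) * 6561 ^ (2 * (g * g))
      ≡⟨ ^-distribʳ-* 2 6561 (2 * (g * g)) ⟨
    13122 ^ (2 * (g * g))
      -- This is 2 * 3^8 ≤ 2^14. Doubling the exponent 14 gives 28 = 12 + 16, the shares of `E` and
      -- `h * h`.
      ≤⟨ ^-monoˡ-≤ (2 * (g * g)) (≤ᵇ⇒≤ 13122 16384 tt) ⟩
    (2 ^ 14) ^ (2 * (g * g))
      ≡⟨ trans (^-*-assoc 2 14 (2 * (g * g))) (trans (cong (2 ^_) (total g)) (^-distribˡ-+-* 2 E (h * h))) ⟩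
    2 ^ E * 2 ^ (h * h) ∎
    where
    regroup : ∀ a b → 2 * (2 * a * b) ≡ 2 * (2 * a) * b
    regroup = solve-∀
    eight : ∀ g → 4 * g * (4 * g) ≡ 8 * (2 * (g * g))
    eight = solve-∀
    total : ∀ g → 14 * (2 * (g * g)) ≡ 12 * (g * g) + 4 * g * (4 * g)
    total = solve-∀
    exponent≤ : 2 + 136 * (i * g) ≤ 2 * (g * g)
    exponent≤ = begin
      2 + 136 * (i * g)                ≤⟨ +-monoˡ-≤ (136 * (i * g)) (*-monoʳ-≤ 2 i*g>0) ⟩
      2 * (i * g) + 136 * (i * g)      ≡⟨ shape i g ⟩
      2 * (69 * i * g)                 ≤⟨ *-monoʳ-≤ 2 (*-monoˡ-≤ g (constant*i≤g 69 (literal40 69 tt))) ⟩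
      2 * (g * g)                      ∎
      where
      shape : ∀ i g → 2 * (i * g) + 136 * (i * g) ≡ 2 * (69 * i * g)
      shape = solve-∀

  24*i≤e : 24 * i ≤ e
  24*i≤e = <⇒≤ (*-cancelʳ-< m (24 * i) e (begin-strict
    24 * i * m        ≤⟨ *-mono-≤ (const*i≤u 24 (literal 24 tt)) m≤u^9 ⟩
    u ^ 10            ≤⟨ u^-mono (≤ᵇ⇒≤ 10 14 tt) ⟩
    M                 <⟨ M<e*m ⟩
    e * m             ∎))

  degrees-rare : 10 * (2 * (m * M) * (m′ + 2) ^ M) ≤ 2 ^ D * m ^ M
  degrees-rare = begin
    10 * (2 * (m * M) * (m′ + 2) ^ M)
      ≤⟨ *-monoʳ-≤ 10 (*-monoʳ-≤ (2 * (m * M)) (subst (λ x → x ^ M ≤ 4 ^ e * m ^ M) (sym (+-suc m′ 1)) (growth m 1 m M e (s≤s z≤n) (≤-reflexive (+-identityʳ m)) (<⇒≤ M<e*m)))) ⟩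
    10 * (2 * (m * M) * (4 ^ e * m ^ M))
      ≡⟨ regroup m M (4 ^ e) (m ^ M) ⟩
    20 * (m * M) * 4 ^ e * m ^ M
      ≤⟨ *-monoˡ-≤ (m ^ M) powers ⟩
    2 ^ D * m ^ M ∎
    where
    regroup : ∀ m M a b → 10 * (2 * (m * M) * (a * b)) ≡ 20 * (m * M) * a * b
    regroup = solve-∀
    powers : 20 * (m * M) * 4 ^ e ≤ 2 ^ D
    powers = begin
      20 * (m * M) * 4 ^ e          ≤⟨ *-monoˡ-≤ (4 ^ e) (*-mono-≤ (const≤u 20 (literal 20 tt)) (*-monoˡ-≤ M m≤u^9)) ⟩
      u * (u ^ 9 * u ^ 14) * 4 ^ e  ≡⟨ cong₂ (λ x y → u * x * y) (sym (^-distribˡ-+-* u 9 14)) (4^≡2^ e) ⟩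
      u ^ 24 * 2 ^ (2 * e)          ≡⟨ cong (_* 2 ^ (2 * e)) (u^≡2^ 24) ⟩
      2 ^ (i * 24) * 2 ^ (2 * e)    ≤⟨ *-monoˡ-≤ (2 ^ (2 * e)) (^-monoʳ-≤ 2 (≤-trans (≤-reflexive (*-comm i 24)) 24*i≤e)) ⟩
      2 ^ e * 2 ^ (2 * e)           ≡⟨ ^-distribˡ-+-* 2 e (2 * e) ⟨
      2 ^ D                         ∎

  f≤8g : f ≤ 8 * g
  f≤8g = begin
    3 * (two^ 16 * (u * u))        ≤⟨ *-mono-≤ (≤ᵇ⇒≤ 3 8 tt) (*-mono-≤ (two^-mono (≤ᵇ⇒≤ 16 40 tt)) (≤-trans u*u≤m (m≤n*m m i {{>-nonZero 0<i}}))) ⟩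
    8 * g                          ∎

  8g≤f*t : 8 * g ≤ f * t
  8g≤f*t = ≤-trans (<⇒≤ (m<[1+m/n]*n (8 * g) f)) (≤-reflexive (*-comm t f))

  f*t≤16g : f * t ≤ 16 * g
  f*t≤16g = begin
    f * suc (8 * g / f)            ≡⟨ *-comm f t ⟩
    f + 8 * g / f * f              ≤⟨ +-mono-≤ f≤8g (m/n*n≤m (8 * g) f) ⟩
    8 * g + 8 * g                  ≡⟨ sum g ⟩
    16 * g                         ∎
    where
    sum : ∀ g → 8 * g + 8 * g ≡ 16 * g
    sum = solve-∀

  u*t≤m : u * t ≤ m
  u*t≤m = *-cancelˡ-≤ f (begin
    f * (u * t)                           ≡⟨ exchange f u t ⟩
    u * (f * t)                           ≤⟨ *-monoʳ-≤ u f*t≤16g ⟩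
    u * (16 * (two^ 40 * (i * m)))        ≡⟨ shape u (two^ 40) i m ⟩
    16 * two^ 40 * i * (u * m)            ≤⟨ *-monoˡ-≤ (u * m) (const*i≤u (16 * two^ 40) 16*2^40≤) ⟩
    u * (u * m)                           ≤⟨ m≤n*m (u * (u * m)) (3 * two^ 16) {{>-nonZero (*-mono-≤ {1} {3} (s≤s z≤n) (two^>0 16))}} ⟩
    3 * two^ 16 * (u * (u * m))           ≡⟨ back (two^ 16) u m ⟩
    f * m                                 ∎)
    where
    exchange : ∀ a b c → a * (b * c) ≡ b * (a * c)
    exchange = solve-∀
    shape : ∀ u z i m → u * (16 * (z * (i * m))) ≡ 16 * z * i * (u * m)
    shape = solve-∀
    back : ∀ z u m → 3 * z * (u * (u * m)) ≡ 3 * (z * (u * u)) * m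
    back = solve-∀
    16*2^40≤ : 16 * two^ 40 ≤ two^ 64
    16*2^40≤ = ≤-trans (≤-reflexive (trans (cong (_* two^ 40) (sym (two^-def 4))) (sym (two^-+ 4 40)))) (two^-mono (≤ᵇ⇒≤ 44 64 tt))

  -- The exponent needed is 10 + 28 t + t, for the factor 20 m, two sets of t classes and `4 ^ t`. A
  -- bounded multiple of t suffices because `u * t ≤ m` allows the Chernoff parameter `u`, a power
  -- of n.
  dense-rare : 10 * (2 * (m * (M ^ t * M ^ t)) * (m′ + u) ^ (t * t)) ≤ u ^ (64 * t) * m ^ (t * t)
  dense-rare = begin
    10 * (2 * (m * (M ^ t * M ^ t)) * (m′ + u) ^ (t * t))
      ≤⟨ *-monoʳ-≤ 10 (*-monoʳ-≤ (2 * (m * (M ^ t * M ^ t))) (≤-trans (^-monoˡ-≤ (t * t) (+-monoˡ-≤ u (n≤1+n m′))) (growth m u t (t * t) t (s≤s z≤n) u*t≤m ≤-refl))) ⟩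
    10 * (2 * (m * (M ^ t * M ^ t)) * (4 ^ t * m ^ (t * t)))
      ≡⟨ regroup m (M ^ t) (4 ^ t) (m ^ (t * t)) ⟩
    20 * m * (M ^ t * M ^ t) * 4 ^ t * m ^ (t * t)
      ≤⟨ *-monoˡ-≤ (m ^ (t * t)) powers ⟩
    u ^ (64 * t) * m ^ (t * t) ∎
    where
    regroup : ∀ m a b c → 10 * (2 * (m * (a * a)) * (b * c)) ≡ 20 * m * (a * a) * b * c
    regroup = solve-∀
    powers : 20 * m * (M ^ t * M ^ t) * 4 ^ t ≤ u ^ (64 * t)
    powers = begin
      20 * m * (M ^ t * M ^ t) * 4 ^ t
        ≤⟨ *-mono-≤ (*-mono-≤ (*-mono-≤ (const≤u 20 (literal 20 tt)) m≤u^9) (≤-reflexive (trans (sym (^-distribˡ-+-* M t t)) (^-*-assoc u 14 (t + t))))) (^-monoˡ-≤ t (const≤u 4 (literal 4 tt))) ⟩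
      u ^ 10 * u ^ (14 * (t + t)) * u ^ t
        ≡⟨ cong (_* u ^ t) (^-distribˡ-+-* u 10 (14 * (t + t))) ⟨
      u ^ (10 + 14 * (t + t)) * u ^ t
        ≡⟨ ^-distribˡ-+-* u (10 + 14 * (t + t)) t ⟨
      u ^ (10 + 14 * (t + t) + t)
        ≤⟨ u^-mono (≤-trans (+-monoˡ-≤ t (+-monoˡ-≤ (14 * (t + t)) (≤-trans (≤ᵇ⇒≤ 10 35 tt) (m≤m*n 35 t)))) (≤-reflexive (sum t))) ⟩
      u ^ (64 * t) ∎
      where
      sum : ∀ t → 35 * t + 14 * (t + t) + t ≡ 64 * t
      sum = solve-∀

  -- Missing K cells has probability at most 2^(-K/m), and K/m = 2^41 i g exceeds the 136 i g bits
  -- that describe two blocks. This forces g to be at least of order i m, that is √(n log n).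
  missing-rare : 10 * (2 * (m * (n ^ h * n ^ h)) * m′ ^ K) ≤ m ^ K
  missing-rare = begin
    10 * (2 * (m * (n ^ h * n ^ h)) * m′ ^ K)     ≡⟨ regroup m (n ^ h * n ^ h) (m′ ^ K) ⟩
    20 * m * (n ^ h * n ^ h) * m′ ^ K             ≤⟨ *-monoˡ-≤ (m′ ^ K) few ⟩
    2 ^ κ * m′ ^ K                                ≡⟨ cong (λ x → 2 ^ κ * m′ ^ x) K≡ ⟩
    2 ^ κ * m′ ^ (m * κ)                          ≡⟨ cong (2 ^ κ *_) (^-*-assoc m′ m κ) ⟨
    2 ^ κ * (m′ ^ m) ^ κ                          ≡⟨ ^-distribʳ-* 2 (m′ ^ m) κ ⟨
    (2 * m′ ^ m) ^ κ                              ≤⟨ ^-monoˡ-≤ κ (2*a^[1+a]≤[1+a]^[1+a] m′) ⟩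
    (m ^ m) ^ κ                                   ≡⟨ ^-*-assoc m m κ ⟩
    m ^ (m * κ)                                   ≡⟨ cong (m ^_) K≡ ⟨
    m ^ K                                         ∎
    where
    κ = 2 * (two^ 40 * i * g)
    regroup : ∀ m a b → 10 * (2 * (m * a) * b) ≡ 20 * m * a * b
    regroup = solve-∀
    K≡ : K ≡ m * κ
    K≡ = shape (two^ 40) i m g
      where
      shape : ∀ z i m g → 2 * (z * (i * m) * g) ≡ m * (2 * (z * i * g))
      shape = solve-∀
    few : 20 * m * (n ^ h * n ^ h) ≤ 2 ^ κ
    few = begin
      20 * m * (n ^ h * n ^ h)                ≤⟨ *-mono-≤ (*-mono-≤ (const≤u 20 (literal 20 tt)) m≤u^9) n^h*n^h≤2^ ⟩
      u ^ 10 * 2 ^ (136 * (i * g))            ≡⟨ cong (_* 2 ^ (136 * (i * g))) (u^≡2^ 10) ⟩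
      2 ^ (i * 10) * 2 ^ (136 * (i * g))      ≡⟨ ^-distribˡ-+-* 2 (i * 10) (136 * (i * g)) ⟨
      2 ^ (i * 10 + 136 * (i * g))            ≤⟨ ^-monoʳ-≤ 2 exponent≤ ⟩
      2 ^ κ                                   ∎
      where
      shape : ∀ i g → i * g * 10 + 136 * (i * g) ≡ 2 * (73 * i * g)
      shape = solve-∀
      exponent≤ : i * 10 + 136 * (i * g) ≤ κ
      exponent≤ = begin
        i * 10 + 136 * (i * g)                ≤⟨ +-monoˡ-≤ (136 * (i * g)) (*-monoˡ-≤ 10 (m≤m*n i g)) ⟩
        i * g * 10 + 136 * (i * g)            ≡⟨ shape i g ⟩
        2 * (73 * i * g)                      ≤⟨ *-monoʳ-≤ 2 (*-monoˡ-≤ g (*-monoˡ-≤ i (literal40 73 tt))) ⟩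
        κ                                     ∎

  few-lost : 10 * (n * (n * (2 * (m * (M + M))))) ≤ R₀ * m ^ 3
  few-lost = begin
    10 * (n * (n * (2 * (m * (M + M)))))              ≡⟨ shape n m M ⟩
    40 * (n * (m * M)) * n                            ≤⟨ *-monoʳ-≤ (40 * (n * (m * M))) m-lower ⟩
    40 * (n * (m * M)) * (32 * (i * (m * m)))         ≡⟨ back n m M i ⟩
    R₀ * m ^ 3                                        ∎
    where
    shape : ∀ n m M → 10 * (n * (n * (2 * (m * (M + M))))) ≡ 40 * (n * (m * M)) * n
    shape = solve-∀
    back : ∀ n m M i → 40 * (n * (m * M)) * (32 * (i * (m * m))) ≡ 1280 * (i * (n * M)) * (m * (m * (m * 1)))
    back = solve-∀

  h+h≤f*t : h + h ≤ f * t
  h+h≤f*t = ≤-trans (≤-reflexive (sum g)) 8g≤f*t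
    where
    sum : ∀ g → 4 * g + 4 * g ≡ 8 * g
    sum = solve-∀

  -- The product is of order (n/M)(M/m) = n/m, so M cancels, and n ≤ 32 i m² brings it to the scale
  -- of g.
  f*D≤ : f * D ≤ 576 * (two^ 16 * (i * m))
  f*D≤ = *-cancelʳ-≤ _ _ m (begin
    f * D * m                                    ≡⟨ shape (two^ 16) u e m ⟩
    9 * two^ 16 * (u * u) * (e * m)              ≤⟨ *-monoʳ-≤ (9 * two^ 16 * (u * u)) e*m≤2M ⟩
    9 * two^ 16 * (u * u) * (2 * u ^ 14)         ≡⟨ collect (two^ 16) u (u ^ 14) ⟩
    18 * two^ 16 * u ^ 16                        ≤⟨ *-monoʳ-≤ (18 * two^ 16) (≤-trans n≥ m-lower) ⟩
    18 * two^ 16 * (32 * (i * (m * m)))          ≡⟨ back (two^ 16) i m ⟩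
    576 * (two^ 16 * (i * m)) * m                ∎)
    where
    shape : ∀ z u e m → 3 * (z * (u * u)) * (3 * e) * m ≡ 9 * z * (u * u) * (e * m)
    shape = solve-∀
    collect : ∀ z u p → 9 * z * (u * u) * (2 * p) ≡ 18 * z * (u * (u * p))
    collect = solve-∀
    back : ∀ z i m → 18 * z * (32 * (i * (m * m))) ≡ 576 * (z * (i * m)) * m
    back = solve-∀

  room : K + E + 32 * (64 * f * (f * t) * D) ≤ h * h
  room = begin
    K + E + 32 * (64 * f * (f * t) * D)              ≡⟨ cong (K + E +_) (shape f (f * t) D) ⟩
    K + E + 2048 * (f * t) * (f * D)                 ≤⟨ +-monoʳ-≤ (K + E) (*-mono-≤ (*-monoʳ-≤ 2048 f*t≤16g) f*D≤) ⟩
    K + E + 2048 * (16 * g) * (576 * (two^ 16 * (i * m)))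
      ≤⟨ +-monoʳ-≤ (K + E) (*-monoʳ-≤ (2048 * (16 * g)) (*-monoˡ-≤ (two^ 16 * (i * m)) (≤ᵇ⇒≤ 576 1024 tt))) ⟩
    K + E + 2048 * (16 * g) * (1024 * (two^ 16 * (i * m)))
      ≡⟨ cong (K + E +_) (collect g (two^ 16) (i * m)) ⟩
    K + E + 2 * g * (2 ^ 24 * two^ 16 * (i * m))     ≡⟨ cong (λ c → K + E + 2 * g * (c * (i * m))) (trans (cong (_* two^ 16) (sym (two^-def 24))) (sym (two^-+ 24 16))) ⟩
    K + E + 2 * g * g                                ≡⟨ total g ⟩
    h * h                                            ∎
    where
    shape : ∀ f x D → 32 * (64 * f * x * D) ≡ 2048 * x * (f * D)
    shape = solve-∀
    collect : ∀ g z x → 2048 * (16 * g) * (1024 * (z * x)) ≡ 2 * g * (16777216 * z * x)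
    collect = solve-∀
    total : ∀ g → 2 * (g * g) + 12 * (g * g) + 2 * g * g ≡ 4 * g * (4 * g)
    total = solve-∀

  0<n : 0 < n
  0<n = ≤-trans (m^n>0 u 16) n≥

  ℓ = n * f + n * f + R₀

  -- Relative to n², the loss is of order f/n + i M/n, at most about i/u²; one factor `u` absorbs q,
  -- i and the constants by `big`.
  q*ℓ≤pairs : q * ℓ ≤ pairs n
  q*ℓ≤pairs = *-cancelˡ-≤ 2 (+-cancelʳ-≤ n _ _ (begin
    2 * (q * ℓ) + n                                        ≡⟨ shape q n f i M ⟩
    n * (4 * (q * f) + 2560 * (q * i) * M + 1)             ≤⟨ *-monoʳ-≤ n (≤-trans (+-mono-≤ (+-mono-≤ fibres-part lost-part) (m^n>0 u 15)) (≤-trans (≤-reflexive (three (u ^ 15))) (*-monoˡ-≤ (u ^ 15) (const≤u 3 (literal 3 tt))))) ⟩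
    n * u ^ 16                                             ≤⟨ *-monoʳ-≤ n n≥ ⟩
    n * n                                                  ≡⟨ 2*pairs n ⟨
    2 * pairs n + n                                        ∎))
    where
    shape : ∀ q n f i M → 2 * (q * (n * f + n * f + 1280 * (i * (n * M)))) + n ≡ n * (4 * (q * f) + 2560 * (q * i) * M + 1)
    shape = solve-∀
    three : ∀ x → x + x + x ≡ 3 * x
    three = solve-∀
    lost-part : 2560 * (q * i) * M ≤ u ^ 15
    lost-part = *-monoˡ-≤ M (const*q*i≤u 2560 (literal 2560 tt))
    fibres-part : 4 * (q * f) ≤ u ^ 15
    fibres-part = begin
      4 * (q * (3 * (two^ 16 * (u * u))))        ≡⟨ arrange q (two^ 16) u ⟩
      12 * two^ 16 * q * (u * u)                 ≤⟨ *-monoˡ-≤ (u * u) (≤-trans (*-monoʳ-≤ (12 * two^ 16) (m≤m*n q i {{>-nonZero 0<i}})) (const*q*i≤u (12 * two^ 16) 12*2^16≤)) ⟩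
      u * (u * u)                                ≡⟨ cube u ⟩
      u ^ 3                                      ≤⟨ u^-mono (≤ᵇ⇒≤ 3 15 tt) ⟩
      u ^ 15                                     ∎
      where
      arrange : ∀ q z u → 4 * (q * (3 * (z * (u * u)))) ≡ 12 * z * q * (u * u)
      arrange = solve-∀
      cube : ∀ u → u * (u * u) ≡ u * (u * (u * 1))
      cube = solve-∀
      12*2^16≤ : 12 * two^ 16 ≤ two^ 64
      12*2^16≤ = ≤-trans (*-monoˡ-≤ (two^ 16) (≤ᵇ⇒≤ 12 16 tt))
        (≤-trans (≤-reflexive (trans (cong (_* two^ 16) (sym (two^-def 4))) (sym (two^-+ 4 16)))) (two^-mono (≤ᵇ⇒≤ 20 64 tt)))

  -- From k = 2^49 i m and 4 i m² ≤ n follows k² ≤ 2^96 i n, and 16 i ≤ log₂ n turns this into C² =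
  -- 2^92.
  independence-bound : ∀ s → s < k → 2 ^ (s * s * (1 * 1)) ≤ n ^ (two^ 46 * two^ 46 * n)
  independence-bound s s<k = begin
    2 ^ (s * s * (1 * 1))                       ≤⟨ ^-monoʳ-≤ 2 exponent≤ ⟩
    2 ^ (i * 16 * (two^ 46 * two^ 46 * n))      ≡⟨ trans (cong (_^ (two^ 46 * two^ 46 * n)) (u^≡2^ 16)) (^-*-assoc 2 (i * 16) (two^ 46 * two^ 46 * n)) ⟨
    (u ^ 16) ^ (two^ 46 * two^ 46 * n)          ≤⟨ ^-monoˡ-≤ (two^ 46 * two^ 46 * n) n≥ ⟩
    n ^ (two^ 46 * two^ 46 * n)                 ∎
    where
    exponent≤ : s * s * (1 * 1) ≤ i * 16 * (two^ 46 * two^ 46 * n)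
    exponent≤ = begin
      s * s * (1 * 1)                                    ≤⟨ ≤-trans (≤-reflexive (*-identityʳ (s * s))) (*-mono-≤ (<⇒≤ s<k) (<⇒≤ s<k)) ⟩
      k * k                                              ≡⟨ shape z i m ⟩
      i * 65536 * (z * z) * (4 * (i * (m * m)))          ≤⟨ *-monoʳ-≤ (i * 65536 * (z * z)) m-upper ⟩
      i * 65536 * (z * z) * n                            ≡⟨ cong (λ c → i * c * (z * z) * n) 2^16≡ ⟩
      i * (16 * (x * x)) * (z * z) * n                   ≡⟨ back i x z n ⟩
      i * 16 * (x * z * (x * z) * n)                     ≡⟨ cong (λ c → i * 16 * (c * c * n)) (two^-+ 6 40) ⟨
      i * 16 * (two^ 46 * two^ 46 * n)                   ∎
      where
      x z : ℕ
      x = two^ 6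
      z = two^ 40
      2^16≡ : 65536 ≡ 16 * (x * x)
      2^16≡ = sym (cong (λ c → 16 * (c * c)) (two^-def 6))
      shape : ∀ z i m → 512 * (z * (i * m)) * (512 * (z * (i * m))) ≡ i * 65536 * (z * z) * (4 * (i * (m * m)))
      shape = solve-∀
      back : ∀ i x z n → i * (16 * (x * x)) * (z * z) * n ≡ i * 16 * (x * z * (x * z) * n)
      back = solve-∀

-- Large n and the number of colours

crossing : ∀ {P : ℕ → Set} → (∀ j → Dec (P j)) → ∀ N → P N → ¬ P 0 → ∃[ j ] (¬ P j × P (suc j))
crossing P? zero p ¬p₀ = ⊥-elim (¬p₀ p)
crossing P? (suc N) p ¬p₀ with P? N
... | yes pN = crossing P? N pN ¬p₀
... | no ¬pN = N , ¬pN , p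

n<2^n : ∀ n → n < 2 ^ n
n<2^n zero = s≤s z≤n
n<2^n (suc n) = begin
  suc (suc n)              ≤⟨ s≤s (n<2^n n) ⟩
  suc (2 ^ n)              ≤⟨ +-monoˡ-≤ (2 ^ n) (m^n>0 2 n) ⟩
  2 ^ n + 2 ^ n            ≡⟨ cong (2 ^ n +_) (+-identityʳ (2 ^ n)) ⟨
  2 ^ suc n                ∎
  where open ≤-Reasoning

-- At i = 2A each of A and 2A is at most 2^A; each further step adds A on the left and doubles the
-- right.
linear≤2^ : ∀ A i → 0 < A → A + A ≤ i → A * i ≤ 2 ^ i
linear≤2^ A i 0<A le = subst (λ i → A * i ≤ 2 ^ i) (m+[n∸m]≡n le) (from A (i ∸ (A + A)) 0<A)
  where
  open ≤-Reasoning
  from : ∀ A d → 0 < A → A * (A + A + d) ≤ 2 ^ (A + A + d)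
  from A@(suc c) zero _ = begin
    A * (A + A + 0)            ≡⟨ cong (A *_) (trans (+-identityʳ (A + A)) (cong (A +_) (sym (+-identityʳ A)))) ⟩
    A * (2 * A)                ≤⟨ *-mono-≤ (<⇒≤ (n<2^n A)) (*-monoʳ-≤ 2 (n<2^n c)) ⟩
    2 ^ A * 2 ^ A              ≡⟨ trans (sym (^-distribˡ-+-* 2 A A)) (cong (2 ^_) (sym (+-identityʳ (A + A)))) ⟩
    2 ^ (A + A + 0)            ∎
  from A (suc d) 0<A = begin
    A * (A + A + suc d)                        ≡⟨ trans (cong (A *_) (+-suc (A + A) d)) (*-suc A (A + A + d)) ⟩
    A + A * (A + A + d)                        ≤⟨ +-mono-≤ (≤-trans (≤-trans (m≤m+n A A) (m≤m+n (A + A) d)) (<⇒≤ (n<2^n (A + A + d)))) (from A d 0<A) ⟩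
    2 ^ (A + A + d) + 2 ^ (A + A + d)          ≡⟨ cong (2 ^ (A + A + d) +_) (+-identityʳ (2 ^ (A + A + d))) ⟨
    2 ^ suc (A + A + d)                        ≡⟨ cong (2 ^_) (+-suc (A + A) d) ⟨
    2 ^ (A + A + suc d)                        ∎

-- As p is at least 1, it is enough to treat ε = 1/q: then q P ≤ q s + q ℓ ≤ q s + P.
discount : ∀ p q P s ℓ → 0 < p → P ≤ s + ℓ → q * ℓ ≤ P → (q ∸ p) * P ≤ q * s
discount p zero P s ℓ 0<p _ _ = ≤-trans (≤-reflexive (cong (_* P) (0∸n≡0 p))) z≤n
discount p (suc q) P s ℓ 0<p cover small = ≤-trans (*-monoˡ-≤ P (∸-monoʳ-≤ (suc q) 0<p)) (+-cancelˡ-≤ P _ _ (begin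
  P + q * P                        ≤⟨ *-monoʳ-≤ (suc q) cover ⟩
  suc q * (s + ℓ)                  ≡⟨ *-distribˡ-+ (suc q) s ℓ ⟩
  suc q * s + suc q * ℓ            ≤⟨ +-monoʳ-≤ (suc q * s) small ⟩
  suc q * s + P                    ≡⟨ +-comm (suc q * s) P ⟩
  P + suc q * s                    ∎))
  where open ≤-Reasoning

module Large (q n : ℕ) (0<q : 0 < q) (n₀≤n : (2 ^ (two^ 64 * q + two^ 64 * q)) ^ 16 ≤ n) where

  open ≤-Reasoning

  private
    A = two^ 64 * q

    0<A : 0 < A
    0<A = *-mono-≤ (two^>0 64) 0<q

    0<n : 0 < n
    0<n = ≤-trans (m^n>0 (2 ^ (A + A)) {{m^n≢0 2 (A + A)}} 16) n₀≤n

    -- Thus i is the integer part of (log₂ n)/16.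
    scale : ∃[ i ] (¬ n < (2 ^ i) ^ 16 × n < (2 ^ suc i) ^ 16)
    scale = crossing (λ i → n <? (2 ^ i) ^ 16) n
      (<-≤-trans (n<2^n n) (≤-trans (≤-reflexive (sym (*-identityʳ (2 ^ n)))) (^-monoʳ-≤ (2 ^ n) {{m^n≢0 2 n}} (≤ᵇ⇒≤ 1 16 tt)))) (<⇒≱ (s≤s 0<n))

  i : ℕ
  i = proj₁ scale

  n≥ : (2 ^ i) ^ 16 ≤ n
  n≥ = ≮⇒≥ (proj₁ (proj₂ scale))

  n≤ : n ≤ two^ 16 * (2 ^ i) ^ 16
  n≤ = ≤-trans (<⇒≤ (proj₂ (proj₂ scale))) (≤-reflexive (trans (^-distribʳ-* 2 (2 ^ i) 16) (cong (_* (2 ^ i) ^ 16) (sym (two^-def 16)))))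

  A+A≤i : A + A ≤ i
  A+A≤i with A + A ≤? i
  ... | yes le = le
  ... | no ≰i = ⊥-elim (<⇒≱ (proj₂ (proj₂ scale)) (≤-trans (^-monoˡ-≤ 16 (^-monoʳ-≤ 2 (≰⇒> ≰i))) n₀≤n))

  0<i : 0 < i
  0<i = ≤-trans 0<A (≤-trans (m≤m+n A A) A+A≤i)

  big : two^ 64 * (q * i) ≤ 2 ^ i
  big = ≤-trans (≤-reflexive (sym (*-assoc (two^ 64) q i))) (linear≤2^ A i 0<A A+A≤i)

  2^16≤u : two^ 16 ≤ 2 ^ i
  2^16≤u = begin
    two^ 16                 ≤⟨ two^-mono (≤ᵇ⇒≤ 16 64 tt) ⟩
    two^ 64                 ≤⟨ m≤m*n (two^ 64) (q * i) {{>-nonZero (*-mono-≤ 0<q 0<i)}} ⟩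
    two^ 64 * (q * i)       ≤⟨ big ⟩
    2 ^ i                   ∎

  n≤2^ : n ≤ 2 ^ (i * 17)
  n≤2^ = ≤-trans n≤ (≤-trans (*-monoˡ-≤ ((2 ^ i) ^ 16) 2^16≤u) (≤-reflexive (^-*-assoc 2 i 17)))

  2≤n : 2 ≤ n
  2≤n = begin
    2                       ≤⟨ ^-monoʳ-≤ 2 0<i ⟩
    2 ^ i                   ≡⟨ *-identityʳ (2 ^ i) ⟨
    (2 ^ i) ^ 1             ≤⟨ ^-monoʳ-≤ (2 ^ i) {{m^n≢0 2 i}} (≤ᵇ⇒≤ 1 16 tt) ⟩
    (2 ^ i) ^ 16            ≤⟨ n≥ ⟩
    n                       ∎

  private
    -- For D = 1: a place where this property switches on gives both inequalities of
    -- `IsCeilDSqrtNOverLog`.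
    Enough : ℕ → Set
    Enough j = 2 ^ (1 * 1 * n) ≤ n ^ (j * j * (1 * 1))

    1*1*n≡n : 1 * 1 * n ≡ n
    1*1*n≡n = *-identityˡ n

    number : ∃[ j ] (¬ Enough j × Enough (suc j))
    number = crossing (λ j → 2 ^ (1 * 1 * n) ≤? n ^ (j * j * (1 * 1))) n enough ¬enough
      where
      ¬enough : ¬ Enough 0
      ¬enough le = <⇒≱ (n<2^n n) (≤-trans (subst (λ x → 2 ^ x ≤ 1) 1*1*n≡n le) 0<n)
      enough : Enough n
      enough = begin
        2 ^ (1 * 1 * n)          ≡⟨ cong (2 ^_) 1*1*n≡n ⟩
        2 ^ n                    ≤⟨ ^-monoˡ-≤ n 2≤n ⟩
        n ^ n                    ≤⟨ ^-monoʳ-≤ n {{>-nonZero 0<n}} (≤-trans (m≤m*n n n {{>-nonZero 0<n}}) (≤-reflexive (sym (*-identityʳ (n * n))))) ⟩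
        n ^ (n * n * (1 * 1))    ∎

  m′ m : ℕ
  m′ = proj₁ number
  m = suc m′

  isCeil : IsCeilDSqrtNOverLog 1 1 n m
  isCeil = ≰⇒> (proj₁ (proj₂ number)) , proj₂ (proj₂ number)

  0<m′ : 0 < m′
  0<m′ = nonzero m′ (proj₂ isCeil)
    where
    nonzero : ∀ j → Enough (suc j) → 0 < j
    nonzero zero le = ⊥-elim (<⇒≱ (n<2^n n) (subst₂ (λ x y → 2 ^ x ≤ y) 1*1*n≡n (*-identityʳ n) le))
    nonzero (suc j) _ = s≤s z≤n

  -- The ceiling bounds only `m′` from above, by 16 i m′² ≤ n; `m ≤ 2 * m′`, valid since `m′` is
  -- positive, costs a factor 4.
  m-upper : 4 * (i * (m * m)) ≤ n
  m-upper = begin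
    4 * (i * (m * m))              ≤⟨ *-monoʳ-≤ 4 (*-monoʳ-≤ i (*-mono-≤ m≤2m′ m≤2m′)) ⟩
    4 * (i * (2 * m′ * (2 * m′)))  ≡⟨ shape i m′ ⟩
    i * 16 * (m′ * m′ * (1 * 1))   ≤⟨ 2^-cancel-≤ _ _ powers ⟩
    n                              ∎
    where
    m≤2m′ : m ≤ 2 * m′
    m≤2m′ = ≤-trans (+-monoˡ-≤ m′ 0<m′) (≤-reflexive (cong (m′ +_) (sym (+-identityʳ m′))))
    shape : ∀ i m → 4 * (i * (2 * m * (2 * m))) ≡ i * 16 * (m * m * (1 * 1))
    shape = solve-∀
    powers : 2 ^ (i * 16 * (m′ * m′ * (1 * 1))) ≤ 2 ^ n
    powers = begin
      2 ^ (i * 16 * (m′ * m′ * (1 * 1)))        ≡⟨ trans (cong (_^ (m′ * m′ * (1 * 1))) (^-*-assoc 2 i 16)) (^-*-assoc 2 (i * 16) (m′ * m′ * (1 * 1))) ⟨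
      ((2 ^ i) ^ 16) ^ (m′ * m′ * (1 * 1))      ≤⟨ ^-monoˡ-≤ (m′ * m′ * (1 * 1)) n≥ ⟩
      n ^ (m′ * m′ * (1 * 1))                   ≤⟨ <⇒≤ (proj₁ isCeil) ⟩
      2 ^ (1 * 1 * n)                           ≡⟨ cong (2 ^_) 1*1*n≡n ⟩
      2 ^ n                                     ∎

  m-lower : n ≤ 32 * (i * (m * m))
  m-lower = begin
    n                                ≤⟨ 2^-cancel-≤ _ _ powers ⟩
    i * 17 * (m * m * (1 * 1))       ≡⟨ shape i m ⟩
    17 * (i * (m * m))               ≤⟨ *-monoˡ-≤ (i * (m * m)) (≤ᵇ⇒≤ 17 32 tt) ⟩
    32 * (i * (m * m))               ∎
    where
    shape : ∀ i m → i * 17 * (m * m * (1 * 1)) ≡ 17 * (i * (m * m))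
    shape = solve-∀
    powers : 2 ^ n ≤ 2 ^ (i * 17 * (m * m * (1 * 1)))
    powers = begin
      2 ^ n                                     ≡⟨ cong (2 ^_) 1*1*n≡n ⟨
      2 ^ (1 * 1 * n)                           ≤⟨ proj₂ isCeil ⟩
      n ^ (m * m * (1 * 1))                     ≤⟨ ^-monoˡ-≤ (m * m * (1 * 1)) n≤2^ ⟩
      (2 ^ (i * 17)) ^ (m * m * (1 * 1))        ≡⟨ ^-*-assoc 2 (i * 17) (m * m * (1 * 1)) ⟩
      2 ^ (i * 17 * (m * m * (1 * 1)))          ∎

  module N = Numerics q i m′ n 0<q 0<i big n≥ n≤ m-lower m-upper

  large-packing : Packing n m N.k N.ℓ
  -- 64 is the density `b` of blocks, and `u` serves as the Chernoff parameter for blocks and for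
  -- boxes.
  large-packing = packing n N.M m′ N.h N.t 64 N.D N.u N.K N.R₀ N.f N.k N.E N.u
    N.0<M (s≤s z≤n) N.0<u N.0<u (*-mono-≤ {1} {1280} (s≤s z≤n) (*-mono-≤ 0<i (*-mono-≤ 0<n N.0<M)))
    N.fibres-rare N.boxes-rare N.sides-rare N.degrees-rare N.dense-rare N.missing-rare N.few-lost
    N.h+h≤f*t N.room

theorem1p1 : ∀ (p q : ℕ) → 0 < p → 0 < q →
    ∃[ n₀ ] ∃[ c ] ∃[ d ] ∃[ a ] ∃[ b ]
    (0 < c × 0 < d × 0 < a × 0 < b ×
    (∀ n → n₀ ≤ n →
    ∃[ m ] (IsCeilDSqrtNOverLog a b n m ×
    ∃[ G ] (PairwiseEdgeDisjoint {n} {m} G ×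
    (∀ i → TriangleFree (G i)) ×
    (∀ i → AlphaAtMost (G i) c d) ×
    EdgeSumBound p q (sumEdges G) n))))
theorem1p1 p q 0<p 0<q =
  -- Only n₀ depends on ε: it makes i at least 2 * 2^64 q, so that 2^i exceeds 2^64 q i. The
  -- constants C = 2^46 and D = 1 are absolute.
  (2 ^ (two^ 64 * q + two^ 64 * q)) ^ 16 , two^ 46 , 1 , 1 , 1 ,
  two^>0 46 , s≤s z≤n , s≤s z≤n , s≤s z≤n , λ n n₀≤n →
    let module L = Large q n 0<q n₀≤n
        P = L.large-packing
        G = Packing.G P
    in L.m , L.isCeil , G , Packing.disjoint P , Packing.triangle-free P ,
       (λ i S indep → L.N.independence-bound ∣ S ∣ (Packing.independent< P i S indep)) ,
       subst (λ B → (q ∸ p) * B ≤ q * sumEdges G) (sym (C2≡pairs n))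
         (discount p q (pairs n) (sumEdges G) L.N.ℓ 0<p (Packing.covered P) L.N.q*ℓ≤pairs)
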